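{- Fix an integer $n \ge 1$. For every face $D$ of the wiggly complex (i.e. every set $D$ of pairwise compatible internal wiggly arcs), the vectors $\mathbf{g}(\alpha)$, $\alpha \in D$, are linearly independent, and the collection of cones $\mathbb{R}_{\ge 0}\,\mathbf{g}(D) = \{\sum_{\alpha\in D}\lambda_\alpha \mathbf{g}(\alpha) : \lambda_\alpha \ge 0\}$, for all faces $D$ of the wiggly complex, forms a complete simplicial fan of the hyperplane $\mathbb{H}_{2n}=\{\mathbf{x}\in\mathbb{R}^{2n} : \sum_{k} x_k = 0\}$ (the wiggly fan).
   Context: Consider the $n+2$ points $0,1,\dots,n+1$ on the horizontal axis. A wiggly arc is a quadruple $\alpha=(i,j,A,B)$ with $0\le i<j\le n+1$ and $A,B$ a partition of $\{i+1,\dots,j-1\}$; it is represented by an abscissa-monotone curve from point $i$ to point $j$ passing above the points of $A$ and below the points of $B$. The external wiggly arcs are $(0,n+1,[n],\varnothing)$ and $(0,n+1,\varnothing,[n])$; all others are internal. Two wiggly arcs $(i,j,A,B)$ and $(i',j',A',B')$ are non pointed if $i=j'$ or $i'=j$; they are crossing if $(A\cap B')\cup(\{i,j\}\cap B')\cup(A\cap\{i',j'\})\ne\varnothing$ and $(A'\cap B)\cup(\{i',j'\}\cap B)\cup(A'\cap\{i,j\})\ne\varnothing$; they are compatible if they are neither non pointed nor crossing. The wiggly complex is the simplicial complex whose faces are the sets of pairwise compatible internal wiggly arcs. For a wiggly arc $\alpha=(i,j,A,B)$ let $\alpha^+=(\{2i-1,2j\}\setminus\{ -1,2n+2\})\cup\{2a-1,2a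 : a\in A\}$ and $\alpha^-=(\{2i,2j-1\}\setminus\{0,2n+1\})\cup\{2b-1,2b : b\in B\}$, let $\hat{\mathbf{g}}(\alpha)=\mathbf{1}_{\alpha^+}-\mathbf{1}_{\alpha^- }\in\mathbb{R}^{2n}$ (where $\mathbf{1}_X=\sum_{x\in X}\mathbf{e}_x$), and let the $\mathbf{g}$-vector be $\mathbf{g}(\alpha)=\pi(\hat{\mathbf{g}}(\alpha))$, where $\pi(\mathbf{x})=\mathbf{x}-\frac{\langle \mathbf{x},\mathbf{1}_{2n}\rangle}{2n}\mathbf{1}_{2n}$ is the orthogonal projection onto $\mathbb{H}_{2n}$. For a set $D$ of wiggly arcs, $\mathbf{g}(D)=\{\mathbf{g}(\alpha):\alpha\in D \text{ internal}\}$.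
   Formalization: The theorem is stated over the rational numbers: vectors, points of the hyperplane, cone coefficients, linear-dependence coefficients and supporting functionals are all rational instead of real. -}

module Defs where

open import Data.Bool using (Bool; true; false; _∧_; _∨_; not; if_then_else_)
open import Data.Nat as ℕ using (ℕ; zero; suc; _∸_; _≤ᵇ_; _<ᵇ_; _≡ᵇ_)
open import Data.Fin using (Fin; toℕ)
open import Data.Fin.Subset using (Subset; _∈_; _∉_)
open import Data.Vec using (lookup)
open import Data.List using (List; length; allFin)
open import Data.Bool.ListAction using (any)
import Data.List as L
open import Data.Integer using (+_)
open import Data.Rational using (ℚ; 0ℚ; 1ℚ; _+_; _*_; _-_; _≤_; _/_)
open import Data.Product using (Σ; ∃; _×_)
open import Data.Sum using (_⊎_)
open import Relation.Nullary using (¬_)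
open import Relation.Binary.PropositionalEquality using (_≡_; _≢_)
open import Data.List.Membership.Propositional using () renaming (_∈_ to _∈ˡ_)
open import Data.List.Relation.Unary.All using (All)
open import Data.List.Relation.Unary.Unique.Propositional using (Unique)

Pt : ℕ → Set
Pt n = Fin (suc (suc n))

-- (i, j, A, B) with i < j, A ⊆ {i+1..j-1}, and B = {i+1..j-1} \ A.
-- B is determined by A, so it is not stored; proof fields are irrelevant
-- so that equality of arcs is equality of the data (i, j, A).
record Arc (n : ℕ) : Set where
  constructor mkArc
  field
    i j : Pt n
    .i<j : toℕ i ℕ.< toℕ j
    A : Subset (suc (suc n))
    .A⊆ : ∀ k → k ∈ A → (toℕ i ℕ.< toℕ k) × (toℕ k ℕ.< toℕ j)
open Arc public

InA : ∀ {n} → Arc n → Pt n → Set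
InA α k = k ∈ A α

InB : ∀ {n} → Arc n → Pt n → Set
InB α k = (toℕ (i α) ℕ.< toℕ k) × (toℕ k ℕ.< toℕ (j α)) × (k ∉ A α)

InEnds : ∀ {n} → Arc n → Pt n → Set
InEnds α k = (k ≡ i α) ⊎ (k ≡ j α)

InBracket : ∀ n → Pt n → Set
InBracket n k = (1 ℕ.≤ toℕ k) × (toℕ k ℕ.≤ n)

IsExternal : ∀ {n} → Arc n → Set
IsExternal {n} α =
  (toℕ (i α) ≡ 0) × (toℕ (j α) ≡ suc n) ×
  ( ((∀ k → InA α k → InBracket n k) × (∀ k → InBracket n k → InA α k))
  ⊎ ((∀ k → InB α k → InBracket n k) × (∀ k → InBracket n k → InB α k)) )

Internal : ∀ {n} → Arc n → Set
Internal α = ¬ IsExternal α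

NonPointed : ∀ {n} → Arc n → Arc n → Set
NonPointed α β = (i α ≡ j β) ⊎ (i β ≡ j α)

HalfCross : ∀ {n} → Arc n → Arc n → Set
HalfCross α β = ∃ λ k → (InA α k × InB β k) ⊎ (InEnds α k × InB β k) ⊎ (InA α k × InEnds β k)

Crossing : ∀ {n} → Arc n → Arc n → Set
Crossing α β = HalfCross α β × HalfCross β α

Compatible : ∀ {n} → Arc n → Arc n → Set
Compatible α β = ¬ NonPointed α β × ¬ Crossing α β

WigglyFace : ∀ n → List (Arc n) → Set
WigglyFace n D =
  Unique D × All Internal D ×
  (∀ α β → α ∈ˡ D → β ∈ˡ D → α ≢ β → Compatible α β)

-- Vectors in ℚ^d (coordinates 1..d stored at Fin positions 0..d-1)

Vect : ℕ → Set
Vect d = Fin d → ℚ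

sumF : ∀ {d} → (Fin d → ℚ) → ℚ
sumF {zero} f = 0ℚ
sumF {suc d} f = f Fin.zero + sumF (λ k → f (Fin.suc k))
  where import Data.Fin as Fin

invℕ : ℕ → ℚ
invℕ zero = 0ℚ
invℕ (suc m) = + 1 / suc m

-- orthogonal projection onto H_d
proj : ∀ {d} → Vect d → Vect d
proj {d} x p = x p - (sumF x * invℕ d)

ind : Bool → ℚ
ind b = if b then 1ℚ else 0ℚ

-- membership (Bool) of the 1-based index x in α⁺ and α⁻
inPlus : ∀ {n} → Arc n → ℕ → Bool
inPlus {n} α x =
  ((1 ≤ᵇ toℕ (i α)) ∧ (x ≡ᵇ (2 ℕ.* toℕ (i α) ∸ 1))) ∨
  ((toℕ (j α) ≤ᵇ n) ∧ (x ≡ᵇ 2 ℕ.* toℕ (j α))) ∨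
  any (λ a → lookup (A α) a ∧ ((x ≡ᵇ (2 ℕ.* toℕ a ∸ 1)) ∨ (x ≡ᵇ 2 ℕ.* toℕ a)))
      (allFin (suc (suc n)))

inBᵇ : ∀ {n} → Arc n → Pt n → Bool
inBᵇ α b = (toℕ (i α) <ᵇ toℕ b) ∧ (toℕ b <ᵇ toℕ (j α)) ∧ not (lookup (A α) b)

inMinus : ∀ {n} → Arc n → ℕ → Bool
inMinus {n} α x =
  ((1 ≤ᵇ toℕ (i α)) ∧ (x ≡ᵇ 2 ℕ.* toℕ (i α))) ∨
  ((toℕ (j α) ≤ᵇ n) ∧ (x ≡ᵇ (2 ℕ.* toℕ (j α) ∸ 1))) ∨
  any (λ b → inBᵇ α b ∧ ((x ≡ᵇ (2 ℕ.* toℕ b ∸ 1)) ∨ (x ≡ᵇ 2 ℕ.* toℕ b)))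
      (allFin (suc (suc n)))

ghat : ∀ {n} → Arc n → Vect (2 ℕ.* n)
ghat α p = ind (inPlus α (suc (toℕ p))) - ind (inMinus α (suc (toℕ p)))

gvec : ∀ {n} → Arc n → Vect (2 ℕ.* n)
gvec α = proj (ghat α)

gvecs : ∀ {n} → List (Arc n) → List (Vect (2 ℕ.* n))
gvecs D = L.map gvec D

comb : ∀ {d} (V : List (Vect d)) → (Fin (length V) → ℚ) → Vect d
comb V c p = sumF (λ k → c k * L.lookup V k p)

LinIndep : ∀ {d} → List (Vect d) → Set
LinIndep V = ∀ c → (∀ p → comb V c p ≡ 0ℚ) → ∀ k → c k ≡ 0ℚ

Cone : ∀ {d} → List (Vect d) → Vect d → Set
Cone V x = ∃ λ c → (∀ k → 0ℚ ≤ c k) × (∀ p → x p ≡ comb V c p)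

InH : ∀ {d} → Vect d → Set
InH x = sumF x ≡ 0ℚ

dot : ∀ {d} → Vect d → Vect d → ℚ
dot f x = sumF (λ p → f p * x p)

SameSet : ∀ {d} → (Vect d → Set) → (Vect d → Set) → Set
SameSet S T = ∀ x → (S x → T x) × (T x → S x)

IsFaceOf : ∀ {d} → (Vect d → Set) → (Vect d → Set) → Set
IsFaceOf F C = ∃ λ f → (∀ x → C x → 0ℚ ≤ dot f x)
                     × SameSet F (λ x → C x × (dot f x ≡ 0ℚ))

_∩_ : ∀ {d} → (Vect d → Set) → (Vect d → Set) → Vect d → Set
(S ∩ T) x = S x × T x

IsFanIn-H : ∀ {d} {I : Set} → (I → Set) → (I → Vect d → Set) → Set₁
IsFanIn-H {d} P C =
  (∀ a → P a → ∀ x → C a x → InH x) ×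
  (∀ a → P a → (F : Vect d → Set) → IsFaceOf F (C a) →
     ∃ λ b → P b × SameSet (C b) F) ×
  (∀ a b → P a → P b → IsFaceOf (C a ∩ C b) (C a) × IsFaceOf (C a ∩ C b) (C b))

IsCompleteIn-H : ∀ {d} {I : Set} → (I → Set) → (I → Vect d → Set) → Set
IsCompleteIn-H P C = ∀ x → InH x → ∃ λ a → P a × C a x

{-# OPTIONS --safe #-}
-- Record how an arc behaves at each point by a letter: it starts there, ends there,
-- passes above or passes below. For weights c on pairwise compatible arcs, the
-- coordinates 2k - 1 and 2k of Σ c ĝ determine the weight above k minus the weight
-- below k and, since by pointedness arcs start and end at k only in one of the two
-- ways, also the weights starting and ending at k. Given the total weight leaving
-- point 0, a sweep from left to right then knows all four weights at every point, and
-- compatible arcs are linearly ordered between consecutive points, so there is exactly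
-- one way of distributing the weights. The total weight is free because the two
-- external arcs have opposite vectors ± 1 and are compatible with every arc, and these
-- vectors vanish under the projection π. Hence every vector of the hyperplane is a
-- nonnegative combination of the g-vectors of exactly one coherent system of weights;
-- linear independence and the intersection property follow from this uniqueness.
module Submission where

open import Defs
open import Data.Bool as Bool using (Bool; true; false; T; _∧_; _∨_; not)
open import Data.Bool.ListAction using (any)
open import Data.Bool.Properties using (T-∧; T-∨; T-not-≡)
open import Data.Empty using (⊥; ⊥-elim)
open import Data.Fin using (Fin; zero; suc; inject₁; toℕ; fromℕ<)
import Data.Fin.Properties as Fin
open import Data.Fin.Subset using (Subset; inside; outside; _∈_) renaming (⊥ to ∅)
open import Data.Fin.Subset.Properties using (Empty-unique)
import Data.Integer as ℤ
import Data.Integer.Properties as ℤ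
open import Data.List as L using (List; []; _∷_; _++_; map; filter; length; allFin)
open import Data.List.Membership.Propositional using (lose)
  renaming (_∈_ to _∈ˡ_; _∉_ to _∉ˡ_)
open import Data.List.Membership.Propositional.Properties
  using (∈-allFin; ∈-map⁺; ∈-map⁻; ∈-++⁺ˡ; ∈-++⁺ʳ; ∈-filter⁺; ∈-filter⁻)
open import Data.List.Relation.Unary.All as All using (All; []; _∷_)
import Data.List.Relation.Unary.All.Properties as All
open import Data.List.Relation.Unary.AllPairs using ([]; _∷_)
open import Data.List.Relation.Unary.Any as Any using (here; there)
open import Data.List.Relation.Unary.Any.Properties using (any⁺; any⁻)
open import Data.List.Relation.Unary.Unique.Propositional using (Unique)
import Data.List.Relation.Unary.Unique.Propositional.Properties as Unique
open import Data.Nat as ℕ using (ℕ; zero; suc; _∸_; _≤ᵇ_; _<ᵇ_; _≡ᵇ_; s≤s; z≤n)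
import Data.Nat.Coprimality as Coprime
import Data.Nat.Properties as ℕ
open import Data.Product using (Σ; ∃; _×_; _,_; proj₁; proj₂; swap)
open import Data.Rational
  using (ℚ; mkℚ; 0ℚ; 1ℚ; ½; _+_; _*_; _-_; -_; _/_; 1/_; _≤_; _<_; _⊔_; nonNegative; ≢-nonZero)
import Data.Rational.Properties as ℚ
open import Data.Rational.Solver using (module +-*-Solver)
open import Data.Sum as Sum using (_⊎_; inj₁; inj₂; [_,_]′)
open import Data.Vec using (lookup; []; _∷_; here; there)
open import Data.Vec.Properties using (lookup⇒[]=; []=⇒lookup; lookup-replicate; ≡-dec)
open import Function using (_∘_; Equivalence)
open import Relation.Binary.PropositionalEquality
open import Relation.Nullary using (¬_; Dec; yes; no; contradiction)
open import Relation.Nullary.Decidable using (recompute)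
open +-*-Solver using (solve; _:+_; _:*_; _:-_; :-_; _:=_; con)

-- Rational arithmetic

-- The induction runs over weights on all words, not over sets of arcs. Arcs that pass below the
-- first point, start there or pass above it can have the same remainder, and a set of arcs would
-- lose this multiplicity when the point is forgotten. `next` adds the three weights, so going back
-- means cutting one weight function into three parts with prescribed totals. Compatibility leaves
-- one order for the cut: below, starting, above, with no part above a later one. An exchange
-- argument shows that such a cut is unique, and filling from below shows that it exists; no sorted
-- list of arcs is ever formed. Uniqueness rests on the fact that two distinct live words are
-- comparable at the first point where they differ. Before the projection the coordinates leave the
-- total weight at point 0 open; after it a common shift of all coordinates is open too. These two
-- degrees of freedom match the two external arcs, whose weights change the total by their sum and
-- the coordinates by their difference.

+-nonneg : ∀ {a b} → 0ℚ ≤ a → 0ℚ ≤ b → 0ℚ ≤ a + b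
+-nonneg = ℚ.+-mono-≤

*-nonneg : ∀ {a b} → 0ℚ ≤ a → 0ℚ ≤ b → 0ℚ ≤ a * b
*-nonneg {a} {b} 0≤a 0≤b =
  subst (_≤ a * b) (ℚ.*-zeroʳ a) (ℚ.*-monoˡ-≤-nonNeg a {{nonNegative 0≤a}} 0≤b)

pos-+ : ∀ {a b} → 0ℚ < a + b → 0ℚ < a ⊎ 0ℚ < b
pos-+ {a} {b} 0<a+b with 0ℚ ℚ.<? a
... | yes 0<a = inj₁ 0<a
... | no  0≮a = inj₂ (ℚ.<-≤-trans 0<a+b
  (subst (a + b ≤_) (ℚ.+-identityˡ b) (ℚ.+-monoˡ-≤ b (ℚ.≮⇒≥ 0≮a))))

≤∧≮⇒≡ : ∀ {a b} → a ≤ b → ¬ (a < b) → a ≡ b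
≤∧≮⇒≡ a≤b a≮b = ℚ.≤-antisym a≤b (ℚ.≮⇒≥ a≮b)

0≤a-b : ∀ {a b} → b ≤ a → 0ℚ ≤ a - b
0≤a-b {a} {b} b≤a = subst (_≤ a - b) (ℚ.+-inverseʳ b) (ℚ.+-monoˡ-≤ (- b) b≤a)

pos-part : ℚ → ℚ
pos-part q = q ⊔ 0ℚ

pos-part-nonneg : ∀ q → 0ℚ ≤ pos-part q
pos-part-nonneg q = ℚ.p≤q⊔p q 0ℚ

pos-part-difference : ∀ q → pos-part q - pos-part (- q) ≡ q
pos-part-difference q with ℚ.≤-total q 0ℚ
... | inj₁ q≤0 = trans (cong₂ _-_ (ℚ.p≤q⇒p⊔q≡q q≤0) (ℚ.p≥q⇒p⊔q≡p (ℚ.neg-antimono-≤ q≤0)))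
                       (solve 1 (λ q → con 0ℚ :- (:- q) := q) refl q)
... | inj₂ 0≤q = trans (cong₂ _-_ (ℚ.p≥q⇒p⊔q≡p 0≤q) (ℚ.p≤q⇒p⊔q≡q (ℚ.neg-antimono-≤ 0≤q)))
                       (solve 1 (λ q → q :- con 0ℚ := q) refl q)

pos-part-zero : ∀ q → pos-part q ≡ 0ℚ ⊎ pos-part (- q) ≡ 0ℚ
pos-part-zero q with ℚ.≤-total q 0ℚ
... | inj₁ q≤0 = inj₁ (ℚ.p≤q⇒p⊔q≡q q≤0)
... | inj₂ 0≤q = inj₂ (ℚ.p≤q⇒p⊔q≡q (ℚ.neg-antimono-≤ 0≤q))

disjoint⇒pos-part : ∀ {a b} → 0ℚ ≤ a → 0ℚ ≤ b → a ≡ 0ℚ ⊎ b ≡ 0ℚ → a ≡ pos-part (a - b)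
disjoint⇒pos-part {b = b} _ 0≤b (inj₁ refl) = sym (ℚ.p≤q⇒p⊔q≡q
  (subst (_≤ 0ℚ) (sym (ℚ.+-identityˡ (- b))) (ℚ.neg-antimono-≤ 0≤b)))
disjoint⇒pos-part {a = a} 0≤a _ (inj₂ refl) =
  sym (trans (cong pos-part (solve 1 (λ q → q :- con 0ℚ := q) refl a)) (ℚ.p≥q⇒p⊔q≡p 0≤a))

-- Words

data Phase : Set where
  idle live : Phase

-- A word of length N describes an arc on N consecutive points: `idle` words
-- begin before its first endpoint, `live` words between its two endpoints.
data Word : Phase → ℕ → Set where
  skip  : ∀ {N} → Word idle N → Word idle (suc N)
  start : ∀ {N} → Word live N → Word idle (suc N)
  end   : ∀ {N} → Word live (suc N)
  up dn : ∀ {N} → Word live N → Word live (suc N)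

-- Letters and compatibility of letter sequences

data Letter : Set where
  none first last above below : Letter

letter : ∀ {s N} → Word s N → Fin N → Letter
letter (skip w)  zero    = none
letter (skip w)  (suc k) = letter w k
letter (start p) zero    = first
letter (start p) (suc k) = letter p k
letter end       zero    = last
letter end       (suc k) = none
letter (up p)    zero    = above
letter (up p)    (suc k) = letter p k
letter (dn p)    zero    = below
letter (dn p)    (suc k) = letter p k

-- The five pairs are the three intersections in the definition of crossing, read at a single point.
-- Two endpoints at the same point are not comparable.
data Over : Letter → Letter → Set where
  above-below : Over above below
  above-first : Over above first
  above-last  : Over above last
  first-below : Over first below
  last-below  : Over last below

data Clash : Letter → Letter → Set where
  first-last : Clash first last
  last-first : Clash last first

Above : ∀ {N} → (Fin N → Letter) → (Fin N → Letter) → Set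
Above f g = ∃ λ k → Over (f k) (g k)

-- Stated for letter sequences rather than words, so that words of different phases can be compared
-- and the first point is dropped by composing with `suc`.
Compat : ∀ {N} → (Fin N → Letter) → (Fin N → Letter) → Set
Compat f g = (∀ k → ¬ Clash (f k) (g k)) × ¬ (Above f g × Above g f)

¬Over-refl : ∀ {x} → ¬ Over x x
¬Over-refl ()

¬Clash-refl : ∀ {x} → ¬ Clash x x
¬Clash-refl ()

¬Over-none : ∀ {x} → ¬ Over x none
¬Over-none ()

Clash-sym : ∀ {x y} → Clash x y → Clash y x
Clash-sym first-last = last-first
Clash-sym last-first = first-last

Compat-refl : ∀ {N} (f : Fin N → Letter) → Compat f f
Compat-refl f = (λ k → ¬Clash-refl) , λ ((k , o) , _) → ¬Over-refl o

Compat-sym : ∀ {N} {f g : Fin N → Letter} → Compat f g → Compat g f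
Compat-sym (nc , nx) = (λ k c → nc k (Clash-sym c)) , λ (a , b) → nx (b , a)

Compat-tail : ∀ {N} {f g : Fin (suc N) → Letter} → Compat f g → Compat (f ∘ suc) (g ∘ suc)
Compat-tail (nc , nx) =
  (λ k → nc (suc k)) , λ ((k , o) , (l , o')) → nx ((suc k , o) , (suc l , o'))

Above-cons : ∀ {N} {f g : Fin (suc N) → Letter} →
  ¬ Over (f zero) (g zero) → ¬ Above (f ∘ suc) (g ∘ suc) → ¬ Above f g
Above-cons nh nt (zero , o)  = nh o
Above-cons nh nt (suc k , o) = nt (k , o)

Compat-cons : ∀ {N} {f g : Fin (suc N) → Letter} → ¬ Clash (f zero) (g zero) →
  ¬ Over (f zero) (g zero) → ¬ Over (g zero) (f zero) →
  Compat (f ∘ suc) (g ∘ suc) → Compat f g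
Compat-cons nc fg gf (ncs , nx) =
  (λ { zero → nc ; (suc k) → ncs k }) ,
  λ { ((zero , o) , _)          → fg o
    ; ((suc k , o) , (zero , o')) → gf o'
    ; ((suc k , o) , (suc l , o')) → nx ((k , o) , (l , o')) }

-- A crossing needs both directions, so it is enough to exclude one of them at the first point and
-- on the tails. Used when `g` may lie over `f` at the first point, where `Compat-cons` does not
-- apply.
Compat-cons-ordered : ∀ {N} {f g : Fin (suc N) → Letter} → ¬ Clash (f zero) (g zero) →
  ¬ Over (f zero) (g zero) → Compat (f ∘ suc) (g ∘ suc) →
  ¬ Above (f ∘ suc) (g ∘ suc) → Compat f g
Compat-cons-ordered nc fg (ncs , _) nx =
  (λ { zero → nc ; (suc k) → ncs k }) , λ (a , _) → Above-cons fg nx a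

-- The `Over` at the first point is already one half of a crossing; a later point in the other
-- direction would complete it.
ordered-tails : ∀ {N} {f g : Fin (suc N) → Letter} → Over (g zero) (f zero) →
  Compat f g → ¬ Above (f ∘ suc) (g ∘ suc)
ordered-tails o (_ , nx) (k , o') = nx ((suc k , o') , (zero , o))

-- At the first point where two live words differ, both letters are among `last`, `above` and
-- `below`, and any two of these are comparable by `Over`.
Above-antisym : ∀ {N} (p q : Word live N) →
  ¬ Above (letter p) (letter q) → ¬ Above (letter q) (letter p) → p ≡ q
Above-antisym end    end    _ _ = refl
Above-antisym end    (up q) _ h = ⊥-elim (h (zero , above-last))
Above-antisym end    (dn q) h _ = ⊥-elim (h (zero , last-below))
Above-antisym (up p) end    h _ = ⊥-elim (h (zero , above-last))
Above-antisym (up p) (up q) h h' = cong up (Above-antisym p q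
  (λ (k , o) → h (suc k , o)) (λ (k , o) → h' (suc k , o)))
Above-antisym (up p) (dn q) h _ = ⊥-elim (h (zero , above-below))
Above-antisym (dn p) end    _ h = ⊥-elim (h (zero , last-below))
Above-antisym (dn p) (up q) _ h = ⊥-elim (h (zero , above-below))
Above-antisym (dn p) (dn q) h h' = cong dn (Above-antisym p q
  (λ (k , o) → h (suc k , o)) (λ (k , o) → h' (suc k , o)))

-- Sums over all words

sumW : ∀ {s N} → (Word s N → ℚ) → ℚ
sumW {idle} {zero}  f = 0ℚ
sumW {live} {zero}  f = 0ℚ
sumW {idle} {suc N} f = sumW (f ∘ skip) + sumW (f ∘ start)
sumW {live} {suc N} f = f end + (sumW (f ∘ up) + sumW (f ∘ dn))

sumW-cong : ∀ {s N} {f g : Word s N → ℚ} → (∀ w → f w ≡ g w) → sumW f ≡ sumW g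
sumW-cong {idle} {zero}  h = refl
sumW-cong {live} {zero}  h = refl
sumW-cong {idle} {suc N} h = cong₂ _+_ (sumW-cong (h ∘ skip)) (sumW-cong (h ∘ start))
sumW-cong {live} {suc N} h =
  cong₂ _+_ (h end) (cong₂ _+_ (sumW-cong (h ∘ up)) (sumW-cong (h ∘ dn)))

+-interchange : ∀ a b c d → (a + b) + (c + d) ≡ (a + c) + (b + d)
+-interchange = solve 4 (λ a b c d → (a :+ b) :+ (c :+ d) := (a :+ c) :+ (b :+ d)) refl

sumW-+ : ∀ {s N} (f g : Word s N → ℚ) → sumW (λ w → f w + g w) ≡ sumW f + sumW g
sumW-+ {idle} {zero}  f g = refl
sumW-+ {live} {zero}  f g = refl
sumW-+ {idle} {suc N} f g =
  trans (cong₂ _+_ (sumW-+ (f ∘ skip) (g ∘ skip)) (sumW-+ (f ∘ start) (g ∘ start)))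
        (+-interchange (sumW (f ∘ skip)) _ _ _)
sumW-+ {live} {suc N} f g =
  trans (cong (f end + g end +_) (trans
          (cong₂ _+_ (sumW-+ (f ∘ up) (g ∘ up)) (sumW-+ (f ∘ dn) (g ∘ dn)))
          (+-interchange (sumW (f ∘ up)) _ _ _)))
        (+-interchange (f end) (g end) (sumW (f ∘ up) + sumW (f ∘ dn)) _)

sumW-*ʳ : ∀ {s N} (f : Word s N → ℚ) c → sumW (λ w → f w * c) ≡ sumW f * c
sumW-*ʳ {idle} {zero}  f c = sym (ℚ.*-zeroˡ c)
sumW-*ʳ {live} {zero}  f c = sym (ℚ.*-zeroˡ c)
sumW-*ʳ {idle} {suc N} f c =
  trans (cong₂ _+_ (sumW-*ʳ (f ∘ skip) c) (sumW-*ʳ (f ∘ start) c)) (sym (ℚ.*-distribʳ-+ c (sumW (f ∘ skip)) _))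
sumW-*ʳ {live} {suc N} f c =
  trans (cong (f end * c +_) (trans
          (cong₂ _+_ (sumW-*ʳ (f ∘ up) c) (sumW-*ʳ (f ∘ dn) c)) (sym (ℚ.*-distribʳ-+ c (sumW (f ∘ up)) _))))
        (sym (ℚ.*-distribʳ-+ c (f end) _))

sumW-zero : ∀ {s N} {f : Word s N → ℚ} → (∀ w → f w ≡ 0ℚ) → sumW f ≡ 0ℚ
sumW-zero {idle} {zero}  h = refl
sumW-zero {live} {zero}  h = refl
sumW-zero {idle} {suc N} h = cong₂ _+_ (sumW-zero (h ∘ skip)) (sumW-zero (h ∘ start))
sumW-zero {live} {suc N} h =
  cong₂ _+_ (h end) (cong₂ _+_ (sumW-zero (h ∘ up)) (sumW-zero (h ∘ dn)))

sumW-mono : ∀ {s N} {f g : Word s N → ℚ} → (∀ w → f w ≤ g w) → sumW f ≤ sumW g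
sumW-mono {idle} {zero}  h = ℚ.≤-refl
sumW-mono {live} {zero}  h = ℚ.≤-refl
sumW-mono {idle} {suc N} h = ℚ.+-mono-≤ (sumW-mono (h ∘ skip)) (sumW-mono (h ∘ start))
sumW-mono {live} {suc N} h =
  ℚ.+-mono-≤ (h end) (ℚ.+-mono-≤ (sumW-mono (h ∘ up)) (sumW-mono (h ∘ dn)))

sumW-mono-strict : ∀ {s N} {f g : Word s N → ℚ} → (∀ w → f w ≤ g w) →
  ∀ w → f w < g w → sumW f < sumW g
sumW-mono-strict h (skip w) lt =
  ℚ.+-mono-<-≤ (sumW-mono-strict (h ∘ skip) w lt) (sumW-mono (h ∘ start))
sumW-mono-strict h (start p) lt =
  ℚ.+-mono-≤-< (sumW-mono (h ∘ skip)) (sumW-mono-strict (h ∘ start) p lt)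
sumW-mono-strict h end lt =
  ℚ.+-mono-<-≤ lt (ℚ.+-mono-≤ (sumW-mono (h ∘ up)) (sumW-mono (h ∘ dn)))
sumW-mono-strict h (up p) lt =
  ℚ.+-mono-≤-< (h end) (ℚ.+-mono-<-≤ (sumW-mono-strict (h ∘ up) p lt) (sumW-mono (h ∘ dn)))
sumW-mono-strict h (dn p) lt =
  ℚ.+-mono-≤-< (h end) (ℚ.+-mono-≤-< (sumW-mono (h ∘ up)) (sumW-mono-strict (h ∘ dn) p lt))

sumW-nonneg : ∀ {s N} {f : Word s N → ℚ} → (∀ w → 0ℚ ≤ f w) → 0ℚ ≤ sumW f
sumW-nonneg {s} {N} {f} h =
  subst (_≤ sumW f) (sumW-zero {s} {N} (λ _ → refl)) (sumW-mono h)

sumW-zero⁻¹ : ∀ {s N} {f : Word s N → ℚ} → (∀ w → 0ℚ ≤ f w) → sumW f ≡ 0ℚ → ∀ w → f w ≡ 0ℚ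
sumW-zero⁻¹ {s} {N} h eq w = sym (≤∧≮⇒≡ (h w) λ lt → ℚ.<-irrefl
  (trans (sumW-zero {s} {N} (λ _ → refl)) (sym eq)) (sumW-mono-strict h w lt))

-- Uniqueness of ordered splittings

-- Expresses that μ lies below ν. One word may have weight in both, since no word is above itself.
Ordered : ∀ {N} → (Word live N → ℚ) → (Word live N → ℚ) → Set
Ordered μ ν = ∀ p q → 0ℚ < μ p → 0ℚ < ν q → ¬ Above (letter p) (letter q)

shift-< : ∀ {a b c d} → a + b ≡ c + d → a < c → d < b
shift-< {a} {b} {c} {d} eq a<c with d ℚ.<? b
... | yes d<b = d<b
... | no  d≮b = ⊥-elim (ℚ.<-irrefl eq (ℚ.+-mono-<-≤ a<c (ℚ.≮⇒≥ d≮b)))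

-- Exchange argument: if μ₁ exceeds ν₁ at p, equal totals force ν₁ to exceed μ₁ at some q. Then p
-- has weight in the first part and q in the second for μ, and the reverse holds for ν. So neither
-- word is above the other, and they coincide by `Above-antisym`.
split-≤ : ∀ {N} {μ₁ μ₂ ν₁ ν₂ : Word live N → ℚ} →
  (∀ p → 0ℚ ≤ μ₂ p) → (∀ p → 0ℚ ≤ ν₁ p) →
  (∀ p → 0ℚ ≤ μ₁ p) → (∀ p → 0ℚ ≤ ν₂ p) →
  (∀ p → μ₁ p + μ₂ p ≡ ν₁ p + ν₂ p) → sumW μ₁ ≡ sumW ν₁ →
  Ordered μ₁ μ₂ → Ordered ν₁ ν₂ → ∀ p → μ₁ p ≤ ν₁ p
split-≤ {μ₁ = μ₁} {μ₂} {ν₁} {ν₂} nμ₂ nν₁ nμ₁ nν₂ eq tot oμ oν p = ℚ.≮⇒≥ impossible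
  where
  module _ (lt : ν₁ p < μ₁ p) where
    dominated : ∀ q → ν₁ q ≤ μ₁ q
    dominated q = ℚ.≮⇒≥ λ lt' → ℚ.<-asym lt (subst (λ r → μ₁ r < ν₁ r)
      (sym (Above-antisym p q
        (oμ p q (ℚ.≤-<-trans (nν₁ p) lt) (ℚ.≤-<-trans (nν₂ q) (shift-< (eq q) lt')))
        (oν q p (ℚ.≤-<-trans (nμ₁ q) lt') (ℚ.≤-<-trans (nμ₂ p) (shift-< (sym (eq p)) lt)))))
      lt')
    impossible : ⊥
    impossible = ℚ.<-irrefl (sym tot) (sumW-mono-strict dominated p lt)

split-unique : ∀ {N} {μ₁ μ₂ ν₁ ν₂ : Word live N → ℚ} →
  (∀ p → 0ℚ ≤ μ₁ p) → (∀ p → 0ℚ ≤ μ₂ p) → (∀ p → 0ℚ ≤ ν₁ p) → (∀ p → 0ℚ ≤ ν₂ p) →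
  (∀ p → μ₁ p + μ₂ p ≡ ν₁ p + ν₂ p) → sumW μ₁ ≡ sumW ν₁ →
  Ordered μ₁ μ₂ → Ordered ν₁ ν₂ → ∀ p → μ₁ p ≡ ν₁ p
split-unique nμ₁ nμ₂ nν₁ nν₂ eq tot oμ oν p = ℚ.≤-antisym
  (split-≤ nμ₂ nν₁ nμ₁ nν₂ eq tot oμ oν p)
  (split-≤ nν₂ nμ₁ nν₁ nμ₂ (λ q → sym (eq q)) (sym tot) oν oμ p)

-- Weighted families

Fam : ℕ → Set
Fam N = (s : Phase) → Word s N → ℚ

Nonneg : ∀ {N} → Fam N → Set
Nonneg F = ∀ s w → 0ℚ ≤ F s w

Coherent : ∀ {N} → Fam N → Set
Coherent {N} F = ∀ {s t} (w : Word s N) (w' : Word t N) →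
  0ℚ < F s w → 0ℚ < F t w' → Compat (letter w) (letter w')

-- Forgetting the first point merges the weights of words with the same remainder.
next : ∀ {N} → Fam (suc N) → Fam N
next F idle w = F idle (skip w)
next F live p = F live (dn p) + (F idle (start p) + F live (up p))

next-nonneg : ∀ {N} {F : Fam (suc N)} → Nonneg F → Nonneg (next F)
next-nonneg nn idle w = nn idle (skip w)
next-nonneg nn live p = +-nonneg (nn live (dn p)) (+-nonneg (nn idle (start p)) (nn live (up p)))

lift-positive : ∀ {N} (F : Fam (suc N)) {s} (w : Word s N) → 0ℚ < next F s w →
  Σ Phase λ t → Σ (Word t (suc N)) λ ŵ → 0ℚ < F t ŵ × letter w ≡ letter ŵ ∘ suc
lift-positive F {idle} w pos = _ , skip w , pos , refl
lift-positive F {live} p pos with pos-+ {F live (dn p)} pos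
... | inj₁ pos-dn = _ , dn p , pos-dn , refl
... | inj₂ pos' with pos-+ {F idle (start p)} pos'
...   | inj₁ pos-start = _ , start p , pos-start , refl
...   | inj₂ pos-up    = _ , up p , pos-up , refl

-- A positive merged weight comes from a positive weight on some word with the same tail.
next-coherent : ∀ {N} {F : Fam (suc N)} → Coherent F → Coherent (next F)
next-coherent {F = F} coh w w' pos pos' with lift-positive F w pos | lift-positive F w' pos'
... | _ , ŵ , p , eq | _ , ŵ' , p' , eq' =
  subst₂ Compat (sym eq) (sym eq') (Compat-tail (coh ŵ ŵ' p p'))

-- With `val₁` or `val₂` this is a coordinate of the weighted sum of the vectors ĝ, expressed
-- through letters so that it follows the recursion over the points.
coord : ∀ {N} → (Letter → ℚ) → Fam N → Fin N → ℚ
coord val F k = sumW (λ w → F idle w * val (letter w k)) + sumW (λ w → F live w * val (letter w k))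

module _ {N : ℕ} (F : Fam (suc N)) where

  ups downs starts ends : ℚ
  ups    = sumW (λ p → F live (up p))
  downs  = sumW (λ p → F live (dn p))
  starts = sumW (λ p → F idle (start p))
  ends   = F live end

  sumW-next : sumW (next F live) ≡ downs + (starts + ups)
  sumW-next = trans (sumW-+ (F live ∘ dn) (λ p → F idle (start p) + F live (up p)))
                    (cong (downs +_) (sumW-+ (F idle ∘ start) (F live ∘ up)))

  coord-zero : ∀ val → val none ≡ 0ℚ → coord val F zero ≡
    starts * val first + (ends * val last + (ups * val above + downs * val below))
  coord-zero val val-none = cong₂ _+_
    (trans (cong₂ _+_ (sumW-zero λ w → trans (cong (F idle (skip w) *_) val-none) (ℚ.*-zeroʳ (F idle (skip w))))
                      (sumW-*ʳ (F idle ∘ start) (val first)))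
           (ℚ.+-identityˡ (starts * val first)))
    (cong (ends * val last +_)
      (cong₂ _+_ (sumW-*ʳ (F live ∘ up) (val above)) (sumW-*ʳ (F live ∘ dn) (val below))))

  -- The words merged by `next` share all later letters, and a word ending at the first point has
  -- only `none` left.
  coord-suc : ∀ val → val none ≡ 0ℚ → ∀ k → coord val F (suc k) ≡ coord val (next F) k
  coord-suc val val-none k = begin
    (I + S) + (ends * val none + (U + D))
      ≡⟨ cong (λ z → (I + S) + (z + (U + D))) (trans (cong (ends *_) val-none) (ℚ.*-zeroʳ ends)) ⟩
    (I + S) + (0ℚ + (U + D))
      ≡⟨ solve 4 (λ i s u d → (i :+ s) :+ (con 0ℚ :+ (u :+ d)) := i :+ (d :+ (s :+ u))) refl I S U D ⟩
    I + (D + (S + U))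
      ≡⟨ cong (λ z → I + (D + z)) (sym (sumW-+ fs fu)) ⟩
    I + (D + sumW (λ p → fs p + fu p))
      ≡⟨ cong (I +_) (sym (sumW-+ fd (λ p → fs p + fu p))) ⟩
    I + sumW (λ p → fd p + (fs p + fu p))
      ≡⟨ cong (I +_) (sumW-cong λ p →
           solve 4 (λ d s u v → d :* v :+ (s :* v :+ u :* v) := (d :+ (s :+ u)) :* v) refl
             (F live (dn p)) (F idle (start p)) (F live (up p)) (val (letter p k))) ⟩
    coord val (next F) k ∎
    where
    open ≡-Reasoning
    fs fu fd : Word live N → ℚ
    fs p = F idle (start p) * val (letter p k)
    fu p = F live (up p) * val (letter p k)
    fd p = F live (dn p) * val (letter p k)
    I S U D : ℚ
    I = sumW (λ w → F idle (skip w) * val (letter w k))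
    S = sumW fs
    U = sumW fu
    D = sumW fd

-- The coordinates 2k - 1 and 2k of ĝ in terms of the behaviour of the arc at point k.
val₁ val₂ : Letter → ℚ
val₁ none  = 0ℚ
val₁ first = 1ℚ
val₁ last  = - 1ℚ
val₁ above = 1ℚ
val₁ below = - 1ℚ
val₂ none  = 0ℚ
val₂ first = - 1ℚ
val₂ last  = 1ℚ
val₂ above = 1ℚ
val₂ below = - 1ℚ

-- Recovering the weights at a point from its coordinates

ends-or-starts-zero : ∀ {N} {F : Fam (suc N)} → Nonneg F → Coherent F → starts F ≡ 0ℚ ⊎ ends F ≡ 0ℚ
ends-or-starts-zero {F = F} nn coh with 0ℚ ℚ.<? ends F
... | no  ≮ = inj₂ (sym (≤∧≮⇒≡ (nn live end) ≮))
... | yes 0<e = inj₁ (sumW-zero λ p → sym (≤∧≮⇒≡ (nn idle (start p))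
                  λ 0<s → proj₁ (coh (start p) end 0<s 0<e) zero first-last))

-- Starting and ending weights at a point exclude each other, so they are the
-- positive and negative parts of half the difference of the two coordinates.
module _ {N : ℕ} {F : Fam (suc N)} (nn : Nonneg F) (coh : Coherent F) where

  private
    c₁ c₂ : ℚ
    c₁ = coord val₁ F zero
    c₂ = coord val₂ F zero

  starts-formula : starts F ≡ pos-part (½ * (c₁ - c₂))
  starts-formula = trans
    (disjoint⇒pos-part (sumW-nonneg (λ p → nn idle (start p))) (nn live end) (ends-or-starts-zero nn coh))
    (cong pos-part (trans
      (solve 4 (λ s e a b → s :- e := con ½ :*
          ((s :* con 1ℚ :+ (e :* con (- 1ℚ) :+ (a :* con 1ℚ :+ b :* con (- 1ℚ))))
        :- (s :* con (- 1ℚ) :+ (e :* con 1ℚ :+ (a :* con 1ℚ :+ b :* con (- 1ℚ))))))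
        refl (starts F) (ends F) (ups F) (downs F))
      (sym (cong₂ (λ x y → ½ * (x - y)) (coord-zero F val₁ refl) (coord-zero F val₂ refl)))))

  ends-formula : ends F ≡ starts F - ½ * (c₁ - c₂)
  ends-formula = trans
    (solve 4 (λ s e a b → e := s :- con ½ :*
          ((s :* con 1ℚ :+ (e :* con (- 1ℚ) :+ (a :* con 1ℚ :+ b :* con (- 1ℚ))))
        :- (s :* con (- 1ℚ) :+ (e :* con 1ℚ :+ (a :* con 1ℚ :+ b :* con (- 1ℚ))))))
        refl (starts F) (ends F) (ups F) (downs F))
    (sym (cong₂ (λ x y → starts F - ½ * (x - y)) (coord-zero F val₁ refl) (coord-zero F val₂ refl)))

  -- Half the sum of the two coordinates is `ups` minus `downs`, and the live weight that does not
  -- end here is `ups` plus `downs`; this solves the linear system.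
  downs-formula : downs F ≡ ½ * ((sumW (F live) - ends F) - ½ * (c₁ + c₂))
  downs-formula = trans
    (solve 4 (λ s e a b → b := con ½ :* (((e :+ (a :+ b)) :- e) :- con ½ :*
          ((s :* con 1ℚ :+ (e :* con (- 1ℚ) :+ (a :* con 1ℚ :+ b :* con (- 1ℚ))))
        :+ (s :* con (- 1ℚ) :+ (e :* con 1ℚ :+ (a :* con 1ℚ :+ b :* con (- 1ℚ)))))))
        refl (starts F) (ends F) (ups F) (downs F))
    (sym (cong₂ (λ x y → ½ * ((sumW (F live) - ends F) - ½ * (x + y)))
      (coord-zero F val₁ refl) (coord-zero F val₂ refl)))

  ups-formula : ups F ≡ (sumW (F live) - ends F) - downs F
  ups-formula = solve 3 (λ e a b → a := ((e :+ (a :+ b)) :- e) :- b) refl (ends F) (ups F) (downs F)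

+-cancelˡ : ∀ {a b c d} → a ≡ c → a + b ≡ c + d → b ≡ d
+-cancelˡ {a} {b} {_} {d} refl eq = begin
  b             ≡⟨ solve 2 (λ a b → b := (a :+ b) :- a) refl a b ⟩
  (a + b) - a   ≡⟨ cong (_- a) eq ⟩
  (a + d) - a   ≡⟨ solve 2 (λ a d → (a :+ d) :- a := d) refl a d ⟩
  d             ∎
  where open ≡-Reasoning

+-cancelʳ : ∀ {a b c d} → b ≡ d → a + b ≡ c + d → a ≡ c
+-cancelʳ {a} {b} {c} {d} eq eq' =
  +-cancelˡ eq (trans (ℚ.+-comm b a) (trans eq' (ℚ.+-comm c d)))

-- Uniqueness of coherent families

module _ {N : ℕ} {F : Fam (suc N)} (coh : Coherent F) where

  ordered-dn : Ordered (λ p → F live (dn p)) (λ p → F idle (start p) + F live (up p))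
  ordered-dn p q pos pos' with pos-+ {F idle (start q)} pos'
  ... | inj₁ pos'' = ordered-tails first-below (coh (dn p) (start q) pos pos'')
  ... | inj₂ pos'' = ordered-tails above-below (coh (dn p) (up q) pos pos'')

  ordered-start : Ordered (λ p → F idle (start p)) (λ p → F live (up p))
  ordered-start p q pos pos' = ordered-tails above-first (coh (start p) (up q) pos pos')

-- The four totals at the first point give the total for `next`, so the induction determines the
-- merged weights. Two ordered splittings then separate them: `dn` from the rest, and `start` from
-- `up`. The final point has no coordinates, hence `inject₁`; only the ending word is left there and
-- its weight is the total.
coherent-unique : ∀ n {F F' : Fam (suc n)} → Nonneg F → Nonneg F' → Coherent F → Coherent F' →
  sumW (F live) ≡ sumW (F' live) →
  (∀ (k : Fin n) → coord val₁ F (inject₁ k) ≡ coord val₁ F' (inject₁ k)) →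
  (∀ (k : Fin n) → coord val₂ F (inject₁ k) ≡ coord val₂ F' (inject₁ k)) →
  ∀ s w → F s w ≡ F' s w
coherent-unique zero nn nn' coh coh' tot h₁ h₂ live end = +-cancelʳ refl tot
coherent-unique zero nn nn' coh coh' tot h₁ h₂ live (up ())
coherent-unique zero nn nn' coh coh' tot h₁ h₂ live (dn ())
coherent-unique zero nn nn' coh coh' tot h₁ h₂ idle (skip ())
coherent-unique zero nn nn' coh coh' tot h₁ h₂ idle (start ())
coherent-unique (suc n) {F} {F'} nn nn' coh coh' tot h₁ h₂ = result
  where
  starts≡ : starts F ≡ starts F'
  starts≡ = trans (starts-formula nn coh) (trans
    (cong₂ (λ x y → pos-part (½ * (x - y))) (h₁ zero) (h₂ zero)) (sym (starts-formula nn' coh')))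

  ends≡ : ends F ≡ ends F'
  ends≡ = trans (ends-formula nn coh) (trans
    (cong₂ _-_ starts≡ (cong₂ (λ x y → ½ * (x - y)) (h₁ zero) (h₂ zero)))
    (sym (ends-formula nn' coh')))

  downs≡ : downs F ≡ downs F'
  downs≡ = trans (downs-formula nn coh) (trans
    (cong₂ (λ x y → ½ * (x - y)) (cong₂ _-_ tot ends≡)
      (cong₂ (λ x y → ½ * (x + y)) (h₁ zero) (h₂ zero)))
    (sym (downs-formula nn' coh')))

  ups≡ : ups F ≡ ups F'
  ups≡ = trans (ups-formula nn coh) (trans
    (cong₂ _-_ (cong₂ _-_ tot ends≡) downs≡) (sym (ups-formula nn' coh')))

  next≡ : ∀ s w → next F s w ≡ next F' s w
  next≡ = coherent-unique n (next-nonneg nn) (next-nonneg nn') (next-coherent coh) (next-coherent coh')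
    (trans (sumW-next F) (trans (cong₂ _+_ downs≡ (cong₂ _+_ starts≡ ups≡)) (sym (sumW-next F'))))
    (λ k → trans (sym (coord-suc F val₁ refl (inject₁ k)))
             (trans (h₁ (suc k)) (coord-suc F' val₁ refl (inject₁ k))))
    (λ k → trans (sym (coord-suc F val₂ refl (inject₁ k)))
             (trans (h₂ (suc k)) (coord-suc F' val₂ refl (inject₁ k))))

  dn≡ : ∀ p → F live (dn p) ≡ F' live (dn p)
  dn≡ = split-unique
    (λ p → nn live (dn p)) (λ p → +-nonneg (nn idle (start p)) (nn live (up p)))
    (λ p → nn' live (dn p)) (λ p → +-nonneg (nn' idle (start p)) (nn' live (up p)))
    (next≡ live) downs≡ (ordered-dn coh) (ordered-dn coh')

  rest≡ : ∀ p → F idle (start p) + F live (up p) ≡ F' idle (start p) + F' live (up p)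
  rest≡ p = +-cancelˡ (dn≡ p) (next≡ live p)

  start≡ : ∀ p → F idle (start p) ≡ F' idle (start p)
  start≡ = split-unique
    (λ p → nn idle (start p)) (λ p → nn live (up p))
    (λ p → nn' idle (start p)) (λ p → nn' live (up p))
    rest≡ starts≡ (ordered-start coh) (ordered-start coh')

  result : ∀ s w → F s w ≡ F' s w
  result idle (skip w)  = next≡ idle w
  result idle (start p) = start≡ p
  result live end       = ends≡
  result live (dn p)    = dn≡ p
  result live (up p)    = +-cancelˡ (start≡ p) (rest≡ p)

-- Realising prescribed coordinates

-- A cut of μ at height b, measured from below; the weight of a word at the cut may be divided
-- between the two parts.
record Split {N} (μ : Word live N → ℚ) (b : ℚ) : Set where
  field
    lower upper  : Word live N → ℚ
    lower-nonneg : ∀ p → 0ℚ ≤ lower p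
    upper-nonneg : ∀ p → 0ℚ ≤ upper p
    lower+upper  : ∀ p → lower p + upper p ≡ μ p
    sumW-lower   : sumW lower ≡ b
    ordered      : Ordered lower upper

  lower-positive : ∀ {p} → 0ℚ < lower p → 0ℚ < μ p
  lower-positive {p} 0<l = subst (0ℚ <_) (lower+upper p) (ℚ.+-mono-<-≤ 0<l (upper-nonneg p))

  upper-positive : ∀ {p} → 0ℚ < upper p → 0ℚ < μ p
  upper-positive {p} 0<u = subst (0ℚ <_) (lower+upper p) (ℚ.+-mono-≤-< (lower-nonneg p) 0<u)

  sumW-lower+upper : b + sumW upper ≡ sumW μ
  sumW-lower+upper = trans (cong (_+ sumW upper) (sym sumW-lower))
    (trans (sym (sumW-+ lower upper)) (sumW-cong lower+upper))

Chain : ∀ {N} → (Word live N → ℚ) → Set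
Chain μ = ∀ p q → 0ℚ < μ p → 0ℚ < μ q → Compat (letter p) (letter q)

split-all : ∀ {N} {μ : Word live N → ℚ} → (∀ p → 0ℚ ≤ μ p) → Split μ (sumW μ)
split-all {μ = μ} nn = record
  { lower = μ ; upper = λ _ → 0ℚ
  ; lower-nonneg = nn ; upper-nonneg = λ _ → ℚ.≤-refl
  ; lower+upper = λ p → ℚ.+-identityʳ (μ p) ; sumW-lower = refl
  ; ordered = λ _ _ _ 0<0 → ⊥-elim (ℚ.<-irrefl refl 0<0) }

split-none : ∀ {N} {μ : Word live N → ℚ} → (∀ p → 0ℚ ≤ μ p) → Split μ 0ℚ
split-none {N} {μ} nn = record
  { lower = λ _ → 0ℚ ; upper = μ
  ; lower-nonneg = λ _ → ℚ.≤-refl ; upper-nonneg = nn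
  ; lower+upper = λ p → ℚ.+-identityˡ (μ p) ; sumW-lower = sumW-zero {live} {N} λ _ → refl
  ; ordered = λ _ _ 0<0 → ⊥-elim (ℚ.<-irrefl refl 0<0) }

-- By their first letters, live words are ranked `dn`, `end`, `up`. The last three hypotheses forbid
-- a word of the lower part from outranking one of the upper part. For a lower `dn` and an upper
-- `up` word, compatibility carries the order at the first point over to the tails.
split-assemble : ∀ {N} {μ : Word live (suc N) → ℚ} {b-dn b-up e₁ e₂} → Chain μ →
  (D : Split (μ ∘ dn) b-dn) (U : Split (μ ∘ up) b-up) →
  0ℚ ≤ e₁ → 0ℚ ≤ e₂ → e₁ + e₂ ≡ μ end →
  (∀ p → 0ℚ < e₁ → ¬ (0ℚ < Split.upper D p)) →
  (∀ p → 0ℚ < Split.lower U p → ¬ (0ℚ < e₂)) →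
  (∀ p q → 0ℚ < Split.lower U p → ¬ (0ℚ < Split.upper D q)) →
  Split μ (e₁ + (b-up + b-dn))
split-assemble {N} {μ} {b-dn} {b-up} {e₁} {e₂} chain D U 0≤e₁ 0≤e₂ e≡ end-dn up-end up-dn = record
  { lower = assemble e₁ U.lower D.lower
  ; upper = assemble e₂ U.upper D.upper
  ; lower-nonneg = λ { end → 0≤e₁ ; (up p) → U.lower-nonneg p ; (dn p) → D.lower-nonneg p }
  ; upper-nonneg = λ { end → 0≤e₂ ; (up p) → U.upper-nonneg p ; (dn p) → D.upper-nonneg p }
  ; lower+upper = λ { end → e≡ ; (up p) → U.lower+upper p ; (dn p) → D.lower+upper p }
  ; sumW-lower = cong (e₁ +_) (cong₂ _+_ U.sumW-lower D.sumW-lower)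
  ; ordered = ord }
  where
  module D = Split D
  module U = Split U
  assemble : ℚ → (Word live N → ℚ) → (Word live N → ℚ) → Word live (suc N) → ℚ
  assemble e u d end    = e
  assemble e u d (up p) = u p
  assemble e u d (dn p) = d p
  ord : Ordered (assemble e₁ U.lower D.lower) (assemble e₂ U.upper D.upper)
  ord end    end    _ _ = λ { (zero , ()) ; (suc _ , ()) }
  ord end    (up q) _ _ = λ { (zero , ()) ; (suc _ , ()) }
  ord end    (dn q) h h' = ⊥-elim (end-dn q h h')
  ord (up p) end    h h' = ⊥-elim (up-end p h h')
  ord (up p) (up q) h h' = Above-cons ¬Over-refl (U.ordered p q h h')
  ord (up p) (dn q) h h' = ⊥-elim (up-dn p q h h')
  ord (dn p) end    _ _ = λ { (zero , ()) ; (suc _ , ()) }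
  ord (dn p) (up q) h h' = Above-cons (λ ())
    (ordered-tails above-below (chain (dn p) (up q) (D.lower-positive h) (U.upper-positive h')))
  ord (dn p) (dn q) h h' = Above-cons ¬Over-refl (D.ordered p q h h')

-- The lower part is filled greedily: first words starting with `dn`, then `end`, then `up`.
split-exists : ∀ {N} {μ : Word live N → ℚ} → (∀ p → 0ℚ ≤ μ p) → Chain μ →
  ∀ b → 0ℚ ≤ b → b ≤ sumW μ → Split μ b
split-exists {zero} {μ} nn chain b 0≤b b≤0 = record
  { lower = μ ; upper = μ ; lower-nonneg = λ () ; upper-nonneg = λ () ; lower+upper = λ ()
  ; sumW-lower = ℚ.≤-antisym 0≤b b≤0 ; ordered = λ () }
split-exists {suc N} {μ} nn chain b 0≤b b≤ with ℚ.≤-total b (sumW (μ ∘ dn))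
... | inj₁ b≤d = subst (Split μ) (solve 1 (λ b → con 0ℚ :+ (con 0ℚ :+ b) := b) refl b)
        (split-assemble chain
          (split-exists (nn ∘ dn) chain-dn b 0≤b b≤d)
          (split-none (nn ∘ up)) ℚ.≤-refl (nn end) (ℚ.+-identityˡ (μ end))
          (λ _ 0<0 → ⊥-elim (ℚ.<-irrefl refl 0<0))
          (λ _ 0<0 → ⊥-elim (ℚ.<-irrefl refl 0<0))
          (λ _ _ 0<0 → ⊥-elim (ℚ.<-irrefl refl 0<0)))
  where
  chain-dn : Chain (μ ∘ dn)
  chain-dn p q h h' = Compat-tail (chain (dn p) (dn q) h h')
... | inj₂ d≤b with ℚ.≤-total b (sumW (μ ∘ dn) + μ end)
...   | inj₁ b≤d+e = subst (Split μ)
          (solve 2 (λ b d → (b :- d) :+ (con 0ℚ :+ d) := b) refl b d)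
          (split-assemble chain (split-all (nn ∘ dn)) (split-none (nn ∘ up))
            (0≤a-b d≤b)
            (subst (0ℚ ≤_) (solve 3 (λ b d e → (d :+ e) :- b := e :- (b :- d)) refl b d (μ end))
              (0≤a-b b≤d+e))
            (solve 3 (λ b d e → (b :- d) :+ (e :- (b :- d)) := e) refl b d (μ end))
            (λ _ _ 0<0 → ⊥-elim (ℚ.<-irrefl refl 0<0))
            (λ _ 0<0 → ⊥-elim (ℚ.<-irrefl refl 0<0))
            (λ _ _ 0<0 → ⊥-elim (ℚ.<-irrefl refl 0<0)))
  where
  d : ℚ
  d = sumW (μ ∘ dn)
...   | inj₂ d+e≤b = subst (Split μ)
          (solve 3 (λ b d e → e :+ ((b :- (d :+ e)) :+ d) := b) refl b d (μ end))
          (split-assemble chain (split-all (nn ∘ dn))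
            (split-exists (nn ∘ up) chain-up (b - (d + μ end)) (0≤a-b d+e≤b)
              (subst (b - (d + μ end) ≤_)
                (solve 3 (λ u d e → (e :+ (u :+ d)) :+ (:- (d :+ e)) := u) refl (sumW (μ ∘ up)) d (μ end))
                (ℚ.+-monoˡ-≤ (- (d + μ end)) b≤)))
            (nn end) ℚ.≤-refl (ℚ.+-identityʳ (μ end))
            (λ _ _ 0<0 → ⊥-elim (ℚ.<-irrefl refl 0<0))
            (λ _ _ 0<0 → ⊥-elim (ℚ.<-irrefl refl 0<0))
            (λ _ _ _ 0<0 → ⊥-elim (ℚ.<-irrefl refl 0<0)))
  where
  d : ℚ
  d = sumW (μ ∘ dn)
  chain-up : Chain (μ ∘ up)
  chain-up p q h h' = Compat-tail (chain (up p) (up q) h h')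

-- Extending a family by a new first point

module _ {N : ℕ} (F' : Fam N) (nn' : Nonneg F') (coh' : Coherent F')
  {b s e : ℚ} (0≤e : 0ℚ ≤ e) (s≡0⊎e≡0 : s ≡ 0ℚ ⊎ e ≡ 0ℚ)
  (S : Split (F' live) b) (R : Split (Split.upper S) s) where

  private
    module S = Split S
    module R = Split R

  -- A right inverse of `next` with prescribed totals. Cutting by S and then by R gives `dn` the
  -- lowest part, `start` the middle one and `up` the highest, which is the order imposed by the
  -- first letters.
  prepend : Fam (suc N)
  prepend idle (skip w)  = F' idle w
  prepend idle (start p) = R.lower p
  prepend live end       = e
  prepend live (up p)    = R.upper p
  prepend live (dn p)    = S.lower p

  prepend-nonneg : Nonneg prepend
  prepend-nonneg idle (skip w)  = nn' idle w
  prepend-nonneg idle (start p) = R.lower-nonneg p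
  prepend-nonneg live end       = 0≤e
  prepend-nonneg live (up p)    = R.upper-nonneg p
  prepend-nonneg live (dn p)    = S.lower-nonneg p

  next-prepend : ∀ t w → next prepend t w ≡ F' t w
  next-prepend idle w = refl
  next-prepend live p = trans (cong (S.lower p +_) (R.lower+upper p)) (S.lower+upper p)

  private
    remainder-positive : ∀ {t} (w : Word t (suc N)) → 0ℚ < prepend t w →
      (∀ k → letter w (suc k) ≡ none) ⊎
      Σ Phase λ t' → Σ (Word t' N) λ w' → 0ℚ < F' t' w' × letter w ∘ suc ≡ letter w'
    remainder-positive (skip w)  h = inj₂ (_ , w , h , refl)
    remainder-positive (start p) h = inj₂ (_ , p , S.upper-positive (R.lower-positive h) , refl)
    remainder-positive end       h = inj₁ λ _ → refl
    remainder-positive (up p)    h = inj₂ (_ , p , S.upper-positive (R.upper-positive h) , refl)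
    remainder-positive (dn p)    h = inj₂ (_ , p , S.lower-positive h , refl)

    Compat-none : ∀ {f g : Fin N → Letter} → (∀ k → f k ≡ none) → Compat f g
    Compat-none {f} {g} eq =
      (λ k c → ¬clash (subst (λ x → Clash x (g k)) (eq k) c)) ,
      λ ((k , o) , _) → ¬over (subst (λ x → Over x (g k)) (eq k) o)
      where
      ¬clash : ∀ {x} → ¬ Clash none x
      ¬clash ()
      ¬over : ∀ {x} → ¬ Over none x
      ¬over ()

    remainders : ∀ {t t'} (w : Word t (suc N)) (w' : Word t' (suc N)) →
      0ℚ < prepend t w → 0ℚ < prepend t' w' → Compat (letter w ∘ suc) (letter w' ∘ suc)
    remainders w w' h h' with remainder-positive w h | remainder-positive w' h'
    ... | inj₁ eq | _ = Compat-none eq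
    ... | inj₂ _  | inj₁ eq = Compat-sym (Compat-none eq)
    ... | inj₂ (_ , v , hv , eq) | inj₂ (_ , v' , hv' , eq') =
      subst₂ Compat (sym eq) (sym eq') (coh' v v' hv hv')

    -- These two words would clash at the new point, but one of their totals s and e is zero.
    start-end : ∀ {p} → 0ℚ < R.lower p → ¬ (0ℚ < e)
    start-end {p} 0<l 0<e =
      [ (λ s≡0 → ℚ.<-irrefl (sym (sumW-zero⁻¹ R.lower-nonneg (trans R.sumW-lower s≡0) p)) 0<l)
      , (λ e≡0 → ℚ.<-irrefl (sym e≡0) 0<e) ]′ s≡0⊎e≡0

    dn-start : ∀ p q → 0ℚ < S.lower p → 0ℚ < R.lower q → Compat (letter (dn p)) (letter (start q))
    dn-start p q h h' = Compat-cons-ordered (λ ()) (λ ()) (remainders (dn p) (start q) h h')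
      (S.ordered p q h (R.lower-positive h'))

    dn-up : ∀ p q → 0ℚ < S.lower p → 0ℚ < R.upper q → Compat (letter (dn p)) (letter (up q))
    dn-up p q h h' = Compat-cons-ordered (λ ()) (λ ()) (remainders (dn p) (up q) h h')
      (S.ordered p q h (R.upper-positive h'))

    dn-end : ∀ p → 0ℚ < S.lower p → 0ℚ < e → Compat (letter (dn p)) (letter (end {N}))
    dn-end p h h' = Compat-cons-ordered (λ ()) (λ ()) (remainders (dn p) end h h')
      λ { (_ , ()) }

    start-up : ∀ p q → 0ℚ < R.lower p → 0ℚ < R.upper q → Compat (letter (start p)) (letter (up q))
    start-up p q h h' = Compat-cons-ordered (λ ()) (λ ()) (remainders (start p) (up q) h h')
      (R.ordered p q h h')

    end-up : ∀ q → 0ℚ < e → 0ℚ < R.upper q → Compat (letter (end {N})) (letter (up q))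
    end-up q h h' = Compat-cons-ordered (λ ()) (λ ()) (remainders end (up q) h h')
      λ { (_ , ()) }

  -- Equal first letters, or a `none`, reduce the claim to the remainders. For the other pairs the
  -- tails follow the order of the first letters, by the splittings or because a tail is empty;
  -- starting together with ending is ruled out by `start-end`.
  prepend-coherent : Coherent prepend
  prepend-coherent (skip w)  w'         h h' =
    Compat-cons (λ ()) (λ ()) ¬Over-none (remainders (skip w) w' h h')
  prepend-coherent w@(start _) (skip w') h h' = Compat-cons (λ ()) (λ ()) (λ ()) (remainders w (skip w') h h')
  prepend-coherent w@end     (skip w')  h h' = Compat-cons (λ ()) (λ ()) (λ ()) (remainders w (skip w') h h')
  prepend-coherent w@(up _)  (skip w')  h h' = Compat-cons (λ ()) (λ ()) (λ ()) (remainders w (skip w') h h')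
  prepend-coherent w@(dn _)  (skip w')  h h' = Compat-cons (λ ()) (λ ()) (λ ()) (remainders w (skip w') h h')
  prepend-coherent (start p) (start q)  h h' = Compat-cons (λ ()) (λ ()) (λ ()) (remainders (start p) (start q) h h')
  prepend-coherent (start p) end        h h' = ⊥-elim (start-end h h')
  prepend-coherent (start p) (up q)     h h' = start-up p q h h'
  prepend-coherent (start p) (dn q)     h h' = Compat-sym (dn-start q p h' h)
  prepend-coherent end       (start q)  h h' = ⊥-elim (start-end h' h)
  prepend-coherent end       end        h h' = Compat-refl (letter (end {N}))
  prepend-coherent end       (up q)     h h' = end-up q h h'
  prepend-coherent end       (dn q)     h h' = Compat-sym (dn-end q h' h)
  prepend-coherent (up p)    (start q)  h h' = Compat-sym (start-up q p h' h)
  prepend-coherent (up p)    end        h h' = Compat-sym (end-up p h' h)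
  prepend-coherent (up p)    (up q)     h h' = Compat-cons (λ ()) (λ ()) (λ ()) (remainders (up p) (up q) h h')
  prepend-coherent (up p)    (dn q)     h h' = Compat-sym (dn-up q p h' h)
  prepend-coherent (dn p)    (start q)  h h' = dn-start p q h h'
  prepend-coherent (dn p)    end        h h' = dn-end p h h'
  prepend-coherent (dn p)    (up q)     h h' = dn-up p q h h'
  prepend-coherent (dn p)    (dn q)     h h' = Compat-cons (λ ()) (λ ()) (λ ()) (remainders (dn p) (dn q) h h')

coord-cong : ∀ {N} val {F F' : Fam N} → (∀ s w → F s w ≡ F' s w) → ∀ k → coord val F k ≡ coord val F' k
coord-cong val eq k = cong₂ _+_ (sumW-cong λ w → cong (_* val (letter w k)) (eq idle w))
                                (sumW-cong λ w → cong (_* val (letter w k)) (eq live w))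

half-difference half-sum : ℚ → ℚ → ℚ
half-difference x₁ x₂ = ½ * (x₁ - x₂)
half-sum        x₁ x₂ = ½ * (x₁ + x₂)

∣∣-parts : ℚ → ℚ
∣∣-parts q = pos-part q + pos-part (- q)

-- A live weight at the left end from which every coordinate vector can be realised.
sufficient : ∀ {n} → (Fin n → ℚ) → (Fin n → ℚ) → ℚ
sufficient {zero}  x₁ x₂ = 0ℚ
sufficient {suc n} x₁ x₂ =
  (∣∣-parts (half-difference (x₁ zero) (x₂ zero)) + ∣∣-parts (half-sum (x₁ zero) (x₂ zero)))
  + sufficient (x₁ ∘ suc) (x₂ ∘ suc)

∣∣-parts-nonneg : ∀ q → 0ℚ ≤ ∣∣-parts q
∣∣-parts-nonneg q = +-nonneg (pos-part-nonneg q) (pos-part-nonneg (- q))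

sufficient-nonneg : ∀ {n} (x₁ x₂ : Fin n → ℚ) → 0ℚ ≤ sufficient x₁ x₂
sufficient-nonneg {zero}  x₁ x₂ = ℚ.≤-refl
sufficient-nonneg {suc n} x₁ x₂ =
  +-nonneg (+-nonneg (∣∣-parts-nonneg (half-difference (x₁ zero) (x₂ zero)))
                     (∣∣-parts-nonneg (half-sum (x₁ zero) (x₂ zero))))
           (sufficient-nonneg (x₁ ∘ suc) (x₂ ∘ suc))

record Realisation {n} (x₁ x₂ : Fin n → ℚ) (m : ℚ) : Set where
  field
    family   : Fam (suc n)
    nonneg   : Nonneg family
    coherent : Coherent family
    total    : sumW (family live) ≡ m
    coord₁   : ∀ k → coord val₁ family (inject₁ k) ≡ x₁ k
    coord₂   : ∀ k → coord val₂ family (inject₁ k) ≡ x₂ k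

-- The remainder is realised first, with the total b + (s + a) that has to leave the first point,
-- and is then cut into the parts of `prepend`. The total m is a parameter because each point
-- prescribes it for the next one.
realise : ∀ n (x₁ x₂ : Fin n → ℚ) m → sufficient x₁ x₂ ≤ m → Realisation x₁ x₂ m
realise zero x₁ x₂ m 0≤m = record
  { family = F ; nonneg = nn ; coherent = coh
  ; total = ℚ.+-identityʳ m ; coord₁ = λ () ; coord₂ = λ () }
  where
  F : Fam 1
  F idle _ = 0ℚ
  F live _ = m
  nn : Nonneg F
  nn idle _ = ℚ.≤-refl
  nn live _ = 0≤m
  coh : Coherent F
  coh end end _ _ = Compat-refl (letter (end {0}))
  coh (skip ())
  coh (start ())
  coh (up ())
  coh (dn ())
  coh end (skip ())
  coh end (start ())
  coh end (up ())
  coh end (dn ())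
realise (suc n) x₁ x₂ m suff = record
  { family = F
  ; nonneg = prepend-nonneg F' IH.nonneg IH.coherent 0≤e (pos-part-zero v) S R
  ; coherent = prepend-coherent F' IH.nonneg IH.coherent 0≤e (pos-part-zero v) S R
  ; total = trans (cong (e +_) (cong₂ _+_ sumT (Split.sumW-lower S)))
      (solve 6 (λ m s e u⁺ u⁻ B →
         let r = m :- (((s :+ e) :+ (u⁺ :+ u⁻)) :+ B) in
         e :+ (con ½ :* (r :+ ((s :+ (u⁺ :+ u⁺)) :+ B)) :+ con ½ :* (r :+ ((s :+ (u⁻ :+ u⁻)) :+ B))) := m)
         refl m s e u⁺ u⁻ B)
  ; coord₁ = λ { zero → trans (coord-zero F val₁ refl) (trans
        (cong₂ (λ x y → x * 1ℚ + (e * - 1ℚ + (proj₁ y * 1ℚ + proj₂ y * - 1ℚ)))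
           (Split.sumW-lower R) (cong₂ _,_ sumT (Split.sumW-lower S)))
        (trans
          (solve 6 (λ m s e u⁺ u⁻ B →
             let r = m :- (((s :+ e) :+ (u⁺ :+ u⁻)) :+ B) in
             s :* con 1ℚ :+ (e :* con (- 1ℚ) :+
               ((con ½ :* (r :+ ((s :+ (u⁺ :+ u⁺)) :+ B))) :* con 1ℚ
               :+ (con ½ :* (r :+ ((s :+ (u⁻ :+ u⁻)) :+ B))) :* con (- 1ℚ)))
             := (s :- e) :+ (u⁺ :- u⁻)) refl m s e u⁺ u⁻ B)
          (trans (cong₂ _+_ (pos-part-difference v) (pos-part-difference u))
            (solve 2 (λ a b → con ½ :* (a :- b) :+ con ½ :* (a :+ b) := a) refl (x₁ zero) (x₂ zero)))))
      ; (suc k) → trans (coord-suc F val₁ refl (inject₁ k))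
          (trans (coord-cong val₁ next≡ (inject₁ k)) (IH.coord₁ k)) }
  ; coord₂ = λ { zero → trans (coord-zero F val₂ refl) (trans
        (cong₂ (λ x y → x * - 1ℚ + (e * 1ℚ + (proj₁ y * 1ℚ + proj₂ y * - 1ℚ)))
           (Split.sumW-lower R) (cong₂ _,_ sumT (Split.sumW-lower S)))
        (trans
          (solve 6 (λ m s e u⁺ u⁻ B →
             let r = m :- (((s :+ e) :+ (u⁺ :+ u⁻)) :+ B) in
             s :* con (- 1ℚ) :+ (e :* con 1ℚ :+
               ((con ½ :* (r :+ ((s :+ (u⁺ :+ u⁺)) :+ B))) :* con 1ℚ
               :+ (con ½ :* (r :+ ((s :+ (u⁻ :+ u⁻)) :+ B))) :* con (- 1ℚ)))
             := :- (s :- e) :+ (u⁺ :- u⁻)) refl m s e u⁺ u⁻ B)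
          (trans (cong₂ (λ x y → - x + y) (pos-part-difference v) (pos-part-difference u))
            (solve 2 (λ a b → :- (con ½ :* (a :- b)) :+ con ½ :* (a :+ b) := b) refl (x₁ zero) (x₂ zero)))))
      ; (suc k) → trans (coord-suc F val₂ refl (inject₁ k))
          (trans (coord-cong val₂ next≡ (inject₁ k)) (IH.coord₂ k)) } }
  where
  v u s e u⁺ u⁻ B r a b : ℚ
  v = half-difference (x₁ zero) (x₂ zero)
  u = half-sum (x₁ zero) (x₂ zero)
  s = pos-part v
  e = pos-part (- v)
  u⁺ = pos-part u
  u⁻ = pos-part (- u)
  B = sufficient (x₁ ∘ suc) (x₂ ∘ suc)
  r = m - (((s + e) + (u⁺ + u⁻)) + B)
  -- Here a and b are the weights passing above and below: a - b must be u and e + (a + b) must be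
  -- m. Writing the solution in terms of the slack r of m over `sufficient` makes its nonnegativity
  -- visible.
  a = ½ * (r + ((s + (u⁺ + u⁺)) + B))
  b = ½ * (r + ((s + (u⁻ + u⁻)) + B))

  0≤r : 0ℚ ≤ r
  0≤r = 0≤a-b suff
  0≤s : 0ℚ ≤ s
  0≤s = pos-part-nonneg v
  0≤e : 0ℚ ≤ e
  0≤e = pos-part-nonneg (- v)
  0≤u⁺ : 0ℚ ≤ u⁺
  0≤u⁺ = pos-part-nonneg u
  0≤u⁻ : 0ℚ ≤ u⁻
  0≤u⁻ = pos-part-nonneg (- u)
  0≤B : 0ℚ ≤ B
  0≤B = sufficient-nonneg (x₁ ∘ suc) (x₂ ∘ suc)
  0≤½ : 0ℚ ≤ ½
  0≤½ = ℚ.nonNegative⁻¹ ½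
  0≤a : 0ℚ ≤ a
  0≤a = *-nonneg 0≤½ (+-nonneg 0≤r (+-nonneg (+-nonneg 0≤s (+-nonneg 0≤u⁺ 0≤u⁺)) 0≤B))
  0≤b : 0ℚ ≤ b
  0≤b = *-nonneg 0≤½ (+-nonneg 0≤r (+-nonneg (+-nonneg 0≤s (+-nonneg 0≤u⁻ 0≤u⁻)) 0≤B))

  B≤ : B ≤ b + (s + a)
  B≤ = subst₂ _≤_ (ℚ.+-identityʳ B)
    (solve 5 (λ r s u⁺ u⁻ B →
       B :+ (r :+ ((s :+ s) :+ (u⁺ :+ u⁻)))
       := con ½ :* (r :+ ((s :+ (u⁻ :+ u⁻)) :+ B)) :+ (s :+ con ½ :* (r :+ ((s :+ (u⁺ :+ u⁺)) :+ B))))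
       refl r s u⁺ u⁻ B)
    (ℚ.+-monoʳ-≤ B (+-nonneg 0≤r (+-nonneg (+-nonneg 0≤s 0≤s) (+-nonneg 0≤u⁺ 0≤u⁻))))

  ih : Realisation (x₁ ∘ suc) (x₂ ∘ suc) (b + (s + a))
  ih = realise n (x₁ ∘ suc) (x₂ ∘ suc) (b + (s + a)) B≤
  module IH = Realisation ih
  F' : Fam (suc n)
  F' = IH.family

  a≤a+c : ∀ {a c} → 0ℚ ≤ c → a ≤ a + c
  a≤a+c {a} {c} 0≤c = subst (_≤ a + c) (ℚ.+-identityʳ a) (ℚ.+-monoʳ-≤ a 0≤c)

  S : Split (F' live) b
  S = split-exists (IH.nonneg live) IH.coherent b 0≤b
        (subst (b ≤_) (sym IH.total) (a≤a+c (+-nonneg 0≤s 0≤a)))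
  module S = Split S

  sum-upper : sumW S.upper ≡ s + a
  sum-upper = +-cancelˡ {b} refl (trans S.sumW-lower+upper IH.total)

  R : Split S.upper s
  R = split-exists S.upper-nonneg
        (λ p q h h' → IH.coherent p q (S.upper-positive h) (S.upper-positive h'))
        s 0≤s (subst (s ≤_) (sym sum-upper) (a≤a+c 0≤a))

  sumT : sumW (Split.upper R) ≡ a
  sumT = +-cancelˡ {s} refl (trans (Split.sumW-lower+upper R) sum-upper)

  F : Fam (suc (suc n))
  F = prepend F' IH.nonneg IH.coherent 0≤e (pos-part-zero v) S R

  next≡ : ∀ t w → next F t w ≡ F' t w
  next≡ = next-prepend F' IH.nonneg IH.coherent 0≤e (pos-part-zero v) S R

-- Words and arcs

firstPt : ∀ {N} → Word idle N → Fin N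
firstPt (skip w)  = suc (firstPt w)
firstPt (start p) = zero

lastPt : ∀ {s N} → Word s N → Fin N
lastPt (skip w)  = suc (lastPt w)
lastPt (start p) = suc (lastPt p)
lastPt end       = zero
lastPt (up p)    = suc (lastPt p)
lastPt (dn p)    = suc (lastPt p)

abovePts : ∀ {s N} → Word s N → Subset N
abovePts (skip w)  = outside ∷ abovePts w
abovePts (start p) = outside ∷ abovePts p
abovePts end       = outside ∷ ∅
abovePts (up p)    = inside ∷ abovePts p
abovePts (dn p)    = outside ∷ abovePts p

isAbove isBelow : Letter → Bool
isAbove above = true
isAbove _     = false
isBelow below = true
isBelow _     = false

lookup-abovePts : ∀ {s N} (w : Word s N) k → lookup (abovePts w) k ≡ isAbove (letter w k)
lookup-abovePts (skip w)  zero    = refl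
lookup-abovePts (skip w)  (suc k) = lookup-abovePts w k
lookup-abovePts (start p) zero    = refl
lookup-abovePts (start p) (suc k) = lookup-abovePts p k
lookup-abovePts end       zero    = refl
lookup-abovePts end       (suc k) = lookup-replicate k outside
lookup-abovePts (up p)    zero    = refl
lookup-abovePts (up p)    (suc k) = lookup-abovePts p k
lookup-abovePts (dn p)    zero    = refl
lookup-abovePts (dn p)    (suc k) = lookup-abovePts p k

letter-live≢first : ∀ {N} (p : Word live N) k → letter p k ≢ first
letter-live≢first (up p) (suc k) eq = letter-live≢first p k eq
letter-live≢first (dn p) (suc k) eq = letter-live≢first p k eq
letter-live≢first end (suc k) ()

letter-firstPt : ∀ {N} (w : Word idle N) → letter w (firstPt w) ≡ first
letter-firstPt (skip w)  = letter-firstPt w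
letter-firstPt (start p) = refl

firstPt-unique : ∀ {N} (w : Word idle N) k → letter w k ≡ first → k ≡ firstPt w
firstPt-unique (skip w)  (suc k) eq = cong suc (firstPt-unique w k eq)
firstPt-unique (start p) zero    eq = refl
firstPt-unique (start p) (suc k) eq = ⊥-elim (letter-live≢first p k eq)

letter-lastPt : ∀ {s N} (w : Word s N) → letter w (lastPt w) ≡ last
letter-lastPt (skip w)  = letter-lastPt w
letter-lastPt (start p) = letter-lastPt p
letter-lastPt end       = refl
letter-lastPt (up p)    = letter-lastPt p
letter-lastPt (dn p)    = letter-lastPt p

lastPt-unique : ∀ {s N} (w : Word s N) k → letter w k ≡ last → k ≡ lastPt w
lastPt-unique (skip w)  (suc k) eq = cong suc (lastPt-unique w k eq)
lastPt-unique (start p) (suc k) eq = cong suc (lastPt-unique p k eq)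
lastPt-unique end       zero    eq = refl
lastPt-unique (up p)    (suc k) eq = cong suc (lastPt-unique p k eq)
lastPt-unique (dn p)    (suc k) eq = cong suc (lastPt-unique p k eq)

data Interior : Letter → Set where
  above : Interior above
  below : Interior below

interior<last : ∀ {s N} (w : Word s N) k → Interior (letter w k) → toℕ k ℕ.< toℕ (lastPt w)
interior<last (skip w)  (suc k) i = s≤s (interior<last w k i)
interior<last (start p) (suc k) i = s≤s (interior<last p k i)
interior<last (up p)    zero    i = s≤s z≤n
interior<last (up p)    (suc k) i = s≤s (interior<last p k i)
interior<last (dn p)    zero    i = s≤s z≤n
interior<last (dn p)    (suc k) i = s≤s (interior<last p k i)
interior<last (skip w)  zero    ()
interior<last (start p) zero    ()
interior<last end       zero    ()
interior<last end       (suc k) ()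

first<interior : ∀ {N} (w : Word idle N) k → Interior (letter w k) → toℕ (firstPt w) ℕ.< toℕ k
first<interior (skip w)  (suc k) i = s≤s (first<interior w k i)
first<interior (start p) (suc k) i = s≤s z≤n
first<interior (skip w)  zero    ()
first<interior (start p) zero    ()

<last⇒interior : ∀ {N} (p : Word live N) k → toℕ k ℕ.< toℕ (lastPt p) → Interior (letter p k)
<last⇒interior (up p) zero    lt = above
<last⇒interior (up p) (suc k) lt = <last⇒interior p k (ℕ.s≤s⁻¹ lt)
<last⇒interior (dn p) zero    lt = below
<last⇒interior (dn p) (suc k) lt = <last⇒interior p k (ℕ.s≤s⁻¹ lt)

between⇒interior : ∀ {N} (w : Word idle N) k →
  toℕ (firstPt w) ℕ.< toℕ k → toℕ k ℕ.< toℕ (lastPt w) → Interior (letter w k)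
between⇒interior (skip w)  (suc k) lt lt' = between⇒interior w k (ℕ.s≤s⁻¹ lt) (ℕ.s≤s⁻¹ lt')
between⇒interior (start p) (suc k) lt lt' = <last⇒interior p k (ℕ.s≤s⁻¹ lt')

first<last : ∀ {N} (w : Word idle N) → toℕ (firstPt w) ℕ.< toℕ (lastPt w)
first<last (skip w)  = s≤s (first<last w)
first<last (start p) = s≤s z≤n

∈abovePts⇒above : ∀ {s N} (w : Word s N) k → k ∈ abovePts w → letter w k ≡ above
∈abovePts⇒above w k k∈ = isAbove⇒≡ (trans (sym (lookup-abovePts w k)) ([]=⇒lookup k∈))
  where
  isAbove⇒≡ : ∀ {ℓ} → isAbove ℓ ≡ true → ℓ ≡ above
  isAbove⇒≡ {above} refl = refl

above⇒∈abovePts : ∀ {s N} (w : Word s N) k → letter w k ≡ above → k ∈ abovePts w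
above⇒∈abovePts w k eq = lookup⇒[]= k _ (trans (lookup-abovePts w k) (cong isAbove eq))

fromWord : ∀ {n} → Word idle (suc (suc n)) → Arc n
fromWord w = mkArc (firstPt w) (lastPt w) (first<last w) (abovePts w) λ k k∈ →
  let i = subst Interior (sym (∈abovePts⇒above w k k∈)) above in
  first<interior w k i , interior<last w k i

toLive : ∀ {N} → Fin N → Subset N → Word live N
toLive zero    _             = end
toLive (suc j) (inside ∷ A)  = up (toLive j A)
toLive (suc j) (outside ∷ A) = dn (toLive j A)

-- Entries of the subset outside the open interval from i to j are ignored; the subset of an arc has
-- none there, so nothing is lost.
toIdle : ∀ {N} (i j : Fin N) → .(toℕ i ℕ.< toℕ j) → Subset N → Word idle N
toIdle zero    zero    ()
toIdle (suc i) zero    ()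
toIdle zero    (suc j) lt (_ ∷ A) = start (toLive j A)
toIdle (suc i) (suc j) lt (_ ∷ A) = skip (toIdle i j (ℕ.s≤s⁻¹ lt) A)

toWord : ∀ {n} → Arc n → Word idle (suc (suc n))
toWord (mkArc i j i<j A _) = toIdle i j i<j A

toLive-lastPt-abovePts : ∀ {N} (p : Word live N) → toLive (lastPt p) (abovePts p) ≡ p
toLive-lastPt-abovePts end    = refl
toLive-lastPt-abovePts (up p) = cong up (toLive-lastPt-abovePts p)
toLive-lastPt-abovePts (dn p) = cong dn (toLive-lastPt-abovePts p)

toIdle-pts : ∀ {N} (w : Word idle N) .(lt : toℕ (firstPt w) ℕ.< toℕ (lastPt w)) →
  toIdle (firstPt w) (lastPt w) lt (abovePts w) ≡ w
toIdle-pts (skip w)  lt = cong skip (toIdle-pts w (ℕ.s≤s⁻¹ lt))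
toIdle-pts (start p) lt = cong start (toLive-lastPt-abovePts p)

toWord-fromWord : ∀ {n} (w : Word idle (suc (suc n))) → toWord (fromWord w) ≡ w
toWord-fromWord w = toIdle-pts w _

lastPt-toLive : ∀ {N} (j : Fin N) A → lastPt (toLive j A) ≡ j
lastPt-toLive zero    _             = refl
lastPt-toLive (suc j) (inside ∷ A)  = cong suc (lastPt-toLive j A)
lastPt-toLive (suc j) (outside ∷ A) = cong suc (lastPt-toLive j A)

lastPt-toIdle : ∀ {N} (i j : Fin N) .(lt : toℕ i ℕ.< toℕ j) A → lastPt (toIdle i j lt A) ≡ j
lastPt-toIdle zero    zero    ()
lastPt-toIdle (suc i) zero    ()
lastPt-toIdle zero    (suc j) lt (_ ∷ A) = cong suc (lastPt-toLive j A)
lastPt-toIdle (suc i) (suc j) lt (_ ∷ A) = cong suc (lastPt-toIdle i j (ℕ.s≤s⁻¹ lt) A)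

firstPt-toIdle : ∀ {N} (i j : Fin N) .(lt : toℕ i ℕ.< toℕ j) A → firstPt (toIdle i j lt A) ≡ i
firstPt-toIdle zero    zero    ()
firstPt-toIdle (suc i) zero    ()
firstPt-toIdle zero    (suc j) lt (_ ∷ A) = refl
firstPt-toIdle (suc i) (suc j) lt (_ ∷ A) = cong suc (firstPt-toIdle i j (ℕ.s≤s⁻¹ lt) A)

abovePts-toLive : ∀ {N} (j : Fin N) A → (∀ k → k ∈ A → toℕ k ℕ.< toℕ j) → abovePts (toLive j A) ≡ A
abovePts-toLive zero    (x ∷ A) A⊆ = sym (Empty-unique λ (k , k∈) → ℕ.n≮0 (A⊆ k k∈))
abovePts-toLive (suc j) (inside ∷ A) A⊆ =
  cong (inside ∷_) (abovePts-toLive j A λ k k∈ → ℕ.s≤s⁻¹ (A⊆ (suc k) (there k∈)))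
abovePts-toLive (suc j) (outside ∷ A) A⊆ =
  cong (outside ∷_) (abovePts-toLive j A λ k k∈ → ℕ.s≤s⁻¹ (A⊆ (suc k) (there k∈)))

abovePts-toIdle : ∀ {N} (i j : Fin N) .(lt : toℕ i ℕ.< toℕ j) A →
  (∀ k → k ∈ A → toℕ i ℕ.< toℕ k × toℕ k ℕ.< toℕ j) → abovePts (toIdle i j lt A) ≡ A
abovePts-toIdle zero    zero    ()
abovePts-toIdle (suc i) zero    ()
abovePts-toIdle i (suc j) lt (inside ∷ A) A⊆ = ⊥-elim (ℕ.n≮0 (proj₁ (A⊆ zero here)))
abovePts-toIdle zero    (suc j) lt (outside ∷ A) A⊆ =
  cong (outside ∷_) (abovePts-toLive j A λ k k∈ → ℕ.s≤s⁻¹ (proj₂ (A⊆ (suc k) (there k∈))))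
abovePts-toIdle (suc i) (suc j) lt (outside ∷ A) A⊆ =
  cong (outside ∷_) (abovePts-toIdle i j (ℕ.s≤s⁻¹ lt) A λ k k∈ →
    ℕ.s≤s⁻¹ (proj₁ (A⊆ (suc k) (there k∈))) , ℕ.s≤s⁻¹ (proj₂ (A⊆ (suc k) (there k∈))))

Arc-≡ : ∀ {n} {α β : Arc n} → i α ≡ i β → j α ≡ j β → A α ≡ A β → α ≡ β
Arc-≡ refl refl refl = refl

fromWord-toWord : ∀ {n} (α : Arc n) → fromWord (toWord α) ≡ α
fromWord-toWord (mkArc i j i<j A A⊆) = Arc-≡ (firstPt-toIdle i j i<j A) (lastPt-toIdle i j i<j A)
  -- `A⊆` is an irrelevant field, so the equality derived from it is only available irrelevantly;
  -- decidable equality of subsets recovers it.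
  (recompute (≡-dec Bool._≟_ (abovePts (toIdle i j i<j A)) A) (abovePts-toIdle i j i<j A A⊆))

-- Crossing and pointedness in terms of letters

module _ {n : ℕ} (w : Word idle (suc (suc n))) where

  InB⇒below : ∀ k → InB (fromWord w) k → letter w k ≡ below
  InB⇒below k (lt , lt' , k∉) = interior∧∉ (between⇒interior w k lt lt') refl
    where
    interior∧∉ : ∀ {ℓ} → Interior ℓ → letter w k ≡ ℓ → letter w k ≡ below
    interior∧∉ above eq = ⊥-elim (k∉ (above⇒∈abovePts w k eq))
    interior∧∉ below eq = eq

  below⇒InB : ∀ k → letter w k ≡ below → InB (fromWord w) k
  below⇒InB k eq =
    first<interior w k (subst Interior (sym eq) below) ,
    interior<last w k (subst Interior (sym eq) below) ,
    λ k∈ → contradiction (trans (sym eq) (∈abovePts⇒above w k k∈)) λ ()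

  InEnds⇒first⊎last : ∀ k → InEnds (fromWord w) k → letter w k ≡ first ⊎ letter w k ≡ last
  InEnds⇒first⊎last k (inj₁ refl) = inj₁ (letter-firstPt w)
  InEnds⇒first⊎last k (inj₂ refl) = inj₂ (letter-lastPt w)

module _ {n : ℕ} (w w' : Word idle (suc (suc n))) where

  HalfCross⇒Above : HalfCross (fromWord w) (fromWord w') → Above (letter w) (letter w')
  HalfCross⇒Above (k , inj₁ (a , b)) =
    k , subst₂ Over (sym (∈abovePts⇒above w k a)) (sym (InB⇒below w' k b)) above-below
  HalfCross⇒Above (k , inj₂ (inj₁ (e , b))) with InEnds⇒first⊎last w k e
  ... | inj₁ f = k , subst₂ Over (sym f) (sym (InB⇒below w' k b)) first-below
  ... | inj₂ l = k , subst₂ Over (sym l) (sym (InB⇒below w' k b)) last-below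
  HalfCross⇒Above (k , inj₂ (inj₂ (a , e))) with InEnds⇒first⊎last w' k e
  ... | inj₁ f = k , subst₂ Over (sym (∈abovePts⇒above w k a)) (sym f) above-first
  ... | inj₂ l = k , subst₂ Over (sym (∈abovePts⇒above w k a)) (sym l) above-last

  Above⇒HalfCross : Above (letter w) (letter w') → HalfCross (fromWord w) (fromWord w')
  Above⇒HalfCross (k , o) with letter w k in eq | letter w' k in eq' | o
  ... | _ | _ | above-below = k , inj₁ (above⇒∈abovePts w k eq , below⇒InB w' k eq')
  ... | _ | _ | above-first = k , inj₂ (inj₂ (above⇒∈abovePts w k eq , inj₁ (firstPt-unique w' k eq')))
  ... | _ | _ | above-last  = k , inj₂ (inj₂ (above⇒∈abovePts w k eq , inj₂ (lastPt-unique w' k eq')))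
  ... | _ | _ | first-below = k , inj₂ (inj₁ (inj₁ (firstPt-unique w k eq) , below⇒InB w' k eq'))
  ... | _ | _ | last-below  = k , inj₂ (inj₁ (inj₂ (lastPt-unique w k eq) , below⇒InB w' k eq'))

  NonPointed⇒Clash : NonPointed (fromWord w) (fromWord w') → ∃ λ k → Clash (letter w k) (letter w' k)
  NonPointed⇒Clash (inj₁ eq) = firstPt w , subst₂ Clash (sym (letter-firstPt w))
    (sym (trans (cong (letter w') eq) (letter-lastPt w'))) first-last
  NonPointed⇒Clash (inj₂ eq) = firstPt w' , subst₂ Clash
    (sym (trans (cong (letter w) eq) (letter-lastPt w))) (sym (letter-firstPt w')) last-first

  Clash⇒NonPointed : ∀ k → Clash (letter w k) (letter w' k) → NonPointed (fromWord w) (fromWord w')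
  Clash⇒NonPointed k c with letter w k in eq | letter w' k in eq' | c
  ... | _ | _ | first-last = inj₁ (trans (sym (firstPt-unique w k eq)) (lastPt-unique w' k eq'))
  ... | _ | _ | last-first = inj₂ (trans (sym (firstPt-unique w' k eq')) (lastPt-unique w k eq))

Compat⇒Compatible : ∀ {n} (w w' : Word idle (suc (suc n))) →
  Compat (letter w) (letter w') → Compatible (fromWord w) (fromWord w')
Compat⇒Compatible w w' (nc , nx) =
  (λ np → let k , c = NonPointed⇒Clash w w' np in nc k c) ,
  λ (h , h') → nx (HalfCross⇒Above w w' h , HalfCross⇒Above w' w h')

Compatible⇒Compat : ∀ {n} (w w' : Word idle (suc (suc n))) →
  Compatible (fromWord w) (fromWord w') → Compat (letter w) (letter w')
Compatible⇒Compat w w' (np , nx) =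
  (λ k c → np (Clash⇒NonPointed w w' k c)) ,
  λ (h , h') → nx (Above⇒HalfCross w w' h , Above⇒HalfCross w' w h')

-- The vectors ĝ

T-ext : ∀ {x y} → (T x → T y) → (T y → T x) → x ≡ y
T-ext {false} {false} f g = refl
T-ext {false} {true}  f g = ⊥-elim (g _)
T-ext {true}  {false} f g = ⊥-elim (f _)
T-ext {true}  {true}  f g = refl

2*suc : ∀ m → 2 ℕ.* suc m ≡ suc (suc (2 ℕ.* m))
2*suc m = ℕ.*-suc 2 m

2*suc∸1 : ∀ m → 2 ℕ.* suc m ∸ 1 ≡ suc (2 ℕ.* m)
2*suc∸1 m = cong (_∸ 1) (2*suc m)

module _ {n : ℕ} (k : Fin n) where

  innerPt : Pt n
  innerPt = suc (inject₁ k)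

  private
    toℕ-innerPt : toℕ innerPt ≡ suc (toℕ k)
    toℕ-innerPt = cong suc (Fin.toℕ-inject₁ k)

    ≡innerPt : ∀ {a : Pt n} → toℕ a ≡ suc (toℕ k) → a ≡ innerPt
    ≡innerPt eq = Fin.toℕ-injective (trans eq (sym toℕ-innerPt))

    innerPt≤n : toℕ innerPt ℕ.≤ n
    innerPt≤n = subst (ℕ._≤ n) (sym toℕ-innerPt) (Fin.toℕ<n k)

  -- The index x equals c a exactly for a = innerPt when b holds, and for no a otherwise.
  Hits : Bool → ℕ → (ℕ → ℕ) → Set
  Hits b x c = ∀ (a : Pt n) → (x ≡ c (toℕ a) → T b × a ≡ innerPt) × (T b × a ≡ innerPt → x ≡ c (toℕ a))

  private
    double : ℕ → ℕ
    double m = 2 ℕ.* m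
    double∸1 : ℕ → ℕ
    double∸1 m = 2 ℕ.* m ∸ 1

  odd-hits-odd : Hits true (suc (2 ℕ.* toℕ k)) double∸1
  odd-hits-odd a =
    (λ eq → _ , ≡innerPt (half (toℕ a) eq)) ,
    λ { (_ , refl) → sym (trans (cong double∸1 toℕ-innerPt) (2*suc∸1 (toℕ k))) }
    where
    half : ∀ m → suc (2 ℕ.* toℕ k) ≡ 2 ℕ.* m ∸ 1 → m ≡ suc (toℕ k)
    -- For m = 0 the truncated difference is 0, which is not a successor, so that case is empty.
    half (suc m) eq = cong suc (ℕ.*-cancelˡ-≡ m (toℕ k) 2
      (sym (ℕ.suc-injective (trans eq (2*suc∸1 m)))))

  odd-misses-even : Hits false (suc (2 ℕ.* toℕ k)) double
  odd-misses-even a = (λ eq → ⊥-elim (ℕ.even≢odd (toℕ a) (toℕ k) (sym eq))) , λ ()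

  even-hits-even : Hits true (suc (suc (2 ℕ.* toℕ k))) double
  even-hits-even a =
    (λ eq → _ , ≡innerPt (ℕ.*-cancelˡ-≡ (toℕ a) (suc (toℕ k)) 2 (trans (sym eq) (sym (2*suc (toℕ k)))))) ,
    λ { (_ , refl) → sym (trans (cong double toℕ-innerPt) (2*suc (toℕ k))) }

  even-misses-odd : Hits false (suc (suc (2 ℕ.* toℕ k))) double∸1
  even-misses-odd a = (λ eq → ⊥-elim (absurd (toℕ a) eq)) , λ ()
    where
    absurd : ∀ m → suc (suc (2 ℕ.* toℕ k)) ≢ 2 ℕ.* m ∸ 1
    absurd (suc m) eq = ℕ.even≢odd m (toℕ k) (sym (ℕ.suc-injective (trans eq (2*suc∸1 m))))

  -- The common shape of the Boolean tests `inPlus` and `inMinus`.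
  indexTest : Pt n → Pt n → (ℕ → ℕ) → (ℕ → ℕ) → (Pt n → Bool) → ℕ → Bool
  indexTest i j cᵢ cⱼ mem x =
    ((1 ≤ᵇ toℕ i) ∧ (x ≡ᵇ cᵢ (toℕ i))) ∨
    ((toℕ j ≤ᵇ n) ∧ (x ≡ᵇ cⱼ (toℕ j))) ∨
    any (λ a → mem a ∧ ((x ≡ᵇ (2 ℕ.* toℕ a ∸ 1)) ∨ (x ≡ᵇ 2 ℕ.* toℕ a))) (allFin (suc (suc n)))

  letterTest : Bool → Bool → (Letter → Bool) → Letter → Bool
  letterTest bᵢ bⱼ m none  = false
  letterTest bᵢ bⱼ m first = bᵢ
  letterTest bᵢ bⱼ m last  = bⱼ
  letterTest bᵢ bⱼ m above = m above
  letterTest bᵢ bⱼ m below = m below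

  module _ (w : Word idle (suc (suc n))) {cᵢ cⱼ : ℕ → ℕ} {bᵢ bⱼ b₁ b₂ : Bool} {x : ℕ}
    (m : Letter → Bool) {mem : Pt n → Bool}
    (m-none : m none ≡ false) (m-first : m first ≡ false) (m-last : m last ≡ false)
    (mem≡m : mem innerPt ≡ m (letter w innerPt))
    (hitᵢ : Hits bᵢ x cᵢ) (hitⱼ : Hits bⱼ x cⱼ)
    (hit₁ : Hits b₁ x double∸1) (hit₂ : Hits b₂ x double) (hit : T (b₁ ∨ b₂)) where

    private
      open Equivalence

      test : Bool
      test = indexTest (firstPt w) (lastPt w) cᵢ cⱼ mem x

      at-member : Pt n → Bool
      at-member a = mem a ∧ ((x ≡ᵇ (2 ℕ.* toℕ a ∸ 1)) ∨ (x ≡ᵇ 2 ℕ.* toℕ a))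

      Cases : Set
      Cases = (T bᵢ × letter w innerPt ≡ first) ⊎ (T bⱼ × letter w innerPt ≡ last) ⊎ T (m (letter w innerPt))

      at-member⇒ : ∀ a → T (at-member a) → T (m (letter w innerPt))
      at-member⇒ a t with to (T-∧ {mem a}) t
      ... | ma , t' = subst T (trans (cong mem a≡) mem≡m) ma
        where
        a≡ : a ≡ innerPt
        a≡ = [ (λ t₁ → proj₂ (proj₁ (hit₁ a) (ℕ.≡ᵇ⇒≡ x _ t₁)))
             , (λ t₂ → proj₂ (proj₁ (hit₂ a) (ℕ.≡ᵇ⇒≡ x _ t₂))) ]′
             (to (T-∨ {x ≡ᵇ (2 ℕ.* toℕ a ∸ 1)}) t')

      test⇒ : T test → Cases
      test⇒ t with to (T-∨ {(1 ≤ᵇ toℕ (firstPt w)) ∧ (x ≡ᵇ cᵢ (toℕ (firstPt w)))}) t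
      ... | inj₁ t₁ with proj₁ (hitᵢ (firstPt w))
                           (ℕ.≡ᵇ⇒≡ x _ (proj₂ (to (T-∧ {1 ≤ᵇ toℕ (firstPt w)}) t₁)))
      ...   | tb , eq = inj₁ (tb , subst (λ a → letter w a ≡ first) eq (letter-firstPt w))
      test⇒ t | inj₂ t' with to (T-∨ {(toℕ (lastPt w) ≤ᵇ n) ∧ (x ≡ᵇ cⱼ (toℕ (lastPt w)))}) t'
      ... | inj₁ t₂ with proj₁ (hitⱼ (lastPt w))
                           (ℕ.≡ᵇ⇒≡ x _ (proj₂ (to (T-∧ {toℕ (lastPt w) ≤ᵇ n}) t₂)))
      ...   | tb , eq = inj₂ (inj₁ (tb , subst (λ a → letter w a ≡ last) eq (letter-lastPt w)))
      test⇒ t | inj₂ t' | inj₂ t₃ with Any.satisfied (any⁻ at-member (allFin (suc (suc n))) t₃)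
      ... | a , ta = inj₂ (inj₂ (at-member⇒ a ta))

      ⇒test : Cases → T test
      ⇒test (inj₁ (tb , eq)) = from (T-∨ {(1 ≤ᵇ toℕ (firstPt w)) ∧ (x ≡ᵇ cᵢ (toℕ (firstPt w)))})
        (inj₁ (from (T-∧ {1 ≤ᵇ toℕ (firstPt w)})
          ( ℕ.≤⇒≤ᵇ (subst (λ a → 1 ℕ.≤ toℕ a) (firstPt-unique w innerPt eq) (s≤s z≤n))
          , ℕ.≡⇒≡ᵇ x _ (proj₂ (hitᵢ (firstPt w)) (tb , sym (firstPt-unique w innerPt eq))))))
      ⇒test (inj₂ c) = from (T-∨ {(1 ≤ᵇ toℕ (firstPt w)) ∧ (x ≡ᵇ cᵢ (toℕ (firstPt w)))})
        (inj₂ (from (T-∨ {(toℕ (lastPt w) ≤ᵇ n) ∧ (x ≡ᵇ cⱼ (toℕ (lastPt w)))}) (go c)))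
        where
        go : (T bⱼ × letter w innerPt ≡ last) ⊎ T (m (letter w innerPt)) → _
        go (inj₁ (tb , eq)) = inj₁ (from (T-∧ {toℕ (lastPt w) ≤ᵇ n})
          ( ℕ.≤⇒≤ᵇ (subst (λ a → toℕ a ℕ.≤ n) (lastPt-unique w innerPt eq) innerPt≤n)
          , ℕ.≡⇒≡ᵇ x _ (proj₂ (hitⱼ (lastPt w)) (tb , sym (lastPt-unique w innerPt eq)))))
        go (inj₂ tm) = inj₂ (any⁺ at-member (lose (∈-allFin innerPt)
          (from (T-∧ {mem innerPt}) (subst T (sym mem≡m) tm ,
            from (T-∨ {x ≡ᵇ (2 ℕ.* toℕ innerPt ∸ 1)}) (
              [ (λ tb₁ → inj₁ (ℕ.≡⇒≡ᵇ x _ (proj₂ (hit₁ innerPt) (tb₁ , refl))))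
              , (λ tb₂ → inj₂ (ℕ.≡⇒≡ᵇ x _ (proj₂ (hit₂ innerPt) (tb₂ , refl)))) ]′
              (to (T-∨ {b₁}) hit))))))

    -- The index x belongs to one inner point, so each disjunct can hold only through that point.
    -- The guards 1 ≤ i and j ≤ n, which delete the indices outside 1, ..., 2n, hold automatically
    -- when the endpoint is that inner point.
    indexTest≡letterTest : test ≡ letterTest bᵢ bⱼ m (letter w innerPt)
    indexTest≡letterTest = T-ext (λ t → cases⇒ _ refl (test⇒ t)) (λ t → ⇒test (⇒cases _ refl t))
      where
      cases⇒ : ∀ ℓ → letter w innerPt ≡ ℓ → Cases → T (letterTest bᵢ bⱼ m ℓ)
      cases⇒ first eq (inj₁ (tb , _)) = tb
      cases⇒ none  eq (inj₁ (tb , eq')) = contradiction (trans (sym eq) eq') λ ()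
      cases⇒ last  eq (inj₁ (tb , eq')) = contradiction (trans (sym eq) eq') λ ()
      cases⇒ above eq (inj₁ (tb , eq')) = contradiction (trans (sym eq) eq') λ ()
      cases⇒ below eq (inj₁ (tb , eq')) = contradiction (trans (sym eq) eq') λ ()
      cases⇒ last  eq (inj₂ (inj₁ (tb , _))) = tb
      cases⇒ none  eq (inj₂ (inj₁ (tb , eq'))) = contradiction (trans (sym eq) eq') λ ()
      cases⇒ first eq (inj₂ (inj₁ (tb , eq'))) = contradiction (trans (sym eq) eq') λ ()
      cases⇒ above eq (inj₂ (inj₁ (tb , eq'))) = contradiction (trans (sym eq) eq') λ ()
      cases⇒ below eq (inj₂ (inj₁ (tb , eq'))) = contradiction (trans (sym eq) eq') λ ()
      cases⇒ none  eq (inj₂ (inj₂ tm)) = subst T (trans (cong m eq) m-none) tm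
      cases⇒ first eq (inj₂ (inj₂ tm)) = ⊥-elim (subst T (trans (cong m eq) m-first) tm)
      cases⇒ last  eq (inj₂ (inj₂ tm)) = ⊥-elim (subst T (trans (cong m eq) m-last) tm)
      cases⇒ above eq (inj₂ (inj₂ tm)) = subst T (cong m eq) tm
      cases⇒ below eq (inj₂ (inj₂ tm)) = subst T (cong m eq) tm

      ⇒cases : ∀ ℓ → letter w innerPt ≡ ℓ → T (letterTest bᵢ bⱼ m ℓ) → Cases
      ⇒cases first eq t = inj₁ (t , eq)
      ⇒cases last  eq t = inj₂ (inj₁ (t , eq))
      ⇒cases above eq t = inj₂ (inj₂ (subst T (cong m (sym eq)) t))
      ⇒cases below eq t = inj₂ (inj₂ (subst T (cong m (sym eq)) t))

  module _ (w : Word idle (suc (suc n))) where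

    private
      open Equivalence

      ℓ : Letter
      ℓ = letter w innerPt

      mem⁺ : lookup (abovePts w) innerPt ≡ isAbove ℓ
      mem⁺ = lookup-abovePts w innerPt

      mem⁻ : inBᵇ (fromWord w) innerPt ≡ isBelow ℓ
      mem⁻ = T-ext
        (λ t → let lt , t' = to (T-∧ {toℕ (firstPt w) <ᵇ toℕ innerPt}) t
                   lt' , nin = to (T-∧ {toℕ innerPt <ᵇ toℕ (lastPt w)}) t' in
          subst (T ∘ isBelow) (sym (InB⇒below w innerPt
            ( ℕ.<ᵇ⇒< (toℕ (firstPt w)) _ lt , ℕ.<ᵇ⇒< (toℕ innerPt) _ lt'
            , λ k∈ → contradiction (trans (sym ([]=⇒lookup k∈)) (to T-not-≡ nin)) λ ()))) _)
        (λ t → let lt , lt' , k∉ = below⇒InB w innerPt (isBelow⇒≡ t) in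
          from (T-∧ {toℕ (firstPt w) <ᵇ toℕ innerPt}) (ℕ.<⇒<ᵇ lt ,
            from (T-∧ {toℕ innerPt <ᵇ toℕ (lastPt w)}) (ℕ.<⇒<ᵇ lt' ,
              subst (T ∘ not) (sym (trans mem⁺ (cong isAbove (isBelow⇒≡ t)))) _)))
        where
        isBelow⇒≡ : ∀ {ℓ} → T (isBelow ℓ) → ℓ ≡ below
        isBelow⇒≡ {below} _ = refl

    -- Both positions and points are counted from 0: position 2k holds the index 2(k + 1) - 1, the
    -- first of the two indices of `innerPt`, which is point k + 1.
    ghat-odd : ∀ (p : Fin (2 ℕ.* n)) → toℕ p ≡ 2 ℕ.* toℕ k → ghat (fromWord w) p ≡ val₁ ℓ
    ghat-odd p eq = trans (cong (λ x → ind (inPlus (fromWord w) (suc x)) - ind (inMinus (fromWord w) (suc x))) eq)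
      (trans (cong₂ (λ b b' → ind b - ind b')
        (indexTest≡letterTest w {cᵢ = double∸1} {double} isAbove {lookup (abovePts w)} refl refl refl mem⁺
          odd-hits-odd odd-misses-even odd-hits-odd odd-misses-even _)
        (indexTest≡letterTest w {cᵢ = double} {double∸1} isBelow {inBᵇ (fromWord w)} refl refl refl mem⁻
          odd-misses-even odd-hits-odd odd-hits-odd odd-misses-even _))
        (value ℓ))
      where
      value : ∀ ℓ → ind (letterTest true false isAbove ℓ) - ind (letterTest false true isBelow ℓ) ≡ val₁ ℓ
      value none  = refl
      value first = refl
      value last  = refl
      value above = refl
      value below = refl

    ghat-even : ∀ (p : Fin (2 ℕ.* n)) → toℕ p ≡ suc (2 ℕ.* toℕ k) → ghat (fromWord w) p ≡ val₂ ℓ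
    ghat-even p eq = trans (cong (λ x → ind (inPlus (fromWord w) (suc x)) - ind (inMinus (fromWord w) (suc x))) eq)
      (trans (cong₂ (λ b b' → ind b - ind b')
        (indexTest≡letterTest w {cᵢ = double∸1} {double} isAbove {lookup (abovePts w)} refl refl refl mem⁺
          even-misses-odd even-hits-even even-misses-odd even-hits-even _)
        (indexTest≡letterTest w {cᵢ = double} {double∸1} isBelow {inBᵇ (fromWord w)} refl refl refl mem⁻
          even-hits-even even-misses-odd even-misses-odd even-hits-even _))
        (value ℓ))
      where
      value : ∀ ℓ → ind (letterTest false true isAbove ℓ) - ind (letterTest true false isBelow ℓ) ≡ val₂ ℓ
      value none  = refl
      value first = refl
      value last  = refl
      value above = refl
      value below = refl

-- Linear algebra over ℚ

sumF-cong : ∀ {d} {f g : Fin d → ℚ} → (∀ p → f p ≡ g p) → sumF f ≡ sumF g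
sumF-cong {zero}  h = refl
sumF-cong {suc d} h = cong₂ _+_ (h zero) (sumF-cong (h ∘ suc))

sumF-+ : ∀ {d} (f g : Fin d → ℚ) → sumF (λ p → f p + g p) ≡ sumF f + sumF g
sumF-+ {zero}  f g = refl
sumF-+ {suc d} f g = trans (cong (f zero + g zero +_) (sumF-+ (f ∘ suc) (g ∘ suc)))
                           (+-interchange (f zero) (g zero) (sumF (f ∘ suc)) _)

sumF-*ˡ : ∀ {d} c (f : Fin d → ℚ) → sumF (λ p → c * f p) ≡ c * sumF f
sumF-*ˡ {zero}  c f = sym (ℚ.*-zeroʳ c)
sumF-*ˡ {suc d} c f = trans (cong (c * f zero +_) (sumF-*ˡ c (f ∘ suc)))
                            (sym (ℚ.*-distribˡ-+ c (f zero) _))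

sumF-zero : ∀ {d} {f : Fin d → ℚ} → (∀ p → f p ≡ 0ℚ) → sumF f ≡ 0ℚ
sumF-zero {zero}  h = refl
sumF-zero {suc d} h = cong₂ _+_ (h zero) (sumF-zero (h ∘ suc))

sumF-nonneg : ∀ {d} {f : Fin d → ℚ} → (∀ p → 0ℚ ≤ f p) → 0ℚ ≤ sumF f
sumF-nonneg {zero}  h = ℚ.≤-refl
sumF-nonneg {suc d} h = +-nonneg (h zero) (sumF-nonneg (h ∘ suc))

+-zero⁻¹ : ∀ {a b} → 0ℚ ≤ a → 0ℚ ≤ b → a + b ≡ 0ℚ → a ≡ 0ℚ × b ≡ 0ℚ
+-zero⁻¹ {a} {b} 0≤a 0≤b eq =
  sym (≤∧≮⇒≡ 0≤a λ lt → ℚ.<-irrefl (sym eq) (ℚ.+-mono-<-≤ lt 0≤b)) ,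
  sym (≤∧≮⇒≡ 0≤b λ lt → ℚ.<-irrefl (sym eq) (ℚ.+-mono-≤-< 0≤a lt))

sumF-zero⁻¹ : ∀ {d} {f : Fin d → ℚ} → (∀ p → 0ℚ ≤ f p) → sumF f ≡ 0ℚ → ∀ p → f p ≡ 0ℚ
sumF-zero⁻¹ h eq zero    = proj₁ (+-zero⁻¹ (h zero) (sumF-nonneg (h ∘ suc)) eq)
sumF-zero⁻¹ h eq (suc p) =
  sumF-zero⁻¹ (h ∘ suc) (proj₂ (+-zero⁻¹ (h zero) (sumF-nonneg (h ∘ suc)) eq)) p

sumF-sumW : ∀ {d s N} (f : Fin d → Word s N → ℚ) →
  sumF (λ p → sumW (f p)) ≡ sumW (λ w → sumF (λ p → f p w))
sumF-sumW {zero} {s} {N} f = sym (sumW-zero {s} {N} λ _ → refl)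
sumF-sumW {suc d} f = trans (cong (sumW (f zero) +_) (sumF-sumW (f ∘ suc)))
                            (sym (sumW-+ (f zero) _))

inverse : ∀ q → q ≢ 0ℚ → ∃ λ r → r * q ≡ 1ℚ
inverse q q≢0 = (1/ q) {{≢-nonZero q≢0}} , ℚ.*-inverseˡ q {{≢-nonZero q≢0}}

square-zero⁻¹ : ∀ q → q * q ≡ 0ℚ → q ≡ 0ℚ
square-zero⁻¹ q eq with q ℚ.≟ 0ℚ
... | yes q≡0 = q≡0
... | no  q≢0 with inverse q q≢0
...   | r , rq≡1 = begin
  q           ≡⟨ sym (ℚ.*-identityˡ q) ⟩
  1ℚ * q      ≡⟨ cong (_* q) (sym rq≡1) ⟩
  r * q * q   ≡⟨ ℚ.*-assoc r q q ⟩
  r * (q * q) ≡⟨ cong (r *_) eq ⟩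
  r * 0ℚ      ≡⟨ ℚ.*-zeroʳ r ⟩
  0ℚ          ∎
  where open ≡-Reasoning

square-nonneg : ∀ q → 0ℚ ≤ q * q
square-nonneg q with ℚ.≤-total 0ℚ q
... | inj₁ 0≤q = *-nonneg 0≤q 0≤q
... | inj₂ q≤0 = subst (0ℚ ≤_) (solve 1 (λ q → (:- q) :* (:- q) := q :* q) refl q)
                   (*-nonneg (ℚ.neg-antimono-≤ q≤0) (ℚ.neg-antimono-≤ q≤0))

-- Scalar products and orthogonal residues

module _ {d : ℕ} where

  dot-cong : ∀ (f : Vect d) {x y} → (∀ p → x p ≡ y p) → dot f x ≡ dot f y
  dot-cong f h = sumF-cong λ p → cong (f p *_) (h p)

  dot-+ʳ : ∀ (f x y : Vect d) → dot f (λ p → x p + y p) ≡ dot f x + dot f y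
  dot-+ʳ f x y = trans (sumF-cong λ p → ℚ.*-distribˡ-+ (f p) (x p) (y p))
    (sumF-+ (λ p → f p * x p) (λ p → f p * y p))

  dot-*ʳ : ∀ (f : Vect d) c x → dot f (λ p → c * x p) ≡ c * dot f x
  dot-*ʳ f c x = trans
    (sumF-cong λ p → solve 3 (λ f c x → f :* (c :* x) := c :* (f :* x)) refl (f p) c (x p))
    (sumF-*ˡ c (λ p → f p * x p))

  dot-comm : ∀ (x y : Vect d) → dot x y ≡ dot y x
  dot-comm x y = sumF-cong λ p → ℚ.*-comm (x p) (y p)

  dot-+*ˡ : ∀ (x y : Vect d) c z → dot (λ p → x p + c * y p) z ≡ dot x z + c * dot y z
  dot-+*ˡ x y c z = begin
    dot (λ p → x p + c * y p) z          ≡⟨ dot-comm _ z ⟩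
    dot z (λ p → x p + c * y p)          ≡⟨ dot-+ʳ z x (λ p → c * y p) ⟩
    dot z x + dot z (λ p → c * y p)      ≡⟨ cong₂ _+_ (dot-comm z x) (trans (dot-*ʳ z c y) (cong (c *_) (dot-comm z y))) ⟩
    dot x z + c * dot y z                ∎
    where open ≡-Reasoning

  dot-sumW : ∀ (f : Vect d) {s N} (φ : Word s N → ℚ) (g : Word s N → Vect d) →
    dot f (λ p → sumW (λ w → φ w * g w p)) ≡ sumW (λ w → φ w * dot f (g w))
  dot-sumW f φ g = trans
    (sumF-cong λ p → trans (ℚ.*-comm (f p) _) (sym (sumW-*ʳ (λ w → φ w * g w p) (f p))))
    (trans (sumF-sumW (λ p w → φ w * g w p * f p)) (sumW-cong λ w → trans
      (sumF-cong λ p → solve 3 (λ φ g f → φ :* g :* f := φ :* (f :* g)) refl (φ w) (g w p) (f p))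
      (sumF-*ˡ (φ w) (λ p → f p * g w p))))

  dot-self-zero⁻¹ : ∀ (x : Vect d) → dot x x ≡ 0ℚ → ∀ p → x p ≡ 0ℚ
  dot-self-zero⁻¹ x eq p = square-zero⁻¹ (x p) (sumF-zero⁻¹ (λ p → square-nonneg (x p)) eq p)

  Perp : List (Vect d) → Vect d → Set
  Perp V w = ∀ k → dot w (L.lookup V k) ≡ 0ℚ

  dot-comb-perp : ∀ (V : List (Vect d)) w c → Perp V w → dot w (comb V c) ≡ 0ℚ
  dot-comb-perp []      w c perp = sumF-zero λ p → ℚ.*-zeroʳ (w p)
  dot-comb-perp (v ∷ V) w c perp = trans (dot-+ʳ w (λ p → c zero * v p) (comb V (c ∘ suc)))
    (cong₂ _+_ (trans (dot-*ʳ w (c zero) v) (trans (cong (c zero *_) (perp zero)) (ℚ.*-zeroʳ (c zero))))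
               (dot-comb-perp V w (c ∘ suc) (perp ∘ suc)))

  comb-linear : ∀ (V : List (Vect d)) (a b : Fin (length V) → ℚ) r p →
    comb V (λ k → a k + r * b k) p ≡ comb V a p + r * comb V b p
  comb-linear []      a b r p = solve 1 (λ r → con 0ℚ := con 0ℚ :+ r :* con 0ℚ) refl r
  comb-linear (v ∷ V) a b r p =
    trans (cong ((a zero + r * b zero) * v p +_) (comb-linear V (a ∘ suc) (b ∘ suc) r p))
      (solve 6 (λ a b r v x y → (a :+ r :* b) :* v :+ (x :+ r :* y) := (a :* v :+ x) :+ r :* (b :* v :+ y))
        refl (a zero) (b zero) r (v p) (comb V (a ∘ suc) p) (comb V (b ∘ suc) p))

  record Residue (V : List (Vect d)) (v : Vect d) : Set where
    field
      residue : Vect d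
      coeff   : Fin (length V) → ℚ
      split   : ∀ p → residue p + comb V coeff p ≡ v p
      perp    : Perp V residue

    dot-residue : dot residue v ≡ dot residue residue
    dot-residue = trans (dot-cong residue (λ p → sym (split p)))
      (trans (dot-+ʳ residue residue (comb V coeff))
        (trans (cong (dot residue residue +_) (dot-comb-perp V residue coeff perp)) (ℚ.+-identityʳ (dot residue residue))))

  -- A sum of rational squares vanishes only if every term does, so a y with zero norm is itself
  -- zero and the ratio 0 works. This lets `gram-schmidt` treat arbitrary lists.
  projection-ratio : ∀ (x y : Vect d) → ∃ λ r → dot x y + r * dot y y ≡ 0ℚ
  projection-ratio x y with dot y y ℚ.≟ 0ℚ
  ... | yes eq = 0ℚ , trans (cong₂ _+_
        (sumF-zero λ p → trans (cong (x p *_) (dot-self-zero⁻¹ y eq p)) (ℚ.*-zeroʳ (x p)))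
        (ℚ.*-zeroˡ (dot y y))) refl
  ... | no neq with inverse (dot y y) neq
  ...   | r , eq = - (dot x y) * r , (begin
    a + (- a * r) * q   ≡⟨ solve 3 (λ a r q → a :+ (:- a :* r) :* q := a :- a :* (r :* q)) refl a r q ⟩
    a - a * (r * q)     ≡⟨ cong (λ z → a - a * z) eq ⟩
    a - a * 1ℚ          ≡⟨ solve 1 (λ a → a :- a :* con 1ℚ := con 0ℚ) refl a ⟩
    0ℚ                  ∎)
    where
    open ≡-Reasoning
    a q : ℚ
    a = dot x y
    q = dot y y

  -- Subtracting from the residue of v modulo V its projection onto the residue of u makes it
  -- orthogonal to u and keeps it orthogonal to V.
  gram-schmidt : ∀ V v → Residue V v
  gram-schmidt [] v = record
    { residue = v ; coeff = λ () ; split = λ p → ℚ.+-identityʳ (v p) ; perp = λ () }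
  gram-schmidt (u ∷ V) v = record
    { residue = λ p → y p + r * x p
    ; coeff = λ { zero → - r ; (suc k) → RV.coeff k + r * RU.coeff k }
    ; split = λ p → begin
        (y p + r * x p) + (- r * u p + comb V (λ k → RV.coeff k + r * RU.coeff k) p)
          ≡⟨ cong₂ (λ a b → (y p + r * x p) + (- r * a + b)) (sym (RU.split p))
               (comb-linear V RV.coeff RU.coeff r p) ⟩
        (y p + r * x p) + (- r * (x p + comb V RU.coeff p) + (comb V RV.coeff p + r * comb V RU.coeff p))
          ≡⟨ solve 5 (λ y r x a b → (y :+ r :* x) :+ (:- r :* (x :+ a) :+ (b :+ r :* a)) := y :+ b) refl
               (y p) r (x p) (comb V RU.coeff p) (comb V RV.coeff p) ⟩
        y p + comb V RV.coeff p
          ≡⟨ RV.split p ⟩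
        v p ∎
    ; perp = λ { zero → perp-u ; (suc k) → perp-V k } }
    where
    open ≡-Reasoning
    module RU = Residue (gram-schmidt V u)
    module RV = Residue (gram-schmidt V v)
    x y : Vect d
    x = RU.residue
    y = RV.residue
    r : ℚ
    r = proj₁ (projection-ratio y x)

    perp-V : Perp V (λ p → y p + r * x p)
    perp-V k = trans (dot-+*ˡ y x r (L.lookup V k))
      (trans (cong₂ (λ a b → a + r * b) (RV.perp k) (RU.perp k))
        (solve 1 (λ r → con 0ℚ :+ r :* con 0ℚ := con 0ℚ) refl r))

    perp-u : dot (λ p → y p + r * x p) u ≡ 0ℚ
    perp-u = begin
      dot (λ p → y p + r * x p) u
        ≡⟨ dot-cong (λ p → y p + r * x p) (λ p → sym (RU.split p)) ⟩
      dot (λ p → y p + r * x p) (λ p → x p + comb V RU.coeff p)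
        ≡⟨ dot-+ʳ (λ p → y p + r * x p) x (comb V RU.coeff) ⟩
      dot (λ p → y p + r * x p) x + dot (λ p → y p + r * x p) (comb V RU.coeff)
        ≡⟨ cong₂ _+_ (dot-+*ˡ y x r x) (dot-comb-perp V (λ p → y p + r * x p) RU.coeff perp-V) ⟩
      (dot y x + r * dot x x) + 0ℚ
        ≡⟨ ℚ.+-identityʳ (dot y x + r * dot x x) ⟩
      dot y x + r * dot x x
        ≡⟨ proj₂ (projection-ratio y x) ⟩
      0ℚ ∎

  LinIndep-tail : ∀ {v : Vect d} {V} → LinIndep (v ∷ V) → LinIndep V
  LinIndep-tail {v} {V} indep c eq k = indep (λ { zero → 0ℚ ; (suc k) → c k })
    (λ p → trans (cong₂ _+_ (ℚ.*-zeroˡ (v p)) (eq p)) refl) (suc k)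

  -- A functional with the right values on V is corrected along the residue of v modulo V. This
  -- direction is orthogonal to V and, by independence, has a nonzero product with v.
  dual-functional : ∀ (V : List (Vect d)) → LinIndep V → ∀ (t : Fin (length V) → ℚ) →
    ∃ λ f → ∀ k → dot f (L.lookup V k) ≡ t k
  dual-functional []      indep t = (λ _ → 0ℚ) , λ ()
  dual-functional (v ∷ V) indep t with dual-functional V (LinIndep-tail {v} {V} indep) (t ∘ suc)
  ... | f , f-V = (λ p → f p + a * w p) , λ { zero → at-v ; (suc k) → at-V k }
    where
    open ≡-Reasoning
    R : Residue V v
    R = gram-schmidt V v
    open Residue R renaming (residue to w)

    w≢0 : dot w w ≢ 0ℚ
    -- A vanishing residue would make v a combination of V. The summand 0ℚ brings the coefficients
    -- into the form of `comb-linear`.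
    w≢0 eq = contradiction (indep (λ { zero → 1ℚ ; (suc k) → 0ℚ + (- 1ℚ) * coeff k }) vanish zero) λ ()
      where
      vanish : ∀ p → 1ℚ * v p + comb V (λ k → 0ℚ + (- 1ℚ) * coeff k) p ≡ 0ℚ
      vanish p = begin
        1ℚ * v p + comb V (λ k → 0ℚ + (- 1ℚ) * coeff k) p
          ≡⟨ cong (1ℚ * v p +_) (comb-linear V (λ _ → 0ℚ) coeff (- 1ℚ) p) ⟩
        1ℚ * v p + (comb V (λ _ → 0ℚ) p + (- 1ℚ) * comb V coeff p)
          ≡⟨ cong₂ (λ a b → 1ℚ * a + (b + (- 1ℚ) * comb V coeff p)) (sym (split p))
               (sumF-zero λ k → ℚ.*-zeroˡ (L.lookup V k p)) ⟩
        1ℚ * (w p + comb V coeff p) + (0ℚ + (- 1ℚ) * comb V coeff p)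
          ≡⟨ solve 2 (λ w c → con 1ℚ :* (w :+ c) :+ (con 0ℚ :+ con (- 1ℚ) :* c) := w) refl (w p) (comb V coeff p) ⟩
        w p
          ≡⟨ dot-self-zero⁻¹ w eq p ⟩
        0ℚ ∎

    r a : ℚ
    r = proj₁ (inverse (dot w w) w≢0)
    a = (t zero - dot f v) * r

    at-v : dot (λ p → f p + a * w p) v ≡ t zero
    at-v = begin
      dot (λ p → f p + a * w p) v
        ≡⟨ dot-+*ˡ f w a v ⟩
      dot f v + a * dot w v
        ≡⟨ cong (λ z → dot f v + a * z) dot-residue ⟩
      dot f v + a * dot w w
        ≡⟨ solve 4 (λ f t r q → f :+ ((t :- f) :* r) :* q := f :+ (t :- f) :* (r :* q)) refl (dot f v) (t zero) r (dot w w) ⟩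
      dot f v + (t zero - dot f v) * (r * dot w w)
        ≡⟨ cong (λ z → dot f v + (t zero - dot f v) * z) (proj₂ (inverse (dot w w) w≢0)) ⟩
      dot f v + (t zero - dot f v) * 1ℚ
        ≡⟨ solve 2 (λ f t → f :+ (t :- f) :* con 1ℚ := t) refl (dot f v) (t zero) ⟩
      t zero ∎

    at-V : ∀ k → dot (λ p → f p + a * w p) (L.lookup V k) ≡ t (suc k)
    at-V k = trans (dot-+*ˡ f w a (L.lookup V k)) (trans
      (cong₂ (λ x y → x + a * y) (f-V k) (perp k))
      (solve 2 (λ t a → t :+ a :* con 0ℚ := t) refl (t (suc k)) a))

-- The orthogonal projection

-- Given as an explicit reduced fraction, so that the reciprocal of a positive value computes to the
-- reduced form of `invℕ`.
fromℕℚ : ℕ → ℚ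
fromℕℚ m = mkℚ (ℤ.+ m) 0 (Coprime.sym (Coprime.1-coprimeTo m))

fromℕℚ-suc : ∀ m → 1ℚ + fromℕℚ m ≡ fromℕℚ (suc m)
fromℕℚ-suc m = trans
  (cong (λ z → (ℤ.+ 1 ℤ.+ z) / 1) (ℤ.*-identityʳ (ℤ.+ m)))
  (ℚ.normalize-coprime (Coprime.sym (Coprime.1-coprimeTo (suc m))))

sumF-const : ∀ d t → sumF {d} (λ _ → t) ≡ fromℕℚ d * t
sumF-const zero    t = sym (ℚ.*-zeroˡ t)
sumF-const (suc d) t = begin
  t + sumF {d} (λ _ → t)   ≡⟨ cong (t +_) (sumF-const d t) ⟩
  t + fromℕℚ d * t         ≡⟨ solve 2 (λ t m → t :+ m :* t := (con 1ℚ :+ m) :* t) refl t (fromℕℚ d) ⟩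
  (1ℚ + fromℕℚ d) * t      ≡⟨ cong (_* t) (fromℕℚ-suc d) ⟩
  fromℕℚ (suc d) * t       ∎
  where open ≡-Reasoning

fromℕℚ*invℕ : ∀ d → fromℕℚ (suc d) * invℕ (suc d) ≡ 1ℚ
fromℕℚ*invℕ d = trans
  (cong (fromℕℚ (suc d) *_) (ℚ.normalize-coprime (Coprime.1-coprimeTo (suc d))))
  (ℚ.*-inverseʳ (fromℕℚ (suc d)))

sumF-const*invℕ : ∀ {d} → 1 ℕ.≤ d → ∀ t → sumF {d} (λ _ → t) * invℕ d ≡ t
sumF-const*invℕ {suc d} _ t = begin
  sumF {suc d} (λ _ → t) * invℕ (suc d)   ≡⟨ cong (_* invℕ (suc d)) (sumF-const (suc d) t) ⟩
  fromℕℚ (suc d) * t * invℕ (suc d)       ≡⟨ solve 3 (λ m t i → m :* t :* i := m :* i :* t) refl (fromℕℚ (suc d)) t (invℕ (suc d)) ⟩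
  fromℕℚ (suc d) * invℕ (suc d) * t       ≡⟨ cong (_* t) (fromℕℚ*invℕ d) ⟩
  1ℚ * t                                  ≡⟨ ℚ.*-identityˡ t ⟩
  t                                       ∎
  where open ≡-Reasoning

module _ {d : ℕ} (1≤d : 1 ℕ.≤ d) where

  proj-InH : ∀ (x : Vect d) → InH (proj x)
  proj-InH x = begin
    sumF (λ p → x p + (- (S * I)))
      ≡⟨ sumF-+ x (λ _ → - (S * I)) ⟩
    S + sumF {d} (λ _ → - (S * I))
      ≡⟨ cong (S +_) (sumF-const d (- (S * I))) ⟩
    S + fromℕℚ d * (- (S * I))
      ≡⟨ solve 3 (λ s m i → s :+ m :* (:- (s :* i)) := s :- (m :* s) :* i) refl S (fromℕℚ d) I ⟩
    S - (fromℕℚ d * S) * I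
      ≡⟨ cong (λ z → S - z * I) (sym (sumF-const d S)) ⟩
    S - sumF {d} (λ _ → S) * I
      ≡⟨ cong (λ z → S - z) (sumF-const*invℕ 1≤d S) ⟩
    S - S
      ≡⟨ ℚ.+-inverseʳ S ⟩
    0ℚ ∎
    where
    open ≡-Reasoning
    S I : ℚ
    S = sumF x
    I = invℕ d

  proj-const : ∀ {x : Vect d} t → (∀ p → x p ≡ t) → ∀ p → proj x p ≡ 0ℚ
  proj-const {x} t eq p = begin
    x p - sumF x * invℕ d                  ≡⟨ cong₂ (λ a b → a - b * invℕ d) (eq p) (sumF-cong eq) ⟩
    t - sumF {d} (λ _ → t) * invℕ d        ≡⟨ cong (λ z → t - z) (sumF-const*invℕ 1≤d t) ⟩
    t - t                                  ≡⟨ ℚ.+-inverseʳ t ⟩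
    0ℚ                                     ∎
    where open ≡-Reasoning

InH⇒proj≡ : ∀ {d} {x : Vect d} → InH x → ∀ p → proj x p ≡ x p
InH⇒proj≡ {d} {x} x∈H p = trans (cong (λ z → x p - z * invℕ d) x∈H)
  (solve 2 (λ x i → x :- con 0ℚ :* i := x) refl (x p) (invℕ d))

proj-sumW : ∀ {d s N} (φ : Word s N → ℚ) (g : Word s N → Vect d) p →
  sumW (λ w → φ w * proj (g w) p) ≡
  sumW (λ w → φ w * g w p) - sumF (λ q → sumW (λ w → φ w * g w q)) * invℕ d
proj-sumW {d} φ g p = begin
  sumW (λ w → φ w * (g w p - sumF (g w) * I))
    ≡⟨ sumW-cong (λ w → solve 4 (λ φ g s i → φ :* (g :- s :* i) := φ :* g :+ φ :* s :* (:- i)) refl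
         (φ w) (g w p) (sumF (g w)) I) ⟩
  sumW (λ w → φ w * g w p + φ w * sumF (g w) * (- I))
    ≡⟨ sumW-+ (λ w → φ w * g w p) (λ w → φ w * sumF (g w) * (- I)) ⟩
  X + sumW (λ w → φ w * sumF (g w) * (- I))
    ≡⟨ cong (X +_) (sumW-*ʳ (λ w → φ w * sumF (g w)) (- I)) ⟩
  X + sumW (λ w → φ w * sumF (g w)) * (- I)
    ≡⟨ cong (λ z → X + z * (- I)) (sym (trans (sumF-sumW (λ p w → φ w * g w p)) (sumW-cong λ w → sumF-*ˡ (φ w) (g w)))) ⟩
  X + sumF (λ q → sumW (λ w → φ w * g w q)) * (- I)
    ≡⟨ cong (X +_) (sym (ℚ.neg-distribʳ-* (sumF (λ q → sumW (λ w → φ w * g w q))) I)) ⟩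
  X - sumF (λ q → sumW (λ w → φ w * g w q)) * I ∎
  where
  open ≡-Reasoning
  I X : ℚ
  I = invℕ d
  X = sumW (λ w → φ w * g w p)

-- Point masses and enumeration of words

δ : ∀ {s N} → Word s N → Word s N → ℚ
δ (skip w)  (skip w')  = δ w w'
δ (skip w)  (start p') = 0ℚ
δ (start p) (skip w')  = 0ℚ
δ (start p) (start p') = δ p p'
δ end       end        = 1ℚ
δ end       (up p')    = 0ℚ
δ end       (dn p')    = 0ℚ
δ (up p)    end        = 0ℚ
δ (up p)    (up p')    = δ p p'
δ (up p)    (dn p')    = 0ℚ
δ (dn p)    end        = 0ℚ
δ (dn p)    (up p')    = 0ℚ
δ (dn p)    (dn p')    = δ p p'

δ-refl : ∀ {s N} (w : Word s N) → δ w w ≡ 1ℚ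
δ-refl (skip w)  = δ-refl w
δ-refl (start p) = δ-refl p
δ-refl end       = refl
δ-refl (up p)    = δ-refl p
δ-refl (dn p)    = δ-refl p

δ-zero⊎≡ : ∀ {s N} (w w' : Word s N) → δ w w' ≡ 0ℚ ⊎ w ≡ w'
δ-zero⊎≡ (skip w)  (skip w')  = Sum.map₂ (cong skip) (δ-zero⊎≡ w w')
δ-zero⊎≡ (skip w)  (start p') = inj₁ refl
δ-zero⊎≡ (start p) (skip w')  = inj₁ refl
δ-zero⊎≡ (start p) (start p') = Sum.map₂ (cong start) (δ-zero⊎≡ p p')
δ-zero⊎≡ end       end        = inj₂ refl
δ-zero⊎≡ end       (up p')    = inj₁ refl
δ-zero⊎≡ end       (dn p')    = inj₁ refl
δ-zero⊎≡ (up p)    end        = inj₁ refl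
δ-zero⊎≡ (up p)    (up p')    = Sum.map₂ (cong up) (δ-zero⊎≡ p p')
δ-zero⊎≡ (up p)    (dn p')    = inj₁ refl
δ-zero⊎≡ (dn p)    end        = inj₁ refl
δ-zero⊎≡ (dn p)    (up p')    = inj₁ refl
δ-zero⊎≡ (dn p)    (dn p')    = Sum.map₂ (cong dn) (δ-zero⊎≡ p p')

δ-≢ : ∀ {s N} {w w' : Word s N} → w ≢ w' → δ w w' ≡ 0ℚ
δ-≢ {w = w} {w'} neq with δ-zero⊎≡ w w'
... | inj₁ eq = eq
... | inj₂ eq = contradiction eq neq

_≟ʷ_ : ∀ {s N} (w w' : Word s N) → Dec (w ≡ w')
w ≟ʷ w' with δ-zero⊎≡ w w'
... | inj₁ eq = no λ { refl → contradiction (trans (sym (δ-refl w)) eq) λ () }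
... | inj₂ eq = yes eq

δ-nonneg : ∀ {s N} (w w' : Word s N) → 0ℚ ≤ δ w w'
δ-nonneg w w' with δ-zero⊎≡ w w'
... | inj₁ eq   = ℚ.≤-reflexive (sym eq)
... | inj₂ refl = subst (0ℚ ≤_) (sym (δ-refl w)) (ℚ.nonNegative⁻¹ 1ℚ)

sumW-δ : ∀ {s N} (w : Word s N) (f : Word s N → ℚ) → sumW (λ w' → δ w w' * f w') ≡ f w
sumW-δ (skip w)  f = trans (cong₂ _+_ (sumW-δ w (f ∘ skip)) (sumW-zero λ q → ℚ.*-zeroˡ (f (start q))))
  (ℚ.+-identityʳ (f (skip w)))
sumW-δ (start p) f = trans (cong₂ _+_ (sumW-zero λ w → ℚ.*-zeroˡ (f (skip w))) (sumW-δ p (f ∘ start)))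
  (ℚ.+-identityˡ (f (start p)))
sumW-δ end       f = trans
  (cong₂ _+_ (ℚ.*-identityˡ (f end))
    (cong₂ _+_ (sumW-zero λ q → ℚ.*-zeroˡ (f (up q))) (sumW-zero λ q → ℚ.*-zeroˡ (f (dn q)))))
  (ℚ.+-identityʳ (f end))
sumW-δ (up p)    f = trans
  (cong₂ _+_ (ℚ.*-zeroˡ (f end)) (cong₂ _+_ (sumW-δ p (f ∘ up)) (sumW-zero λ q → ℚ.*-zeroˡ (f (dn q)))))
  (solve 1 (λ a → con 0ℚ :+ (a :+ con 0ℚ) := a) refl (f (up p)))
sumW-δ (dn p)    f = trans
  (cong₂ _+_ (ℚ.*-zeroˡ (f end)) (cong₂ _+_ (sumW-zero λ q → ℚ.*-zeroˡ (f (up q))) (sumW-δ p (f ∘ dn))))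
  (solve 1 (λ a → con 0ℚ :+ (con 0ℚ :+ a) := a) refl (f (dn p)))

-- Weights are functions on all words, whereas faces are lists of arcs; the enumeration allows the
-- support of a weight function to be listed.
words : ∀ s N → List (Word s N)
words s    zero    = []
words idle (suc N) = map skip (words idle N) ++ map start (words live N)
words live (suc N) = end ∷ map up (words live N) ++ map dn (words live N)

∈-words : ∀ {s N} (w : Word s N) → w ∈ˡ words s N
∈-words (skip w)  = ∈-++⁺ˡ (∈-map⁺ skip (∈-words w))
∈-words (start p) = ∈-++⁺ʳ _ (∈-map⁺ start (∈-words p))
∈-words end       = here refl
∈-words (up p)    = there (∈-++⁺ˡ (∈-map⁺ up (∈-words p)))
∈-words {N = suc N} (dn p) = there (∈-++⁺ʳ (map up (words live N)) (∈-map⁺ dn (∈-words p)))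

words-unique : ∀ s N → Unique (words s N)
words-unique idle zero    = []
words-unique live zero    = []
words-unique idle (suc N) = Unique.++⁺
  (Unique.map⁺ (λ { refl → refl }) (words-unique idle N))
  (Unique.map⁺ (λ { refl → refl }) (words-unique live N))
  λ (x , y) → let _ , _ , eq = ∈-map⁻ skip x ; _ , _ , eq' = ∈-map⁻ start y in
    contradiction (trans (sym eq) eq') λ ()
words-unique live (suc N) =
  All.++⁺ (All.map⁺ {f = up} (All.tabulate {xs = words live N} λ _ ()))
          (All.map⁺ {f = dn} (All.tabulate {xs = words live N} λ _ ())) ∷
  Unique.++⁺
    (Unique.map⁺ (λ { refl → refl }) (words-unique live N))
    (Unique.map⁺ (λ { refl → refl }) (words-unique live N))
    λ (x , y) → let _ , _ , eq = ∈-map⁻ up x ; _ , _ , eq' = ∈-map⁻ dn y in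
      contradiction (trans (sym eq) eq') λ ()

-- The external arcs

uniform : Bool → ∀ n → Word live (suc n)
uniform b     zero    = end
uniform true  (suc n) = up (uniform true n)
uniform false (suc n) = dn (uniform false n)

module _ (n : ℕ) where
  external : Bool → Word idle (suc (suc n))
  external b = start (uniform b n)

-- No letter is over `above`, and only `above` is over `last`; the uniform word has `last` at the
-- final point, where no word passes above.
¬Above-uniform : ∀ n {s} (w : Word s (suc n)) → ¬ Above (letter w) (letter (uniform true n))
¬Above-uniform zero    end       (zero , ())
¬Above-uniform zero    (skip ())
¬Above-uniform zero    (start ())
¬Above-uniform zero    (up ())
¬Above-uniform zero    (dn ())
¬Above-uniform (suc n) w         (zero , o)  = ¬Over-above o
  where
  ¬Over-above : ∀ {x} → ¬ Over x above
  ¬Over-above ()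
¬Above-uniform (suc n) (skip w)  (suc k , o) = ¬Above-uniform n w (k , o)
¬Above-uniform (suc n) (start w) (suc k , o) = ¬Above-uniform n w (k , o)
¬Above-uniform (suc n) (up w)    (suc k , o) = ¬Above-uniform n w (k , o)
¬Above-uniform (suc n) (dn w)    (suc k , o) = ¬Above-uniform n w (k , o)
¬Above-uniform (suc n) end       (suc k , ())

¬uniform-Above : ∀ n {s} (w : Word s (suc n)) → ¬ Above (letter (uniform false n)) (letter w)
¬uniform-Above zero    end       (zero , ())
¬uniform-Above zero    (skip ())
¬uniform-Above zero    (start ())
¬uniform-Above zero    (up ())
¬uniform-Above zero    (dn ())
¬uniform-Above (suc n) w         (zero , ())
¬uniform-Above (suc n) (skip w)  (suc k , o) = ¬uniform-Above n w (k , o)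
¬uniform-Above (suc n) (start w) (suc k , o) = ¬uniform-Above n w (k , o)
¬uniform-Above (suc n) (up w)    (suc k , o) = ¬uniform-Above n w (k , o)
¬uniform-Above (suc n) (dn w)    (suc k , o) = ¬uniform-Above n w (k , o)
¬uniform-Above (suc n) end       (suc k , o) = ¬Over-none o

-- The only endpoint of the uniform word is its end at the final point, where no word starts.
¬Clash-uniform : ∀ b n {s} (w : Word s (suc n)) k → ¬ Clash (letter (uniform b n) k) (letter w k)
¬Clash-uniform b     zero    end       zero    ()
¬Clash-uniform b     zero    (skip ())
¬Clash-uniform b     zero    (start ())
¬Clash-uniform b     zero    (up ())
¬Clash-uniform b     zero    (dn ())
¬Clash-uniform true  (suc n) w         zero    ()
¬Clash-uniform false (suc n) w         zero    ()
¬Clash-uniform true  (suc n) (skip w)  (suc k) c = ¬Clash-uniform true n w k c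
¬Clash-uniform true  (suc n) (start w) (suc k) c = ¬Clash-uniform true n w k c
¬Clash-uniform true  (suc n) (up w)    (suc k) c = ¬Clash-uniform true n w k c
¬Clash-uniform true  (suc n) (dn w)    (suc k) c = ¬Clash-uniform true n w k c
¬Clash-uniform false (suc n) (skip w)  (suc k) c = ¬Clash-uniform false n w k c
¬Clash-uniform false (suc n) (start w) (suc k) c = ¬Clash-uniform false n w k c
¬Clash-uniform false (suc n) (up w)    (suc k) c = ¬Clash-uniform false n w k c
¬Clash-uniform false (suc n) (dn w)    (suc k) c = ¬Clash-uniform false n w k c
¬Clash-uniform b     (suc n) end       (suc k) c = ¬Clash-none c
  where
  ¬Clash-none : ∀ {x} → ¬ Clash x none
  ¬Clash-none ()

uniform-compat : ∀ b n {s} (w : Word s (suc n)) → Compat (letter (uniform b n)) (letter w)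
uniform-compat true  n w = ¬Clash-uniform true n w , λ (_ , a) → ¬Above-uniform n w a
uniform-compat false n w = ¬Clash-uniform false n w , λ (a , _) → ¬uniform-Above n w a

external-compat : ∀ {n} b (w : Word idle (suc (suc n))) → Compat (letter (external n b)) (letter w)
external-compat {n} b (skip w)  = Compat-cons (λ ()) (λ ()) (λ ()) (uniform-compat b n w)
external-compat {n} b (start p) = Compat-cons (λ ()) (λ ()) (λ ()) (uniform-compat b n p)

side : Bool → Letter
side true  = above
side false = below

uniform-letter : ∀ b {n} (k : Fin n) → letter (uniform b n) (inject₁ k) ≡ side b
uniform-letter true  zero    = refl
uniform-letter false zero    = refl
uniform-letter true  (suc k) = uniform-letter true k
uniform-letter false (suc k) = uniform-letter false k

uniform-characterisation : ∀ b {n} (p : Word live (suc n)) →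
  (∀ (k : Fin n) → letter p (inject₁ k) ≡ side b) → p ≡ uniform b n
uniform-characterisation b     {zero}  end    h = refl
uniform-characterisation b     {zero}  (up ()) h
uniform-characterisation b     {zero}  (dn ()) h
uniform-characterisation true  {suc n} (up p) h = cong up (uniform-characterisation true p (h ∘ suc))
uniform-characterisation true  {suc n} (dn p) h = contradiction (h zero) λ ()
uniform-characterisation true  {suc n} end    h = contradiction (h zero) λ ()
uniform-characterisation false {suc n} (dn p) h = cong dn (uniform-characterisation false p (h ∘ suc))
uniform-characterisation false {suc n} (up p) h = contradiction (h zero) λ ()
uniform-characterisation false {suc n} end    h = contradiction (h zero) λ ()

lastPt-uniform : ∀ b n → toℕ (lastPt (uniform b n)) ≡ n
lastPt-uniform b     zero    = refl
lastPt-uniform true  (suc n) = cong suc (lastPt-uniform true n)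
lastPt-uniform false (suc n) = cong suc (lastPt-uniform false n)

inner : ∀ {n} (k : Pt n) → InBracket n k → ∃ λ (k' : Fin n) → k ≡ innerPt k'
inner {n} (suc k) (_ , lt) = fromℕ< lt , cong suc (Fin.toℕ-injective
  (sym (trans (Fin.toℕ-inject₁ (fromℕ< lt)) (Fin.toℕ-fromℕ< lt))))

innerPt-inBracket : ∀ {n} (k : Fin n) → InBracket n (innerPt k)
innerPt-inBracket {n} k = s≤s z≤n , subst (λ m → suc m ℕ.≤ n) (sym (Fin.toℕ-inject₁ k)) (Fin.toℕ<n k)

interior-inBracket : ∀ {n} b k → Interior (letter (external n b) k) → InBracket n k
interior-inBracket {n} b k int =
  first<interior (external n b) k int ,
  ℕ.s≤s⁻¹ (subst (toℕ k ℕ.<_) (cong suc (lastPt-uniform b n)) (interior<last (external n b) k int))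

external-isExternal : ∀ {n} b → IsExternal (fromWord (external n b))
external-isExternal {n} true  = refl , cong suc (lastPt-uniform true n) , inj₁
  ( (λ k k∈ → interior-inBracket true k
      (subst Interior (sym (∈abovePts⇒above (external n true) k k∈)) above))
  , λ k ib → let k' , eq = inner k ib in
      above⇒∈abovePts (external n true) k (trans (cong (letter (external n true)) eq) (uniform-letter true k')) )
external-isExternal {n} false = refl , cong suc (lastPt-uniform false n) , inj₂
  ( (λ k k∈ → interior-inBracket false k
      (subst Interior (sym (InB⇒below (external n false) k k∈)) below))
  , λ k ib → let k' , eq = inner k ib in
      below⇒InB (external n false) k (trans (cong (letter (external n false)) eq) (uniform-letter false k')) )

IsExternal⇒external : ∀ {n} (w : Word idle (suc (suc n))) → IsExternal (fromWord w) → ∃ λ b → w ≡ external n b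
IsExternal⇒external (skip w)  (() , _)
IsExternal⇒external (start p) (_ , _ , inj₁ (_ , h)) = true , cong start
  (uniform-characterisation true p λ k → ∈abovePts⇒above (start p) (innerPt k) (h _ (innerPt-inBracket k)))
IsExternal⇒external (start p) (_ , _ , inj₂ (_ , h)) = false , cong start
  (uniform-characterisation false p λ k → InB⇒below (start p) (innerPt k) (h _ (innerPt-inBracket k)))

-- Coordinates

parity : ∀ m → ∃ λ h → m ≡ 2 ℕ.* h ⊎ m ≡ suc (2 ℕ.* h)
parity zero = zero , inj₁ refl
parity (suc m) with parity m
... | h , inj₁ eq = h , inj₂ (cong suc eq)
... | h , inj₂ eq = suc h , inj₁ (trans (cong suc eq) (sym (2*suc h)))

oddIndex evenIndex : ∀ {n} → Fin n → Fin (2 ℕ.* n)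
oddIndex {n} k = fromℕ< {2 ℕ.* toℕ k} (ℕ.*-monoʳ-< 2 (Fin.toℕ<n k))
evenIndex {n} k = fromℕ< {suc (2 ℕ.* toℕ k)}
  (subst (ℕ._≤ 2 ℕ.* n) (2*suc (toℕ k)) (ℕ.*-monoʳ-≤ 2 (Fin.toℕ<n k)))

index-cases : ∀ {n} (p : Fin (2 ℕ.* n)) → ∃ λ (k : Fin n) → p ≡ oddIndex k ⊎ p ≡ evenIndex k
index-cases {n} p with parity (toℕ p)
... | h , inj₁ eq = fromℕ< h<n , inj₁ (Fin.toℕ-injective
      (trans eq (trans (cong (2 ℕ.*_) (sym (Fin.toℕ-fromℕ< h<n))) (sym (Fin.toℕ-fromℕ< _)))))
  where
  h<n : h ℕ.< n
  h<n = ℕ.*-cancelˡ-< 2 h n (subst (ℕ._< 2 ℕ.* n) eq (Fin.toℕ<n p))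
... | h , inj₂ eq = fromℕ< h<n , inj₂ (Fin.toℕ-injective
      (trans eq (trans (cong (λ m → suc (2 ℕ.* m)) (sym (Fin.toℕ-fromℕ< h<n))) (sym (Fin.toℕ-fromℕ< _)))))
  where
  h<n : h ℕ.< n
  h<n = ℕ.*-cancelˡ-< 2 h n (ℕ.<-trans (ℕ.n<1+n _) (subst (ℕ._< 2 ℕ.* n) eq (Fin.toℕ<n p)))

module _ {n : ℕ} where

  ĝ g : Word idle (suc (suc n)) → Vect (2 ℕ.* n)
  ĝ w = ghat (fromWord w)
  g w = gvec (fromWord w)

  ĝ-odd : ∀ w k → ĝ w (oddIndex k) ≡ val₁ (letter w (innerPt k))
  ĝ-odd w k = ghat-odd k w (oddIndex k) (Fin.toℕ-fromℕ< _)

  ĝ-even : ∀ w k → ĝ w (evenIndex k) ≡ val₂ (letter w (innerPt k))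
  ĝ-even w k = ghat-even k w (evenIndex k) (Fin.toℕ-fromℕ< _)

  sign : Bool → ℚ
  sign true  = 1ℚ
  sign false = - 1ℚ

  ĝ-external : ∀ b p → ĝ (external n b) p ≡ sign b
  ĝ-external b p with index-cases {n} p
  ... | k , inj₁ refl = trans (ĝ-odd (external n b) k) (trans (cong val₁ (uniform-letter b k)) (val₁-side b))
    where
    val₁-side : ∀ b → val₁ (side b) ≡ sign b
    val₁-side true  = refl
    val₁-side false = refl
  ... | k , inj₂ refl = trans (ĝ-even (external n b) k) (trans (cong val₂ (uniform-letter b k)) (val₂-side b))
    where
    val₂-side : ∀ b → val₂ (side b) ≡ sign b
    val₂-side true  = refl
    val₂-side false = refl

  -- Coherent weights and their uniqueness

  Weights : Set
  Weights = Word idle (suc (suc n)) → ℚ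

  -- The weights as a family seen from point 1, where the words starting at point 0 are live.
  asFamily : Weights → Fam (suc n)
  asFamily φ idle w = φ (skip w)
  asFamily φ live p = φ (start p)

  CoherentW : Weights → Set
  CoherentW φ = ∀ w w' → 0ℚ < φ w → 0ℚ < φ w' → Compat (letter w) (letter w')

  asFamily-coherent : ∀ {φ} → CoherentW φ → Coherent (asFamily φ)
  asFamily-coherent coh {idle} {idle} w w' h h' = Compat-tail (coh (skip w) (skip w') h h')
  asFamily-coherent coh {idle} {live} w w' h h' = Compat-tail (coh (skip w) (start w') h h')
  asFamily-coherent coh {live} {idle} w w' h h' = Compat-tail (coh (start w) (skip w') h h')
  asFamily-coherent coh {live} {live} w w' h h' = Compat-tail (coh (start w) (start w') h h')

  asFamily-nonneg : ∀ {φ} → (∀ w → 0ℚ ≤ φ w) → Nonneg (asFamily φ)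
  asFamily-nonneg nn idle w = nn (skip w)
  asFamily-nonneg nn live p = nn (start p)

  coord₁-asFamily : ∀ φ k → coord val₁ (asFamily φ) (inject₁ k) ≡ sumW (λ w → φ w * ĝ w (oddIndex k))
  coord₁-asFamily φ k = sym (sumW-cong λ w → cong (φ w *_) (ĝ-odd w k))

  coord₂-asFamily : ∀ φ k → coord val₂ (asFamily φ) (inject₁ k) ≡ sumW (λ w → φ w * ĝ w (evenIndex k))
  coord₂-asFamily φ k = sym (sumW-cong λ w → cong (φ w *_) (ĝ-even w k))

  -- Point 0 has no coordinates, so the sweep begins at point 1, and the total weight starting at
  -- point 0 serves as its initial live weight.
  weights-unique : ∀ {φ φ' : Weights} → (∀ w → 0ℚ ≤ φ w) → (∀ w → 0ℚ ≤ φ' w) →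
    CoherentW φ → CoherentW φ' → sumW (φ ∘ start) ≡ sumW (φ' ∘ start) →
    (∀ p → sumW (λ w → φ w * ĝ w p) ≡ sumW (λ w → φ' w * ĝ w p)) → ∀ w → φ w ≡ φ' w
  weights-unique {φ} {φ'} nn nn' coh coh' tot eq = result
    where
    equal : ∀ s w → asFamily φ s w ≡ asFamily φ' s w
    equal = coherent-unique n (asFamily-nonneg nn) (asFamily-nonneg nn')
      (asFamily-coherent coh) (asFamily-coherent coh') tot
      (λ k → trans (coord₁-asFamily φ k) (trans (eq (oddIndex k)) (sym (coord₁-asFamily φ' k))))
      (λ k → trans (coord₂-asFamily φ k) (trans (eq (evenIndex k)) (sym (coord₂-asFamily φ' k))))
    result : ∀ w → φ w ≡ φ' w
    result (skip w)  = equal idle w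
    result (start p) = equal live p

  -- Two independent adjustments that preserve coherence: a true + a false is added to the total
  -- starting at point 0, and a true - a false to every coordinate.
  module AddExternal (φ : Weights) (nn : ∀ w → 0ℚ ≤ φ w) (coh : CoherentW φ)
    (a : Bool → ℚ) (0≤a : ∀ b → 0ℚ ≤ a b) where

    ext : Bool → Weights
    ext b w = δ (external n b) w * a b

    added : Weights
    added w = φ w + (ext true w + ext false w)

    added-nonneg : ∀ w → 0ℚ ≤ added w
    added-nonneg w = +-nonneg (nn w)
      (+-nonneg (*-nonneg (δ-nonneg (external n true) w) (0≤a true))
                (*-nonneg (δ-nonneg (external n false) w) (0≤a false)))

    private
      ext-positive : ∀ b w → 0ℚ < ext b w → external n b ≡ w
      ext-positive b w h with δ-zero⊎≡ (external n b) w
      ... | inj₁ eq = ⊥-elim (ℚ.<-irrefl (sym (trans (cong (_* a b) eq) (ℚ.*-zeroˡ (a b)))) h)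
      ... | inj₂ eq = eq

      added-positive : ∀ w → 0ℚ < added w → 0ℚ < φ w ⊎ ∃ λ b → external n b ≡ w
      added-positive w h with pos-+ {φ w} h
      ... | inj₁ h' = inj₁ h'
      ... | inj₂ h' with pos-+ {ext true w} h'
      ...   | inj₁ h'' = inj₂ (true , ext-positive true w h'')
      ...   | inj₂ h'' = inj₂ (false , ext-positive false w h'')

    added-coherent : CoherentW added
    added-coherent w w' h h' with added-positive w h | added-positive w' h'
    ... | inj₂ (b , refl) | _               = external-compat b w'
    ... | inj₁ _          | inj₂ (b , refl) = Compat-sym (external-compat b w)
    ... | inj₁ h₁         | inj₁ h₁'        = coh w w' h₁ h₁'

    private
      sumW-ext-start : ∀ b → sumW (ext b ∘ start) ≡ a b
      sumW-ext-start b = sumW-δ (uniform b n) (λ _ → a b)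

      sumW-ext-ĝ : ∀ b p → sumW (λ w → ext b w * ĝ w p) ≡ a b * sign b
      sumW-ext-ĝ b p = trans
        (sumW-cong λ w → ℚ.*-assoc (δ (external n b) w) (a b) (ĝ w p))
        (trans (sumW-δ (external n b) (λ w → a b * ĝ w p)) (cong (a b *_) (ĝ-external b p)))

    sumW-added-start : sumW (added ∘ start) ≡ sumW (φ ∘ start) + (a true + a false)
    sumW-added-start = trans (sumW-+ (φ ∘ start) (λ p → ext true (start p) + ext false (start p)))
      (cong (sumW (φ ∘ start) +_) (trans (sumW-+ (ext true ∘ start) (ext false ∘ start))
        (cong₂ _+_ (sumW-ext-start true) (sumW-ext-start false))))

    sumW-added-ĝ : ∀ p → sumW (λ w → added w * ĝ w p) ≡ sumW (λ w → φ w * ĝ w p) + (a true - a false)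
    sumW-added-ĝ p = begin
      sumW (λ w → added w * ĝ w p)
        ≡⟨ sumW-cong (λ w → solve 4 (λ φ x y g → (φ :+ (x :+ y)) :* g := φ :* g :+ (x :* g :+ y :* g)) refl
             (φ w) (ext true w) (ext false w) (ĝ w p)) ⟩
      sumW (λ w → φ w * ĝ w p + (ext true w * ĝ w p + ext false w * ĝ w p))
        ≡⟨ sumW-+ (λ w → φ w * ĝ w p) (λ w → ext true w * ĝ w p + ext false w * ĝ w p) ⟩
      X + sumW (λ w → ext true w * ĝ w p + ext false w * ĝ w p)
        ≡⟨ cong (X +_) (sumW-+ (λ w → ext true w * ĝ w p) (λ w → ext false w * ĝ w p)) ⟩
      X + (sumW (λ w → ext true w * ĝ w p) + sumW (λ w → ext false w * ĝ w p))
        ≡⟨ cong (X +_) (cong₂ _+_ (sumW-ext-ĝ true p) (sumW-ext-ĝ false p)) ⟩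
      X + (a true * 1ℚ + a false * - 1ℚ)
        ≡⟨ cong (X +_) (solve 2 (λ s t → s :* con 1ℚ :+ t :* con (- 1ℚ) := s :- t) refl (a true) (a false)) ⟩
      X + (a true - a false) ∎
      where
      open ≡-Reasoning
      X : ℚ
      X = sumW (λ w → φ w * ĝ w p)

  -- Equality of the projections determines the sums of the ĝ up to a constant vector;
  -- suitable multiples of the two external arcs absorb that constant and equalise
  -- the total weights starting at point 0.
  internal-weights-unique : ∀ {φ φ' : Weights} → (∀ w → 0ℚ ≤ φ w) → (∀ w → 0ℚ ≤ φ' w) →
    CoherentW φ → CoherentW φ' →
    (∀ b → φ (external n b) ≡ 0ℚ) → (∀ b → φ' (external n b) ≡ 0ℚ) →
    (∀ p → sumW (λ w → φ w * g w p) ≡ sumW (λ w → φ' w * g w p)) → ∀ w → φ w ≡ φ' w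
  internal-weights-unique {φ} {φ'} nn nn' coh coh' ext0 ext0' eq w = result (is-external w)
    where
    open ≡-Reasoning
    t t' τ σ : ℚ
    t  = sumF (λ q → sumW (λ w → φ w * ĝ w q)) * invℕ (2 ℕ.* n)
    t' = sumF (λ q → sumW (λ w → φ' w * ĝ w q)) * invℕ (2 ℕ.* n)
    τ = t' - t
    σ = sumW (φ' ∘ start) - sumW (φ ∘ start)

    η a a' : Bool → ℚ
    -- Chosen so that η true + η false = σ, the difference of the totals, and η true - η false = τ,
    -- the shift between the coordinates. As η may be negative, its positive part is added to φ and
    -- its negative part to φ', which keeps all weights nonnegative.
    η true  = ½ * (σ + τ)
    η false = ½ * (σ - τ)
    a  b = pos-part (η b)
    a' b = pos-part (- η b)

    a-a' : ∀ b → a b ≡ η b + a' b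
    a-a' b = trans (solve 2 (λ x y → x := (x :- y) :+ y) refl (a b) (a' b))
                   (cong (_+ a' b) (pos-part-difference (η b)))

    module E  = AddExternal φ nn coh a (λ b → pos-part-nonneg (η b))
    module E' = AddExternal φ' nn' coh' a' (λ b → pos-part-nonneg (- η b))

    totals : sumW (E.added ∘ start) ≡ sumW (E'.added ∘ start)
    totals = begin
      sumW (E.added ∘ start)
        ≡⟨ E.sumW-added-start ⟩
      s + (a true + a false)
        ≡⟨ cong₂ (λ x y → s + (x + y)) (a-a' true) (a-a' false) ⟩
      s + ((η true + a' true) + (η false + a' false))
        ≡⟨ solve 5 (λ s s' t x y → s :+ ((con ½ :* ((s' :- s) :+ t) :+ x) :+ (con ½ :* ((s' :- s) :- t) :+ y))
             := s' :+ (x :+ y)) refl s s' τ (a' true) (a' false) ⟩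
      s' + (a' true + a' false)
        ≡⟨ sym E'.sumW-added-start ⟩
      sumW (E'.added ∘ start) ∎
      where
      s s' : ℚ
      s  = sumW (φ ∘ start)
      s' = sumW (φ' ∘ start)

    coords : ∀ p → sumW (λ w → E.added w * ĝ w p) ≡ sumW (λ w → E'.added w * ĝ w p)
    coords p = begin
      sumW (λ w → E.added w * ĝ w p)
        ≡⟨ E.sumW-added-ĝ p ⟩
      X + (a true - a false)
        ≡⟨ cong₂ (λ x y → X + (x - y)) (a-a' true) (a-a' false) ⟩
      X + ((η true + a' true) - (η false + a' false))
        ≡⟨ solve 6 (λ X t t' σ x y →
             X :+ ((con ½ :* (σ :+ (t' :- t)) :+ x) :- (con ½ :* (σ :- (t' :- t)) :+ y))
             := ((X :- t) :+ t') :+ (x :- y)) refl X t t' σ (a' true) (a' false) ⟩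
      ((X - t) + t') + (a' true - a' false)
        ≡⟨ cong (λ z → (z + t') + (a' true - a' false))
             (trans (sym (proj-sumW φ ĝ p)) (trans (eq p) (proj-sumW φ' ĝ p))) ⟩
      ((X' - t') + t') + (a' true - a' false)
        ≡⟨ cong (_+ (a' true - a' false)) (solve 2 (λ x t → (x :- t) :+ t := x) refl X' t') ⟩
      X' + (a' true - a' false)
        ≡⟨ sym (E'.sumW-added-ĝ p) ⟩
      sumW (λ w → E'.added w * ĝ w p) ∎
      where
      X X' : ℚ
      X  = sumW (λ w → φ w * ĝ w p)
      X' = sumW (λ w → φ' w * ĝ w p)

    added≡ : E.added w ≡ E'.added w
    added≡ = weights-unique E.added-nonneg E'.added-nonneg E.added-coherent E'.added-coherent totals coords w

    is-external : ∀ w → (∃ λ b → external n b ≡ w) ⊎ (∀ b → δ (external n b) w ≡ 0ℚ)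
    is-external w with δ-zero⊎≡ (external n true) w | δ-zero⊎≡ (external n false) w
    ... | inj₂ e | _      = inj₁ (true , e)
    ... | inj₁ _ | inj₂ e = inj₁ (false , e)
    ... | inj₁ e | inj₁ e' = inj₂ λ { true → e ; false → e' }

    result : (∃ λ b → external n b ≡ w) ⊎ (∀ b → δ (external n b) w ≡ 0ℚ) → φ w ≡ φ' w
    result (inj₁ (b , refl)) = trans (ext0 b) (sym (ext0' b))
    result (inj₂ z) = +-cancelʳ
      (trans (vanish (E.ext) (λ b → trans (cong (_* a b) (z b)) (ℚ.*-zeroˡ (a b))))
             (sym (vanish (E'.ext) (λ b → trans (cong (_* a' b) (z b)) (ℚ.*-zeroˡ (a' b))))))
      added≡
      where
      vanish : ∀ (f : Bool → Weights) → (∀ b → f b w ≡ 0ℚ) → f true w + f false w ≡ 0ℚ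
      vanish f h = cong₂ _+_ (h true) (h false)

-- Cones in terms of weights

module _ {n : ℕ} where

  SupportedOn : List (Arc n) → Weights {n} → Set
  SupportedOn D φ = ∀ w → 0ℚ < φ w → fromWord w ∈ˡ D

  -- The cones of all faces are described by functions on the same set of words, so that
  -- representations of a vector in different cones can be compared.
  WeightedCone : List (Arc n) → Vect (2 ℕ.* n) → Set
  WeightedCone D x = Σ (Weights {n}) λ φ → (∀ w → 0ℚ ≤ φ w) × SupportedOn D φ ×
    (∀ p → x p ≡ sumW (λ w → φ w * g w p))

  weight : (D : List (Arc n)) → (Fin (length (gvecs D)) → ℚ) → Weights {n}
  weight []      c w = 0ℚ
  weight (α ∷ D) c w = δ (toWord α) w * c zero + weight D (c ∘ suc) w

  weight-nonneg : ∀ (D : List (Arc n)) {c} → (∀ k → 0ℚ ≤ c k) → ∀ w → 0ℚ ≤ weight D c w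
  weight-nonneg []      0≤c w = ℚ.≤-refl
  weight-nonneg (α ∷ D) 0≤c w =
    +-nonneg (*-nonneg (δ-nonneg (toWord α) w) (0≤c zero)) (weight-nonneg D (0≤c ∘ suc) w)

  weight-outside : ∀ (D : List (Arc n)) c w → fromWord w ∉ˡ D → weight D c w ≡ 0ℚ
  weight-outside []      c w w∉ = refl
  weight-outside (α ∷ D) c w w∉ = trans
    (cong₂ _+_ (cong (_* c zero) (δ-≢ λ eq → w∉ (here (trans (cong fromWord (sym eq)) (fromWord-toWord α)))))
               (weight-outside D (c ∘ suc) w (w∉ ∘ there)))
    (trans (ℚ.+-identityʳ (0ℚ * c zero)) (ℚ.*-zeroˡ (c zero)))

  weight-supported : ∀ (D : List (Arc n)) c → SupportedOn D (weight D c)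
  weight-supported []      c w h = ⊥-elim (ℚ.<-irrefl refl h)
  weight-supported (α ∷ D) c w h with δ-zero⊎≡ (toWord α) w
  ... | inj₂ eq = here (trans (cong fromWord (sym eq)) (fromWord-toWord α))
  ... | inj₁ eq = there (weight-supported D (c ∘ suc) w (subst (0ℚ <_)
          (trans (cong (λ z → z * c zero + weight D (c ∘ suc) w) eq)
            (solve 2 (λ c x → con 0ℚ :* c :+ x := x) refl (c zero) (weight D (c ∘ suc) w))) h))

  comb-weight : ∀ (D : List (Arc n)) c p → comb (gvecs D) c p ≡ sumW (λ w → weight D c w * g w p)
  comb-weight []      c p = sym (sumW-zero {idle} {suc (suc n)} λ w → ℚ.*-zeroˡ (g {n} w p))
  comb-weight (α ∷ D) c p = begin
    c zero * gvec α p + comb (gvecs D) (c ∘ suc) p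
      ≡⟨ cong₂ (λ β z → c zero * gvec β p + z) (sym (fromWord-toWord α)) (comb-weight D (c ∘ suc) p) ⟩
    c zero * g (toWord α) p + sumW (λ w → weight D (c ∘ suc) w * g w p)
      ≡⟨ cong (_+ sumW (λ w → weight D (c ∘ suc) w * g w p)) (sym (sumW-δ (toWord α) (λ w → c zero * g w p))) ⟩
    sumW (λ w → δ (toWord α) w * (c zero * g w p)) + sumW (λ w → weight D (c ∘ suc) w * g w p)
      ≡⟨ sym (sumW-+ (λ w → δ (toWord α) w * (c zero * g w p)) (λ w → weight D (c ∘ suc) w * g w p)) ⟩
    sumW (λ w → δ (toWord α) w * (c zero * g w p) + weight D (c ∘ suc) w * g w p)
      ≡⟨ sumW-cong (λ w → solve 4 (λ d c g x → d :* (c :* g) :+ x :* g := (d :* c :+ x) :* g) refl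
           (δ (toWord α) w) (c zero) (g w p) (weight D (c ∘ suc) w)) ⟩
    sumW (λ w → weight (α ∷ D) c w * g w p) ∎
    where open ≡-Reasoning

  -- The index type is that of the coefficients of `gvecs D`, which avoids transport between the
  -- lengths of the two lists.
  nth : ∀ (D : List (Arc n)) → Fin (length (gvecs {n} D)) → Arc n
  nth (α ∷ D) zero    = α
  nth (α ∷ D) (suc k) = nth D k

  nth∈ : ∀ (D : List (Arc n)) k → nth D k ∈ˡ D
  nth∈ (α ∷ D) zero    = here refl
  nth∈ (α ∷ D) (suc k) = there (nth∈ D k)

  ∈⇒nth : ∀ {α} (D : List (Arc n)) → α ∈ˡ D → ∃ λ k → nth D k ≡ α
  ∈⇒nth (α ∷ D) (here refl) = zero , refl
  ∈⇒nth (β ∷ D) (there α∈) = let k , eq = ∈⇒nth D α∈ in suc k , eq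

  lookup-gvecs : ∀ (D : List (Arc n)) k → L.lookup (gvecs D) k ≡ gvec (nth D k)
  lookup-gvecs (α ∷ D) zero    = refl
  lookup-gvecs (α ∷ D) (suc k) = lookup-gvecs D k

  toWord-injective : ∀ {α β : Arc n} → toWord α ≡ toWord β → α ≡ β
  toWord-injective {α} {β} eq = trans (sym (fromWord-toWord α)) (trans (cong fromWord eq) (fromWord-toWord β))

  -- As D has no repetitions, no two coefficients are added up on one word, so the weights give the
  -- coefficients back.
  weight-nth : ∀ (D : List (Arc n)) → Unique D → ∀ c k → weight D c (toWord (nth D k)) ≡ c k
  weight-nth (α ∷ D) (α∉ ∷ u) c zero = trans
    (cong₂ (λ x y → x * c zero + y) (δ-refl (toWord α))
      (weight-outside D (c ∘ suc) (toWord α) λ α∈ →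
        All.lookup α∉ α∈ (sym (fromWord-toWord α))))
    (solve 1 (λ c → con 1ℚ :* c :+ con 0ℚ := c) refl (c zero))
  weight-nth (α ∷ D) (α∉ ∷ u) c (suc k) = trans
    (cong₂ (λ x y → x * c zero + y) (δ-≢ (All.lookup α∉ (nth∈ D k) ∘ toWord-injective))
      (weight-nth D u (c ∘ suc) k))
    (solve 2 (λ c x → con 0ℚ :* c :+ x := x) refl (c zero) (c (suc k)))

  Cone⇒WeightedCone : ∀ (D : List (Arc n)) {x} → Cone (gvecs D) x → WeightedCone D x
  Cone⇒WeightedCone D (c , 0≤c , eq) =
    weight D c , weight-nonneg D 0≤c , weight-supported D c , λ p → trans (eq p) (comb-weight D c p)

  unsupported : ∀ {D : List (Arc n)} {φ} → (∀ w → 0ℚ ≤ φ w) → SupportedOn D φ → ∀ w → fromWord w ∉ˡ D → φ w ≡ 0ℚ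
  unsupported nn supp w w∉ = sym (≤∧≮⇒≡ (nn w) (w∉ ∘ supp w))

  WeightedCone⇒Cone : ∀ (D : List (Arc n)) {x} → Unique D → WeightedCone D x → Cone (gvecs D) x
  WeightedCone⇒Cone D {x} u (φ , nn , supp , eq) = c , (λ k → nn (toWord (nth D k))) , λ p →
    trans (eq p) (sym (trans (comb-weight D c p) (sumW-cong λ w → cong (_* g w p) (weight≡ w))))
    where
    c : Fin (length (gvecs D)) → ℚ
    c k = φ (toWord (nth D k))

    on-support : ∀ w → fromWord w ∈ˡ D → weight D c w ≡ φ w
    on-support w w∈ with ∈⇒nth D w∈
    ... | k , eq' = subst (λ v → weight D c v ≡ φ v)
          (trans (cong toWord eq') (toWord-fromWord w)) (weight-nth D u c k)

    weight≡ : ∀ w → weight D c w ≡ φ w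
    weight≡ w with 0ℚ ℚ.<? φ w | 0ℚ ℚ.<? weight D c w
    ... | yes h | _     = on-support w (supp w h)
    ... | no _  | yes h = on-support w (weight-supported D c w h)
    ... | no h  | no h' = trans
          (sym (≤∧≮⇒≡ (weight-nonneg D (λ k → nn (toWord (nth D k))) w) h')) (≤∧≮⇒≡ (nn w) h)

  fromWord-injective : ∀ {w w' : Word idle (suc (suc n))} → fromWord w ≡ fromWord w' → w ≡ w'
  fromWord-injective {w} {w'} eq = trans (sym (toWord-fromWord w)) (trans (cong toWord eq) (toWord-fromWord w'))

  face-coherent : ∀ {D : List (Arc n)} {φ} → WigglyFace n D → SupportedOn D φ → CoherentW φ
  face-coherent (_ , _ , compat) supp w w' h h' with w ≟ʷ w'
  ... | yes refl = Compat-refl (letter w)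
  ... | no  w≢w' = Compatible⇒Compat w w' (compat _ _ (supp w h) (supp w' h') (w≢w' ∘ fromWord-injective))

  face-external : ∀ {D : List (Arc n)} {φ} → WigglyFace n D → (∀ w → 0ℚ ≤ φ w) → SupportedOn D φ →
    ∀ b → φ (external n b) ≡ 0ℚ
  face-external (_ , int , _) nn supp b =
    unsupported nn supp (external n b) λ w∈ → All.lookup int w∈ (external-isExternal b)

  -- Taking the same face twice gives linear independence; two different faces give the intersection
  -- property.
  face-weights-unique : ∀ {D D' : List (Arc n)} {φ φ'} → WigglyFace n D → WigglyFace n D' →
    (∀ w → 0ℚ ≤ φ w) → (∀ w → 0ℚ ≤ φ' w) → SupportedOn D φ → SupportedOn D' φ' →
    (∀ p → sumW (λ w → φ w * g w p) ≡ sumW (λ w → φ' w * g w p)) → ∀ w → φ w ≡ φ' w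
  face-weights-unique F F' nn nn' supp supp' = internal-weights-unique nn nn'
    (face-coherent F supp) (face-coherent F' supp') (face-external F nn supp) (face-external F' nn' supp')

  -- The positive and the negative parts of the coefficients of a vanishing combination represent
  -- the same vector with nonnegative weights, so they agree by uniqueness.
  face-LinIndep : ∀ (D : List (Arc n)) → WigglyFace n D → LinIndep (gvecs D)
  face-LinIndep D F@(u , _) c eq k = begin
    c k                                                   ≡⟨ sym (pos-part-difference (c k)) ⟩
    c⁺ k - c⁻ k                                           ≡⟨ cong (_- c⁻ k) c⁺≡c⁻ ⟩
    c⁻ k - c⁻ k                                           ≡⟨ ℚ.+-inverseʳ (c⁻ k) ⟩
    0ℚ                                                    ∎
    where
    open ≡-Reasoning
    c⁺ c⁻ : Fin (length (gvecs D)) → ℚ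
    c⁺ k = pos-part (c k)
    c⁻ k = pos-part (- c k)

    combs : ∀ p → comb (gvecs D) c⁺ p ≡ comb (gvecs D) c⁻ p
    combs p = begin
      comb (gvecs D) c⁺ p
        ≡⟨ sumF-cong (λ k → cong (_* L.lookup (gvecs D) k p)
             (trans (solve 2 (λ x y → x := y :+ con 1ℚ :* (x :- y)) refl (c⁺ k) (c⁻ k))
                    (cong (λ z → c⁻ k + 1ℚ * z) (pos-part-difference (c k))))) ⟩
      comb (gvecs D) (λ k → c⁻ k + 1ℚ * c k) p
        ≡⟨ comb-linear (gvecs D) c⁻ c 1ℚ p ⟩
      comb (gvecs D) c⁻ p + 1ℚ * comb (gvecs D) c p
        ≡⟨ cong (λ z → comb (gvecs D) c⁻ p + 1ℚ * z) (eq p) ⟩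
      comb (gvecs D) c⁻ p + 1ℚ * 0ℚ
        ≡⟨ solve 1 (λ x → x :+ con 1ℚ :* con 0ℚ := x) refl (comb (gvecs D) c⁻ p) ⟩
      comb (gvecs D) c⁻ p ∎

    c⁺≡c⁻ : c⁺ k ≡ c⁻ k
    c⁺≡c⁻ = trans (sym (weight-nth D u c⁺ k)) (trans
      (face-weights-unique F F (weight-nonneg D (λ k → pos-part-nonneg (c k)))
        (weight-nonneg D (λ k → pos-part-nonneg (- c k)))
        (weight-supported D c⁺) (weight-supported D c⁻)
        (λ p → trans (sym (comb-weight D c⁺ p)) (trans (combs p) (comb-weight D c⁻ p)))
        (toWord (nth D k)))
      (weight-nth D u c⁻ k))

  -- Faces and intersections of cones

  dot-weighted : ∀ f {x} (φ : Weights {n}) → (∀ p → x p ≡ sumW (λ w → φ w * g w p)) →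
    dot f x ≡ sumW (λ w → φ w * dot f (g w))
  dot-weighted f φ eq = trans (dot-cong f eq) (dot-sumW f φ g)

  module _ {D : List (Arc n)} (f : Vect (2 ℕ.* n)) (0≤f : ∀ α → α ∈ˡ D → 0ℚ ≤ dot f (gvec α))
    {φ : Weights {n}} (nn : ∀ w → 0ℚ ≤ φ w) (supp : SupportedOn D φ) where

    term-nonneg : ∀ w → 0ℚ ≤ φ w * dot f (g w)
    term-nonneg w with 0ℚ ℚ.<? φ w
    ... | yes h = *-nonneg (nn w) (0≤f _ (supp w h))
    ... | no  h = ℚ.≤-reflexive (sym (trans (cong (_* dot f (g w)) (sym (≤∧≮⇒≡ (nn w) h))) (ℚ.*-zeroˡ (dot f (g w)))))

    dot-zero⇒ : sumW (λ w → φ w * dot f (g w)) ≡ 0ℚ → ∀ w → 0ℚ < φ w → dot f (g w) ≡ 0ℚ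
    dot-zero⇒ eq w h with inverse (φ w) (λ z → ℚ.<-irrefl (sym z) h)
    ... | r , rφ≡1 = begin
      dot f (g w)               ≡⟨ sym (ℚ.*-identityˡ _) ⟩
      1ℚ * dot f (g w)          ≡⟨ cong (_* dot f (g w)) (sym rφ≡1) ⟩
      r * φ w * dot f (g w)     ≡⟨ ℚ.*-assoc r (φ w) _ ⟩
      r * (φ w * dot f (g w))   ≡⟨ cong (r *_) (sumW-zero⁻¹ term-nonneg eq w) ⟩
      r * 0ℚ                    ≡⟨ ℚ.*-zeroʳ r ⟩
      0ℚ                        ∎
      where open ≡-Reasoning

  dot-zero⇐ : ∀ f {φ : Weights {n}} → (∀ w → 0ℚ ≤ φ w) → (∀ w → 0ℚ < φ w → dot f (g w) ≡ 0ℚ) →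
    sumW (λ w → φ w * dot f (g w)) ≡ 0ℚ
  dot-zero⇐ f {φ} nn h = sumW-zero λ w → term w
    where
    term : ∀ w → φ w * dot f (g w) ≡ 0ℚ
    term w with 0ℚ ℚ.<? φ w
    ... | yes pos = trans (cong (φ w *_) (h w pos)) (ℚ.*-zeroʳ (φ w))
    ... | no ¬pos = trans (cong (_* dot f (g w)) (sym (≤∧≮⇒≡ (nn w) ¬pos))) (ℚ.*-zeroˡ (dot f (g w)))

  gvec∈Cone : ∀ {D : List (Arc n)} → Unique D → ∀ α → α ∈ˡ D → Cone (gvecs D) (gvec α)
  gvec∈Cone {D} u α α∈ = WeightedCone⇒Cone D u
    ( δ (toWord α) , δ-nonneg (toWord α)
    , (λ w h → supported w h (δ-zero⊎≡ (toWord α) w))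
    , λ p → trans (cong (λ β → gvec β p) (sym (fromWord-toWord α))) (sym (sumW-δ (toWord α) (λ w → g w p))))
    where
    supported : ∀ w → 0ℚ < δ (toWord α) w → δ (toWord α) w ≡ 0ℚ ⊎ toWord α ≡ w → fromWord w ∈ˡ D
    supported w h (inj₁ z)    = ⊥-elim (ℚ.<-irrefl (sym z) h)
    supported w h (inj₂ refl) = subst (_∈ˡ D) (sym (fromWord-toWord α)) α∈

  WigglyFace-filter : ∀ {P : Arc n → Set} (P? : ∀ α → Dec (P α)) {D : List (Arc n)} →
    WigglyFace n D → WigglyFace n (filter P? D)
  WigglyFace-filter P? (u , int , compat) =
    Unique.filter⁺ P? u , All.filter⁺ P? int ,
    λ α β α∈ β∈ → compat α β (proj₁ (∈-filter⁻ P? α∈)) (proj₁ (∈-filter⁻ P? β∈))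

  module _ {D : List (Arc n)} (F : WigglyFace n D) (f : Vect (2 ℕ.* n))
    (0≤f : ∀ α → α ∈ˡ D → 0ℚ ≤ dot f (gvec α)) where

    private
      vanishes? : ∀ (α : Arc n) → Dec (dot f (gvec α) ≡ 0ℚ)
      vanishes? α = dot f (gvec α) ℚ.≟ 0ℚ

    -- Since f is nonnegative on the generators, it kills a nonnegative combination exactly when it
    -- kills every generator of positive weight. The face cut out by f is therefore generated by a
    -- part of D.
    vanishing : List (Arc n)
    vanishing = filter vanishes? D

    vanishing-face : WigglyFace n vanishing
    vanishing-face = WigglyFace-filter vanishes? F

    vanishing⇒ : ∀ {x} → WeightedCone vanishing x → WeightedCone D x × dot f x ≡ 0ℚ
    vanishing⇒ (φ , nn , supp , eq) =
      (φ , nn , (λ w h → proj₁ (∈-filter⁻ vanishes? (supp w h))) , eq) ,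
      trans (dot-weighted f φ eq) (dot-zero⇐ f nn λ w h → proj₂ (∈-filter⁻ vanishes? {xs = D} (supp w h)))

    vanishing⇐ : ∀ {x} → WeightedCone D x → dot f x ≡ 0ℚ → WeightedCone vanishing x
    vanishing⇐ (φ , nn , supp , eq) dot≡0 = φ , nn ,
      (λ w h → ∈-filter⁺ vanishes? (supp w h)
        (dot-zero⇒ f 0≤f nn supp (trans (sym (dot-weighted f φ eq)) dot≡0) w h)) , eq

  face-of-cone : ∀ (D : List (Arc n)) → WigglyFace n D → (F : Vect (2 ℕ.* n) → Set) →
    IsFaceOf F (Cone (gvecs D)) → ∃ λ D' → WigglyFace n D' × SameSet (Cone (gvecs D')) F
  face-of-cone D face@(u , _) F (f , 0≤f , same) = vanishing face f 0≤g , vanishing-face face f 0≤g , λ x →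
    (λ x∈ → let x∈D , eq = vanishing⇒ face f 0≤g (Cone⇒WeightedCone _ x∈) in
      proj₂ (same x) (WeightedCone⇒Cone D u x∈D , eq)) ,
    λ x∈ → let x∈D , eq = proj₁ (same x) x∈ in
      WeightedCone⇒Cone _ (proj₁ (vanishing-face face f 0≤g))
        (vanishing⇐ face f 0≤g (Cone⇒WeightedCone D x∈D) eq)
    where
    0≤g : ∀ α → α ∈ˡ D → 0ℚ ≤ dot f (gvec α)
    0≤g α α∈ = 0≤f (gvec α) (gvec∈Cone u α α∈)

  _≟ᵃ_ : (α β : Arc n) → Dec (α ≡ β)
  α ≟ᵃ β with toWord α ≟ʷ toWord β
  ... | yes eq = yes (toWord-injective eq)
  ... | no neq = no (neq ∘ cong toWord)

  open import Data.List.Membership.DecPropositional _≟ᵃ_ using (_∈?_)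

  private
    avoids : List (Arc n) → Arc n → ℚ
    avoids D' α with α ∈? D'
    ... | yes _ = 0ℚ
    ... | no  _ = 1ℚ

    avoids-nonneg : ∀ D' α → 0ℚ ≤ avoids D' α
    avoids-nonneg D' α with α ∈? D'
    ... | yes _ = ℚ.≤-refl
    ... | no  _ = ℚ.nonNegative⁻¹ 1ℚ

    avoids-zero⇒∈ : ∀ D' α → avoids D' α ≡ 0ℚ → α ∈ˡ D'
    avoids-zero⇒∈ D' α eq with α ∈? D'
    ... | yes α∈ = α∈
    ... | no _   = contradiction eq λ ()

    ∈⇒avoids-zero : ∀ D' α → α ∈ˡ D' → avoids D' α ≡ 0ℚ
    ∈⇒avoids-zero D' α α∈ with α ∈? D'
    ... | yes _ = refl
    ... | no α∉ = contradiction α∈ α∉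

  module _ {D D' : List (Arc n)} (F : WigglyFace n D) (F' : WigglyFace n D') (f : Vect (2 ℕ.* n))
    (f-gvec : ∀ α → α ∈ˡ D → dot f (gvec α) ≡ avoids D' α) where

    private
      0≤f : ∀ α → α ∈ˡ D → 0ℚ ≤ dot f (gvec α)
      0≤f α α∈ = subst (0ℚ ≤_) (sym (f-gvec α α∈)) (avoids-nonneg D' α)

    dual-nonneg : ∀ {x} → WeightedCone D x → 0ℚ ≤ dot f x
    dual-nonneg (φ , nn , supp , eq) =
      subst (0ℚ ≤_) (sym (dot-weighted f φ eq)) (sumW-nonneg (term-nonneg f 0≤f nn supp))

    -- A common vector has the same weights in both cones, so its support lies in D' too, and f
    -- vanishes on the arcs of D that belong to D'.
    dual-zero⇐ : ∀ {x} → WeightedCone D x → WeightedCone D' x → dot f x ≡ 0ℚ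
    dual-zero⇐ (φ , nn , supp , eq) (φ' , nn' , supp' , eq') =
      trans (dot-weighted f φ eq) (dot-zero⇐ f nn λ w h →
        trans (f-gvec (fromWord w) (supp w h)) (∈⇒avoids-zero D' (fromWord w)
          (supp' w (subst (0ℚ <_) (φ≡φ' w) h))))
      where
      φ≡φ' : ∀ w → φ w ≡ φ' w
      φ≡φ' = face-weights-unique F F' nn nn' supp supp' (λ p → trans (sym (eq p)) (eq' p))

    -- Arcs of D outside D' have the value 1 under f and so can carry no weight; the same weights
    -- then represent x in the cone of D'.
    dual-zero⇒ : ∀ {x} → WeightedCone D x → dot f x ≡ 0ℚ → WeightedCone D' x
    dual-zero⇒ (φ , nn , supp , eq) dot≡0 = φ , nn , (λ w h →
      avoids-zero⇒∈ D' (fromWord w) (trans (sym (f-gvec (fromWord w) (supp w h)))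
        (dot-zero⇒ f 0≤f nn supp (trans (sym (dot-weighted f φ eq)) dot≡0) w h))) , eq

    dual-face : IsFaceOf (Cone (gvecs D) ∩ Cone (gvecs D')) (Cone (gvecs D))
    dual-face = f , (λ x x∈ → dual-nonneg (Cone⇒WeightedCone D x∈)) , λ x →
      (λ (x∈ , x∈') → x∈ , dual-zero⇐ (Cone⇒WeightedCone D x∈) (Cone⇒WeightedCone D' x∈')) ,
      λ (x∈ , eq) → x∈ , WeightedCone⇒Cone D' (proj₁ F') (dual-zero⇒ (Cone⇒WeightedCone D x∈) eq)

  -- By linear independence some functional vanishes on the common generators
  -- and equals 1 on the other generators of the first cone.
  intersection-face : ∀ (D D' : List (Arc n)) → WigglyFace n D → WigglyFace n D' →
    IsFaceOf (Cone (gvecs D) ∩ Cone (gvecs D')) (Cone (gvecs D))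
  intersection-face D D' F F' =
    by-functional (dual-functional (gvecs D) (face-LinIndep D F) (λ k → avoids D' (nth D k)))
    where
    by-functional : (∃ λ (f : Vect (2 ℕ.* n)) → ∀ k → dot f (L.lookup (gvecs D) k) ≡ avoids D' (nth D k)) →
      IsFaceOf (Cone (gvecs D) ∩ Cone (gvecs D')) (Cone (gvecs D))
    by-functional (f , f-dual) = dual-face F F' f on-generators
      where
      at-nth : ∀ k → dot f (gvec (nth D k)) ≡ avoids D' (nth D k)
      at-nth k = subst (λ v → dot f v ≡ avoids D' (nth D k)) (lookup-gvecs D k) (f-dual k)
      on-generators : ∀ (α : Arc n) → α ∈ˡ D → dot f (gvec α) ≡ avoids D' α
      on-generators α α∈ = let k , eq = ∈⇒nth D α∈ in
        subst (λ β → dot f (gvec β) ≡ avoids D' β) eq (at-nth k)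

  cone⊆H : 1 ℕ.≤ n → ∀ (D : List (Arc n)) x → Cone (gvecs D) x → InH x
  cone⊆H 1≤n D x x∈ = let φ , _ , _ , eq = Cone⇒WeightedCone D x∈ in begin
    sumF x                                     ≡⟨ sumF-cong eq ⟩
    sumF (λ p → sumW (λ w → φ w * g w p))      ≡⟨ sumF-sumW (λ p w → φ w * g w p) ⟩
    sumW (λ w → sumF (λ p → φ w * g w p))      ≡⟨ sumW-zero (λ w → trans (sumF-*ˡ (φ w) (g w))
                                                    (trans (cong (φ w *_) (proj-InH 1≤2n (ĝ w))) (ℚ.*-zeroʳ (φ w)))) ⟩
    0ℚ                                         ∎
    where
    open ≡-Reasoning
    1≤2n : 1 ℕ.≤ 2 ℕ.* n
    1≤2n = ℕ.≤-trans 1≤n (ℕ.m≤m+n n (n ℕ.+ 0))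

  -- Completeness

  module _ (φ : Weights {n}) where

    private
      positive? : ∀ w → Dec (0ℚ < φ w)
      positive? w = 0ℚ ℚ.<? φ w

      support : List (Word idle (suc (suc n)))
      support = filter positive? (words idle (suc (suc n)))

    supportArcs : List (Arc n)
    supportArcs = map fromWord support

    supportArcs-supported : SupportedOn supportArcs φ
    supportArcs-supported w h = ∈-map⁺ fromWord (∈-filter⁺ positive? (∈-words w) h)

    private
      supportArcs⁻ : ∀ {α} → α ∈ˡ supportArcs → ∃ λ w → 0ℚ < φ w × α ≡ fromWord w
      supportArcs⁻ α∈ = let w , w∈ , eq = ∈-map⁻ fromWord α∈ in
        w , proj₂ (∈-filter⁻ positive? {xs = words idle (suc (suc n))} w∈) , eq

    supportArcs-face : CoherentW φ → (∀ b → φ (external n b) ≡ 0ℚ) → WigglyFace n supportArcs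
    supportArcs-face coh ext0 =
      Unique.map⁺ fromWord-injective
        (Unique.filter⁺ positive? (words-unique idle (suc (suc n)))) ,
      All.tabulate (λ α∈ → internal (supportArcs⁻ α∈)) ,
      λ α β α∈ β∈ _ → compatible (supportArcs⁻ α∈) (supportArcs⁻ β∈)
      where
      internal : ∀ {α} → (∃ λ w → 0ℚ < φ w × α ≡ fromWord w) → Internal α
      internal (w , h , refl) isExt = let b , eq = IsExternal⇒external w isExt in
        ℚ.<-irrefl (sym (trans (cong φ eq) (ext0 b))) h
      compatible : ∀ {α β} → (∃ λ w → 0ℚ < φ w × α ≡ fromWord w) →
        (∃ λ w → 0ℚ < φ w × β ≡ fromWord w) → Compatible α β
      compatible (w , h , refl) (w' , h' , refl) = Compat⇒Compatible w w' (coh w w' h h')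

  removeExternal : Weights {n} → Weights {n}
  removeExternal ψ w with w ≟ʷ external n true | w ≟ʷ external n false
  ... | no _  | no _  = ψ w
  ... | yes _ | _     = 0ℚ
  ... | no _  | yes _ = 0ℚ

  removeExternal-nonneg : ∀ {ψ} → (∀ w → 0ℚ ≤ ψ w) → ∀ w → 0ℚ ≤ removeExternal ψ w
  removeExternal-nonneg nn w with w ≟ʷ external n true | w ≟ʷ external n false
  ... | no _  | no _  = nn w
  ... | yes _ | _     = ℚ.≤-refl
  ... | no _  | yes _ = ℚ.≤-refl

  removeExternal-positive : ∀ ψ w → 0ℚ < removeExternal ψ w → 0ℚ < ψ w
  removeExternal-positive ψ w h with w ≟ʷ external n true | w ≟ʷ external n false
  ... | no _  | no _  = h
  ... | yes _ | _     = ⊥-elim (ℚ.<-irrefl refl h)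
  ... | no _  | yes _ = ⊥-elim (ℚ.<-irrefl refl h)

  removeExternal-external : ∀ ψ b → removeExternal ψ (external n b) ≡ 0ℚ
  removeExternal-external ψ b
    with external n b ≟ʷ external n true | external n b ≟ʷ external n false
  ... | yes _  | _      = refl
  ... | no _   | yes _  = refl
  removeExternal-external ψ true  | no neq | no _   = contradiction refl neq
  removeExternal-external ψ false | no _   | no neq = contradiction refl neq

  -- Meant for h a coordinate of `g`, which is zero on the external arcs: dropping their weights
  -- leaves the projected sum unchanged.
  removeExternal-* : ∀ ψ {h : Weights {n}} → (∀ b → h (external n b) ≡ 0ℚ) →
    ∀ w → ψ w * h w ≡ removeExternal ψ w * h w
  removeExternal-* ψ {h} h0 w with w ≟ʷ external n true | w ≟ʷ external n false
  ... | no _     | no _     = refl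
  ... | yes refl | _        = trans (cong (ψ w *_) (h0 true)) (trans (ℚ.*-zeroʳ (ψ w)) (sym (ℚ.*-zeroˡ (h w))))
  ... | no _     | yes refl = trans (cong (ψ w *_) (h0 false)) (trans (ℚ.*-zeroʳ (ψ w)) (sym (ℚ.*-zeroˡ (h w))))

  record Representation (x : Vect (2 ℕ.* n)) : Set where
    field
      ψ          : Weights {n}
      ψ-nonneg   : ∀ w → 0ℚ ≤ ψ w
      ψ-coherent : CoherentW ψ
      ψ-ĝ        : ∀ p → sumW (λ w → ψ w * ĝ w p) ≡ x p

  represent : ∀ x → Representation x
  represent x = record { ψ = ψ ; ψ-nonneg = ψ-nonneg ; ψ-coherent = ψ-coherent ; ψ-ĝ = ψ-ĝ }
    where
    -- The total is the least one that `realise` accepts here. A larger one would yield the same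
    -- weights on internal arcs, by `internal-weights-unique`.
    open Realisation (realise n (x ∘ oddIndex) (x ∘ evenIndex) _ ℚ.≤-refl)

    ψ : Weights {n}
    ψ (skip w)  = family idle w
    ψ (start p) = family live p

    ψ-nonneg : ∀ w → 0ℚ ≤ ψ w
    ψ-nonneg (skip w)  = nonneg idle w
    ψ-nonneg (start p) = nonneg live p

    ψ-coherent : CoherentW ψ
    ψ-coherent (skip w)  (skip w')  h h' = Compat-cons (λ ()) (λ ()) (λ ()) (coherent w w' h h')
    ψ-coherent (skip w)  (start p') h h' = Compat-cons (λ ()) (λ ()) (λ ()) (coherent w p' h h')
    ψ-coherent (start p) (skip w')  h h' = Compat-cons (λ ()) (λ ()) (λ ()) (coherent p w' h h')
    ψ-coherent (start p) (start p') h h' = Compat-cons (λ ()) (λ ()) (λ ()) (coherent p p' h h')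

    ψ-ĝ : ∀ p → sumW (λ w → ψ w * ĝ w p) ≡ x p
    ψ-ĝ p with index-cases {n} p
    ... | k , inj₁ refl = trans (sumW-cong λ w → cong (ψ w *_) (ĝ-odd w k)) (coord₁ k)
    ... | k , inj₂ refl = trans (sumW-cong λ w → cong (ψ w *_) (ĝ-even w k)) (coord₂ k)

  complete : 1 ℕ.≤ n → IsCompleteIn-H (WigglyFace n) (λ D → Cone (gvecs D))
  complete 1≤n x x∈H = from-representation (represent x)
    where
    open ≡-Reasoning
    from-representation : Representation x → ∃ λ D → WigglyFace n D × Cone (gvecs D) x
    from-representation R = supportArcs φ , face ,
      WeightedCone⇒Cone (supportArcs φ) (proj₁ face)
        (φ , removeExternal-nonneg ψ-nonneg , supportArcs-supported φ , x≡)
      where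
      open Representation R
      φ : Weights {n}
      φ = removeExternal ψ

      face : WigglyFace n (supportArcs φ)
      face = supportArcs-face φ
        (λ w w' h h' → ψ-coherent w w' (removeExternal-positive ψ w h) (removeExternal-positive ψ w' h'))
        (removeExternal-external ψ)

      g-external : ∀ p b → g {n} (external n b) p ≡ 0ℚ
      g-external p b =
        proj-const (ℕ.≤-trans 1≤n (ℕ.m≤m+n n (n ℕ.+ 0))) {ĝ (external n b)} (sign {n} b) (ĝ-external {n} b) p

      x≡ : ∀ p → x p ≡ sumW (λ w → φ w * g w p)
      x≡ p = begin
        x p
          ≡⟨ sym (InH⇒proj≡ x∈H p) ⟩
        x p - sumF x * invℕ (2 ℕ.* n)
          ≡⟨ sym (cong₂ (λ a b → a - b * invℕ (2 ℕ.* n)) (ψ-ĝ p) (sumF-cong ψ-ĝ)) ⟩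
        sumW (λ w → ψ w * ĝ w p) - sumF (λ q → sumW (λ w → ψ w * ĝ w q)) * invℕ (2 ℕ.* n)
          ≡⟨ sym (proj-sumW ψ ĝ p) ⟩
        sumW (λ w → ψ w * g w p)
          ≡⟨ sumW-cong (removeExternal-* ψ {λ w → g w p} (g-external p)) ⟩
        sumW (λ w → φ w * g w p) ∎

theorem3p9 : (n : ℕ) → 1 ℕ.≤ n →
    (∀ (D : List (Arc n)) → WigglyFace n D → LinIndep (gvecs D)) ×
    IsFanIn-H (WigglyFace n) (λ D → Cone (gvecs D)) ×
    IsCompleteIn-H (WigglyFace n) (λ D → Cone (gvecs D))
theorem3p9 n 1≤n =
  face-LinIndep ,
  ( (λ D _ → cone⊆H 1≤n D)
  , face-of-cone
  , λ D D' F F' → intersection-face D D' F F' , swap-face (intersection-face D' D F' F) ) ,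
  complete 1≤n
  where
  swap-face : ∀ {d} {S T C : Vect d → Set} → IsFaceOf (S ∩ T) C → IsFaceOf (T ∩ S) C
  swap-face (f , 0≤f , same) = f , 0≤f , λ x →
    (λ (t , s) → proj₁ (same x) (s , t)) , λ h → swap (proj₂ (same x) h)
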